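{- Fix an integer $r\ge 4$, and reals $a>0$, $b\ge 1$, and $0<\delta<1/(r-1)$. Let $(G_N)$ be a sequence of graphs with $t_N=\chi_{\mathrm f}(G_N)\to\infty$ as $N\to\infty$. Suppose each $G_N$ has a $(<r)$-cycle clique cover $\mathcal K_N$ such that, for all sufficiently large $N$, $$b(\mathcal K_N)\le b,\qquad I(\mathcal K_N)\le N^a,\qquad |K|\le N\quad(K\in\mathcal K_N).$$ Assume additionally that the subgraph of $G_N$ induced by the vertices not lying in any clique of $\mathcal K_N$ has fractional chromatic number $o(t_N)$. If $$\frac{N^{ -1+\delta}t_N}{\log t_N}\to\infty,$$ then $h_r^{\mathrm f}(G_N)\to\infty$. More quantitatively, for $p_N=N^{ -1+\delta}$, $$h_r^{\mathrm f}(G_N)\ge c\,\frac{p_Nt_N}{\log t_N}$$ for all large $N$, where $c>0$ depends only on $r,a,b,\delta$.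
   Context: All graphs are finite and simple; subgraphs need not be induced unless stated. $\chi_{\mathrm f}$ is the fractional chromatic number, with $\chi_{\mathrm f}(\emptyset)=0$; $\log$ is natural. The girth of a forest is $\infty$. $h_r^{\mathrm f}(G)=\max\{\chi_{\mathrm f}(H):H\subseteq G,\ \operatorname{girth}(H)\ge r\}$. A family $\mathcal K$ of cliques (complete subgraphs) of $G$ is a $(<r)$-cycle clique cover if every cycle of $G$ of length less than $r$ is contained in some member of $\mathcal K$. Its vertex-incidence number is $I(\mathcal K)=\sum_{K\in\mathcal K}|V(K)|$ and its local overlap is $b(\mathcal K)=\max_{v\in V(G)}|\{K\in\mathcal K: v\in V(K)\}|$. $|K|$ denotes the number of vertices of the clique $K$. -}

module Defs where

open import Level using (0ℓ)
open import Algebra.Bundles using (CommutativeRing)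
import Algebra.Properties.Semiring.Exp as SemiringExp
import Algebra.Properties.Semiring.Mult as SemiringMult
open import Data.Bool.Base using (Bool; T; _∧_)
open import Data.Bool.Properties using (T-∧; T-≡)
open import Data.Fin.Base as Fin using (Fin)
open import Data.Fin.Subset using (Subset; _∈_; _⊆_; _∩_; ∁; ⋃; ∣_∣; inside; outside)
open import Data.Fin.Subset.Properties using (_∈?_; x∈p∩q⁺)
open import Data.List.Base as List using (List; []; _∷_; _++_; allFin; length; filter)
open import Data.List.Extrema.Nat using (max)
open import Data.List.Relation.Unary.All using (All)
open import Data.List.Relation.Unary.Any using (Any)
open import Data.Nat.Base as ℕ using (ℕ; zero; suc; _!)
open import Data.Product.Base using (∃; ∃-syntax; _×_; _,_; proj₁; proj₂)
open import Data.Sum.Base using (_⊎_)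
open import Data.Vec.Base as Vec using (lookup)
open import Data.Vec.Properties using (lookup⇒[]=)
open import Function.Bundles using (Equivalence)
open import Function.Definitions using (Injective)
open import Relation.Binary.Core using (Rel)
open import Relation.Binary.Structures using (IsStrictTotalOrder)
open import Relation.Binary.PropositionalEquality using (_≡_; _≢_)
open import Relation.Nullary.Negation.Core using (¬_)

-- The real numbers, given axiomatically: a Dedekind-complete ordered field is
-- unique up to isomorphism.  The axioms are the classical ones: `<` satisfies
-- trichotomy, and whatever lies below a supremum lies below a member of the set.
-- Both `_⁻¹` and `sup` are total; `0# ⁻¹`, and `sup P` for P empty or
-- unbounded above, are unspecified.
record CompleteOrderedField : Set₁ where
  infix  4 _<_ _≤_
  infixl 7 _/_
  infix  8 _⁻¹
  field
    commutativeRing : CommutativeRing 0ℓ 0ℓ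

  open CommutativeRing commutativeRing public
    using (Carrier; _≈_; _+_; _*_; -_; 0#; 1#; semiring)

  field
    _<_                : Rel Carrier 0ℓ
    isStrictTotalOrder : IsStrictTotalOrder _≈_ _<_
    0<1                : 0# < 1#
    +-monoʳ-<          : ∀ x {y z} → y < z → x + y < x + z
    *-pos              : ∀ {x y} → 0# < x → 0# < y → 0# < x * y
    _⁻¹                : Carrier → Carrier
    ⁻¹-cong            : ∀ {x y} → x ≈ y → x ⁻¹ ≈ y ⁻¹
    *-inverseʳ         : ∀ {x} → ¬ x ≈ 0# → x * x ⁻¹ ≈ 1#

  _≤_ : Rel Carrier 0ℓ
  x ≤ y = x < y ⊎ x ≈ y

  _/_ : Carrier → Carrier → Carrier
  x / y = x * y ⁻¹

  UpperBound : (Carrier → Set) → Carrier → Set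
  UpperBound P u = ∀ x → P x → x ≤ u

  field
    sup        : (Carrier → Set) → Carrier
    sup-upper  : ∀ {P} → ∃ P → ∃ (UpperBound P) → UpperBound P (sup P)
    sup-approx : ∀ {P} → ∃ P → ∃ (UpperBound P) →
                 ∀ {y} → y < sup P → ∃[ x ] (P x × y < x)

Eventually : (ℕ → Set) → Set
Eventually P = ∃[ N₀ ] (∀ N → N₀ ℕ.≤ N → P N)

module RealAnalysis (ℝ : CompleteOrderedField) where
  open CompleteOrderedField ℝ
  private
    module Exp  = SemiringExp semiring
    module Mult = SemiringMult semiring

  infixr 8 _^_

  fromℕ : ℕ → Carrier
  fromℕ n = n Mult.× 1#

  inf : (Carrier → Set) → Carrier
  inf P = - sup (λ x → P (- x))

  -- The limit inferior, hence the limit of every convergent sequence.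
  lim : (ℕ → Carrier) → Carrier
  lim s = sup (λ y → Eventually (λ m → y ≤ s m))

  expSum : Carrier → ℕ → Carrier
  expSum x zero    = 0#
  expSum x (suc m) = expSum x m + (x Exp.^ m) / fromℕ (m !)

  exp : Carrier → Carrier
  exp x = lim (expSum x)

  -- The inverse of exp; meaningful for 0 < t only.
  log : Carrier → Carrier
  log t = sup (λ x → exp x ≤ t)

  -- Real powers; meaningful for a positive base only.
  _^_ : Carrier → Carrier → Carrier
  x ^ y = exp (y * log x)

  TendsTo∞ : (ℕ → Carrier) → Set
  TendsTo∞ s = ∀ M → Eventually (λ N → M ≤ s N)

  -- s = o(t), for sequences of nonnegative numbers.
  LittleO : (ℕ → Carrier) → (ℕ → Carrier) → Set
  LittleO s t = ∀ ε → 0# < ε → Eventually (λ N → s N ≤ ε * t N)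

  sumOver : {A : Set} → List A → (A → Carrier) → Carrier
  sumOver xs f = List.foldr (λ x acc → f x + acc) 0# xs

-- A finite simple graph whose vertex set V is a subset of Fin n (up to
-- isomorphism, every finite simple graph); thus the subgraphs of a
-- `Graph n` are again elements of `Graph n`.
record Graph (n : ℕ) : Set where
  field
    V   : Subset n
    adj : Fin n → Fin n → Bool

  Adj : Fin n → Fin n → Set
  Adj u v = T (adj u v)

  field
    adj-sym    : ∀ {u v} → Adj u v → Adj v u
    adj-irrefl : ∀ {v} → ¬ Adj v v
    adj⇒∈      : ∀ {u v} → Adj u v → u ∈ V

open Graph

infix 4 _⊆ᴳ_

_⊆ᴳ_ : ∀ {n} → Graph n → Graph n → Set
H ⊆ᴳ G = V H ⊆ V G × (∀ {u v} → Adj H u v → Adj G u v)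

induced : ∀ {n} → Graph n → Subset n → Graph n
induced G W = record
  { V          = V G ∩ W
  ; adj        = λ u v → adj G u v ∧ (lookup W u ∧ lookup W v)
  ; adj-sym    = λ {u} {v} e →
      let (g , w) = to T-∧ e
          (p , q) = to (T-∧ {lookup W u} {lookup W v}) w
      in from T-∧ (adj-sym G g , from T-∧ (q , p))
  ; adj-irrefl = λ e → adj-irrefl G (proj₁ (to T-∧ e))
  ; adj⇒∈      = λ {u} e →
      let (g , w) = to T-∧ e
      in x∈p∩q⁺ (adj⇒∈ G g , lookup⇒[]= u W (to T-≡ (proj₁ (to T-∧ w))))
  }
  where open Equivalence

-- A cycle of length 3 + k, as the injective sequence of its vertices.
record Cycle {n} (G : Graph n) (k : ℕ) : Set where
  field
    vertex    : Fin (3 ℕ.+ k) → Fin n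
    injective : Injective _≡_ _≡_ vertex
    step      : ∀ i → Adj G (vertex (Fin.inject₁ i)) (vertex (Fin.suc i))
    close     : Adj G (vertex (Fin.fromℕ (2 ℕ.+ k))) (vertex Fin.zero)

open Cycle

-- girth G ≥ r, the girth being the infimum in ℕ ∪ {∞} of the cycle lengths.
Girth≥ : ∀ {n} → ℕ → Graph n → Set
Girth≥ r G = ∀ k → Cycle G k → r ℕ.≤ 3 ℕ.+ k

IsClique : ∀ {n} → Graph n → Subset n → Set
IsClique G K = K ⊆ V G × (∀ {u v} → u ∈ K → v ∈ K → u ≢ v → Adj G u v)

-- A clique contains all edges between its vertices, so it contains a cycle of
-- G as a subgraph as soon as it contains the vertices of that cycle.
IsCycleCliqueCover : ∀ {n} → ℕ → Graph n → List (Subset n) → Set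
IsCycleCliqueCover r G 𝒦 =
  All (IsClique G) 𝒦 ×
  (∀ k (C : Cycle G k) → 3 ℕ.+ k ℕ.< r → Any (λ K → ∀ i → vertex C i ∈ K) 𝒦)

incidence : ∀ {n} → List (Subset n) → ℕ
incidence 𝒦 = List.sum (List.map ∣_∣ 𝒦)

localOverlap : ∀ {n} → Graph n → List (Subset n) → ℕ
localOverlap {n} G 𝒦 =
  max 0 (List.map (λ v → length (filter (v ∈?_) 𝒦)) (filter (_∈? V G) (allFin n)))

uncovered : ∀ {n} → Graph n → List (Subset n) → Graph n
uncovered G 𝒦 = induced G (∁ (⋃ 𝒦))

IsIndependent : ∀ {n} → Graph n → Subset n → Set
IsIndependent G S = S ⊆ V G × (∀ {u v} → u ∈ S → v ∈ S → ¬ Adj G u v)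

allSubsets : ∀ n → List (Subset n)
allSubsets zero    = Vec.[] ∷ []
allSubsets (suc n) = List.map (outside Vec.∷_) (allSubsets n) ++ List.map (inside Vec.∷_) (allSubsets n)

module FractionalColouring (ℝ : CompleteOrderedField) where
  open CompleteOrderedField ℝ
  open RealAnalysis ℝ

  -- A weighting of the independent sets, extended by 0 to all sets.
  record IsFractionalColouring {n} (G : Graph n) (w : Subset n → Carrier) : Set where
    field
      nonneg  : ∀ S → 0# ≤ w S
      support : ∀ S → ¬ IsIndependent G S → w S ≈ 0#
      covers  : ∀ v → v ∈ V G → 1# ≤ sumOver (filter (v ∈?_) (allSubsets n)) w

  χᶠ : ∀ {n} → Graph n → Carrier
  χᶠ {n} G = inf (λ x → ∃[ w ] (IsFractionalColouring G w × x ≈ sumOver (allSubsets n) w))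

  -- A maximum: there are finitely many H, and the graph without vertices is one.
  hᶠ : ∀ {n} → ℕ → Graph n → Carrier
  hᶠ r G = sup (λ x → ∃[ H ] (H ⊆ᴳ G × Girth≥ r H × x ≈ χᶠ H))

{-# OPTIONS --safe #-}
module Submission where

open import Defs
open import Data.Fin.Subset using (Subset; ∣_∣)
open import Data.List.Base using (List)
open import Data.List.Relation.Unary.All using (All)
open import Data.Nat.Base as ℕ using (ℕ)
open import Data.Product.Base using (∃-syntax; _×_; _,_)

-- A greedy multiplicative-weights argument replaces linear programming duality:
-- either G has a fractional colouring of value at most 4 L, or some integer
-- weighting of total W gives every independent set weight below W / L.
-- Keep every edge of G independently with probability 1 / q, where q is about
-- N^(1-δ).  Orient the edges from heavier to lighter vertices.  The vertices of
-- an edgeless set S with fewer than d back-neighbours in S span a d-degenerate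
-- subgraph of G, so they weigh at most d W / L.  If the others weigh much more
-- than W / L, some layer {v ∈ S | θ < w v} spans so many edges of G that it is
-- unlikely to be edgeless; bounding the expected size of such a layer of S by
-- |{v | θ < w v}| / L for every θ and summing over θ gives a union bound that does
-- not depend on the number of vertices.  With d about q log L, edgeless sets
-- therefore weigh O(d W / L) on average.  On the other hand, a vertex lies on a
-- surviving short cycle inside a clique with probability at most 1/4, since
-- δ < 1 / (r - 1).  Some outcome is good on both counts, and deleting its bad
-- vertices leaves a subgraph of girth at least r and fractional chromatic number
-- of order L / d.

-- Probabilities are counts: `M = length Ω` plays the role of 1 and denominators stay cleared, so an
-- expectation bound is an inequality between sums over `Ω`. Edges run from heavier to lighter
-- vertices because back-neighbours of a vertex then lie in every layer that contains it: a large
-- back-degree in `S` becomes many pairs inside each of these layers. A set with `q κ` such pairs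
-- per vertex stays edgeless with probability at most `2 ^ κ` to the power minus its size. Summing
-- over all sets costs a geometric series, so `2 ^ κ` must be of order `L`; this is the origin of
-- the logarithm. The bound on `δ` balances the cycles: a vertex lies on about N^(m-1) cycles of
-- length m in a clique, each surviving with probability about N^(-(1-δ)m), and the product N^(δm-1)
-- is small for all m < r when δ(r-1) < 1. The bad weight and `A` times the largest independent
-- weight both have mean at most `W / 4`, which lets one outcome satisfy both demands with weight to
-- spare. On the real side, `log` is a supremum never shown to invert `exp`; one-sided inequalities
-- take the place of continuity.

module Combinatorics where

  open import Data.Bool.Base using (Bool; true; false; T; _∧_; _∨_)
  open import Data.Bool.Properties using (T-∧; T-∨; T-≡; ∨-comm)
  open import Data.Empty using (⊥; ⊥-elim)
  open import Data.Fin.Base using (Fin; zero; suc; toℕ; inject₁; fromℕ)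
  open import Data.Fin.Properties using (toℕ-injective; toℕ<n; toℕ-inject₁)
  open import Data.Fin.Relation.Unary.Top using (View; view; view-fromℕ; view-inject₁; ‵fromℕ; ‵inject₁)
  open import Data.Fin.Subset using (_∈_; _⊆_)
  open import Data.Fin.Subset.Properties using (_∈?_; x∈p∩q⁺; x∈p∩q⁻)
  open import Data.List.Base as List
    using (List; []; _∷_; _++_; map; concatMap; length; filter; replicate; allFin; upTo; applyUpTo)
  open import Data.List.Extrema.Nat using (xs≤max)
  open import Data.List.Membership.Propositional as List using (find)
  open import Data.List.Membership.Propositional.Properties
    using (∈-map⁺; ∈-++⁺ˡ; ∈-++⁺ʳ; ∈-allFin; ∈-upTo⁺; ∈-upTo⁻; ∈-filter⁺; ∈-tabulate⁻)
  open import Data.List.Properties using (map-tabulate; length-tabulate; length-upTo)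
  open import Data.List.Relation.Unary.All as All using (All; []; _∷_)
  import Data.List.Relation.Unary.All.Properties as All
  open import Data.List.Relation.Unary.Any using (here; there)
  open import Data.List.Relation.Unary.AllPairs using ([]; _∷_)
  open import Data.List.Relation.Unary.Unique.Propositional using (Unique)
  open import Data.List.Relation.Unary.Unique.Propositional.Properties using (tabulate⁺)
  open import Data.Nat.Base
  open import Data.Nat.DivMod using (_/_; _%_; m≡m%n+[m/n]*n; m%n<n)
  open import Data.Nat.Properties
  open import Data.Nat.Tactic.RingSolver using (solve-∀)
  open import Data.Product.Base using (∃-syntax; _×_; _,_; proj₁; proj₂)
  open import Data.Sum.Base using (_⊎_; inj₁; inj₂)
  open import Data.Vec.Base as Vec using (Vec; []; _∷_; lookup; tabulate)
  open import Data.Vec.Properties using (lookup∘tabulate; lookup⇒[]=; []=⇒lookup)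
  open import Function.Base using (_∘_; id)
  open import Function.Bundles using (Equivalence)
  open import Function.Definitions using (Injective)
  open import Relation.Binary.Definitions using (tri<; tri≈; tri>)
  open import Relation.Binary.PropositionalEquality
  open import Relation.Nullary using (¬_; Dec; yes; no; contradiction; does)
  open import Relation.Nullary.Decidable using (decidable-stable)

  -- Finite sums and products over lists, vectors and subsets.

  ∑ : {A : Set} → List A → (A → ℕ) → ℕ
  ∑ []       f = 0
  ∑ (x ∷ xs) f = f x + ∑ xs f

  ∏ : ∀ m → (Fin m → ℕ) → ℕ
  ∏ zero    f = 1
  ∏ (suc m) f = f zero * ∏ m (f ∘ suc)

  module _ {A : Set} where

    ∑-mono : (xs : List A) {f g : A → ℕ} → (∀ x → f x ≤ g x) → ∑ xs f ≤ ∑ xs g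
    ∑-mono []       f≤g = z≤n
    ∑-mono (x ∷ xs) f≤g = +-mono-≤ (f≤g x) (∑-mono xs f≤g)

    ∑-cong : (xs : List A) {f g : A → ℕ} → (∀ x → f x ≡ g x) → ∑ xs f ≡ ∑ xs g
    ∑-cong []       f≡g = refl
    ∑-cong (x ∷ xs) f≡g = cong₂ _+_ (f≡g x) (∑-cong xs f≡g)

    ∑-+ : (xs : List A) (f g : A → ℕ) → ∑ xs (λ x → f x + g x) ≡ ∑ xs f + ∑ xs g
    ∑-+ []       f g = refl
    ∑-+ (x ∷ xs) f g rewrite ∑-+ xs f g = lemma (f x) (g x) (∑ xs f) (∑ xs g)
      where
      lemma : ∀ a b c d → a + b + (c + d) ≡ a + c + (b + d)
      lemma = solve-∀

    ∑-* : (xs : List A) (c : ℕ) (f : A → ℕ) → ∑ xs (λ x → c * f x) ≡ c * ∑ xs f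
    ∑-* []       c f = sym (*-zeroʳ c)
    ∑-* (x ∷ xs) c f = trans (cong (c * f x +_) (∑-* xs c f)) (sym (*-distribˡ-+ c (f x) _))

    ∑-*ʳ : (xs : List A) (c : ℕ) (f : A → ℕ) → ∑ xs (λ x → f x * c) ≡ ∑ xs f * c
    ∑-*ʳ xs c f = begin
      ∑ xs (λ x → f x * c) ≡⟨ ∑-cong xs (λ x → *-comm (f x) c) ⟩
      ∑ xs (λ x → c * f x) ≡⟨ ∑-* xs c f ⟩
      c * ∑ xs f           ≡⟨ *-comm c _ ⟩
      ∑ xs f * c           ∎
      where open ≡-Reasoning

    ∑-const : (xs : List A) (c : ℕ) → ∑ xs (λ _ → c) ≡ length xs * c
    ∑-const []       c = refl
    ∑-const (x ∷ xs) c = cong (c +_) (∑-const xs c)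

    ∑-zero : (xs : List A) → ∑ xs (λ _ → 0) ≡ 0
    ∑-zero xs = trans (∑-const xs 0) (*-zeroʳ (length xs))

    ∑-∈ : {xs : List A} {x : A} (f : A → ℕ) → x List.∈ xs → f x ≤ ∑ xs f
    ∑-∈ {xs = y ∷ xs} f (here refl) = m≤m+n (f y) _
    ∑-∈ {xs = y ∷ xs} f (there x∈)  = ≤-trans (∑-∈ f x∈) (m≤n+m _ (f y))

    ∑-++ : (xs ys : List A) (f : A → ℕ) → ∑ (xs ++ ys) f ≡ ∑ xs f + ∑ ys f
    ∑-++ []       ys f = refl
    ∑-++ (x ∷ xs) ys f = trans (cong (f x +_) (∑-++ xs ys f)) (sym (+-assoc (f x) _ _))

    ∑-map : {B : Set} (h : B → A) (xs : List B) (f : A → ℕ) → ∑ (map h xs) f ≡ ∑ xs (f ∘ h)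
    ∑-map h []       f = refl
    ∑-map h (x ∷ xs) f = cong (f (h x) +_) (∑-map h xs f)

    ∑-concatMap : {B : Set} (h : B → List A) (xs : List B) (f : A → ℕ) →
                  ∑ (concatMap h xs) f ≡ ∑ xs (λ x → ∑ (h x) f)
    ∑-concatMap h []       f = refl
    ∑-concatMap h (x ∷ xs) f =
      trans (∑-++ (h x) _ f) (cong (∑ (h x) f +_) (∑-concatMap h xs f))

    ∑-average : (xs : List A) (f : A → ℕ) (c : ℕ) → 0 < length xs →
                ∑ xs f ≤ length xs * c → ∃[ x ] f x ≤ c
    ∑-average (x ∷ xs) f c _ ∑≤ with f x ≤? c
    ... | yes fx≤c = x , fx≤c
    ∑-average (x ∷ [])       f c _ ∑≤ | no fx≰c =
      contradiction (subst₂ _≤_ (+-identityʳ _) (+-identityʳ _) ∑≤) fx≰c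
    ∑-average (x ∷ y ∷ xs) f c _ ∑≤ | no fx≰c =
      ∑-average (y ∷ xs) f c (s≤s z≤n)
        (+-cancelˡ-≤ c _ _ (≤-trans (+-monoˡ-≤ _ (<⇒≤ (≰⇒> fx≰c))) ∑≤))

  ∑-swap : {A B : Set} (xs : List A) (ys : List B) (f : A → B → ℕ) →
           ∑ xs (λ x → ∑ ys (f x)) ≡ ∑ ys (λ y → ∑ xs (λ x → f x y))
  ∑-swap []       ys f = sym (∑-zero ys)
  ∑-swap (x ∷ xs) ys f =
    trans (cong (∑ ys (f x) +_) (∑-swap xs ys f)) (sym (∑-+ ys (f x) _))

  ∑-mono-All : {A : Set} {xs : List A} {f g : A → ℕ} → All (λ x → f x ≤ g x) xs → ∑ xs f ≤ ∑ xs g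
  ∑-mono-All []          = z≤n
  ∑-mono-All (le ∷ f≤g) = +-mono-≤ le (∑-mono-All f≤g)

  ∑-allFin-suc : ∀ n (f : Fin (suc n) → ℕ) →
                 ∑ (allFin (suc n)) f ≡ f zero + ∑ (allFin n) (f ∘ suc)
  ∑-allFin-suc n f = cong (f zero +_)
    (trans (cong (λ l → ∑ l f) (sym (map-tabulate id suc))) (∑-map suc (allFin n) f))

  ∏-mono : ∀ m {f g : Fin m → ℕ} → (∀ i → f i ≤ g i) → ∏ m f ≤ ∏ m g
  ∏-mono zero    f≤g = ≤-refl
  ∏-mono (suc m) f≤g = *-mono-≤ (f≤g zero) (∏-mono m (f≤g ∘ suc))

  ∏-cong : ∀ m {f g : Fin m → ℕ} → (∀ i → f i ≡ g i) → ∏ m f ≡ ∏ m g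
  ∏-cong zero    f≡g = refl
  ∏-cong (suc m) f≡g = cong₂ _*_ (f≡g zero) (∏-cong m (f≡g ∘ suc))

  ∏-* : ∀ m (f g : Fin m → ℕ) → ∏ m (λ i → f i * g i) ≡ ∏ m f * ∏ m g
  ∏-* zero    f g = refl
  ∏-* (suc m) f g rewrite ∏-* m (f ∘ suc) (g ∘ suc) =
    lemma (f zero) (g zero) (∏ m (f ∘ suc)) (∏ m (g ∘ suc))
    where
    lemma : ∀ a b c d → a * b * (c * d) ≡ a * c * (b * d)
    lemma = solve-∀

  ∏-^ : ∀ m x (a : Fin m → ℕ) → ∏ m (λ i → x ^ a i) ≡ x ^ ∑ (allFin m) a
  ∏-^ zero    x a = refl
  ∏-^ (suc m) x a = begin
    x ^ a zero * ∏ m (λ i → x ^ a (suc i))     ≡⟨ cong (x ^ a zero *_) (∏-^ m x (a ∘ suc)) ⟩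
    x ^ a zero * x ^ ∑ (allFin m) (a ∘ suc)     ≡⟨ ^-distribˡ-+-* x (a zero) _ ⟨
    x ^ (a zero + ∑ (allFin m) (a ∘ suc))       ≡⟨ cong (x ^_) (∑-allFin-suc m a) ⟨
    x ^ ∑ (allFin (suc m)) a                    ∎
    where open ≡-Reasoning

  ∏-pos : ∀ m {f : Fin m → ℕ} → (∀ i → 0 < f i) → 0 < ∏ m f
  ∏-pos zero    0<f = s≤s z≤n
  ∏-pos (suc m) 0<f = *-mono-< (0<f zero) (∏-pos m (0<f ∘ suc))

  vecs : {A : Set} → List A → ∀ m → List (Vec A m)
  vecs xs zero    = [] ∷ []
  vecs xs (suc m) = concatMap (λ x → map (x ∷_) (vecs xs m)) xs

  module _ {A : Set} (xs : List A) where

    ∑-vecs-suc : ∀ m (f : Vec A (suc m) → ℕ) →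
                 ∑ (vecs xs (suc m)) f ≡ ∑ xs (λ x → ∑ (vecs xs m) (λ v → f (x ∷ v)))
    ∑-vecs-suc m f = trans (∑-concatMap (λ x → map (x ∷_) (vecs xs m)) xs f)
      (∑-cong xs (λ x → ∑-map (x ∷_) (vecs xs m) f))

    -- Independence of coordinates: expanding the product of sums on the right chooses one entry per
    -- coordinate. With coin entries for `xs` it evaluates the mean of a product.
    ∑-vecs-∏ : ∀ m (φ : Fin m → A → ℕ) →
               ∑ (vecs xs m) (λ v → ∏ m (λ i → φ i (lookup v i))) ≡ ∏ m (λ i → ∑ xs (φ i))
    ∑-vecs-∏ zero    φ = refl
    ∑-vecs-∏ (suc m) φ = begin
      ∑ (vecs xs (suc m)) (λ v → ∏ (suc m) (λ i → φ i (lookup v i)))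
        ≡⟨ ∑-vecs-suc m _ ⟩
      ∑ xs (λ x → ∑ (vecs xs m) (λ v → φ zero x * ∏ m (λ i → φ (suc i) (lookup v i))))
        ≡⟨ ∑-cong xs (λ x → ∑-* (vecs xs m) (φ zero x) _) ⟩
      ∑ xs (λ x → φ zero x * ∑ (vecs xs m) (λ v → ∏ m (λ i → φ (suc i) (lookup v i))))
        ≡⟨ ∑-*ʳ xs _ (φ zero) ⟩
      ∑ xs (φ zero) * ∑ (vecs xs m) (λ v → ∏ m (λ i → φ (suc i) (lookup v i)))
        ≡⟨ cong (∑ xs (φ zero) *_) (∑-vecs-∏ m (φ ∘ suc)) ⟩
      ∑ xs (φ zero) * ∏ m (λ i → ∑ xs (φ (suc i))) ∎
      where open ≡-Reasoning

    ∈-vecs : (∀ x → x List.∈ xs) → ∀ {m} (v : Vec A m) → v List.∈ vecs xs m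
    ∈-vecs all []      = here refl
    ∈-vecs all (x ∷ v) = go (all x)
      where
      go : ∀ {ys} → x List.∈ ys → (x ∷ v) List.∈ concatMap (λ x → map (x ∷_) (vecs xs _)) ys
      go (here refl) = ∈-++⁺ˡ (∈-map⁺ _ (∈-vecs all v))
      go (there x∈)  = ∈-++⁺ʳ _ (go x∈)

  ∈-allSubsets : ∀ {n} (S : Subset n) → S List.∈ allSubsets n
  ∈-allSubsets []          = here refl
  ∈-allSubsets (false ∷ S) = ∈-++⁺ˡ (∈-map⁺ _ (∈-allSubsets S))
  ∈-allSubsets (true ∷ S)  = ∈-++⁺ʳ _ (∈-map⁺ _ (∈-allSubsets S))

  ∑-allSubsets-suc : ∀ n (f : Subset (suc n) → ℕ) →
    ∑ (allSubsets (suc n)) f ≡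
    ∑ (allSubsets n) (λ S → f (false ∷ S)) + ∑ (allSubsets n) (λ S → f (true ∷ S))
  ∑-allSubsets-suc n f = trans (∑-++ (map (false ∷_) (allSubsets n)) _ f)
    (cong₂ _+_ (∑-map (false ∷_) (allSubsets n) f) (∑-map (true ∷_) (allSubsets n) f))

  -- The same expansion with two choices per vertex; it is the generating function by which all
  -- subsets are counted at once.
  ∑-allSubsets-∏ : ∀ n (ψ : Fin n → Bool → ℕ) →
    ∑ (allSubsets n) (λ S → ∏ n (λ i → ψ i (lookup S i))) ≡ ∏ n (λ i → ψ i false + ψ i true)
  ∑-allSubsets-∏ zero    ψ = refl
  ∑-allSubsets-∏ (suc n) ψ = begin
    ∑ (allSubsets (suc n)) (λ S → ∏ (suc n) (λ i → ψ i (lookup S i)))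
      ≡⟨ ∑-allSubsets-suc n _ ⟩
    ∑ (allSubsets n) (λ S → ψ zero false * P S) + ∑ (allSubsets n) (λ S → ψ zero true * P S)
      ≡⟨ cong₂ _+_ (∑-* (allSubsets n) (ψ zero false) P) (∑-* (allSubsets n) (ψ zero true) P) ⟩
    ψ zero false * ∑ (allSubsets n) P + ψ zero true * ∑ (allSubsets n) P
      ≡⟨ *-distribʳ-+ (∑ (allSubsets n) P) (ψ zero false) (ψ zero true) ⟨
    (ψ zero false + ψ zero true) * ∑ (allSubsets n) P
      ≡⟨ cong ((ψ zero false + ψ zero true) *_) (∑-allSubsets-∏ n (ψ ∘ suc)) ⟩
    ∏ (suc n) (λ i → ψ i false + ψ i true) ∎
    where
    open ≡-Reasoning
    P : Subset n → ℕ
    P S = ∏ n (λ i → ψ (suc i) (lookup S i))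

  ∑-applyUpTo : ∀ m (h f : ℕ → ℕ) → ∑ (applyUpTo h m) f ≡ ∑ (upTo m) (f ∘ h)
  ∑-applyUpTo zero    h f = refl
  ∑-applyUpTo (suc m) h f = cong (f (h 0) +_)
    (trans (∑-applyUpTo m (h ∘ suc) f) (sym (∑-applyUpTo m suc (f ∘ h))))

  ∑-upTo-suc : ∀ m (f : ℕ → ℕ) → ∑ (upTo (suc m)) f ≡ f 0 + ∑ (upTo m) (f ∘ suc)
  ∑-upTo-suc m f = cong (f 0 +_) (∑-applyUpTo m suc f)

  -- Indicators and cardinalities under excluded middle.

  module Classical (lem : (A : Set) → Dec A) where

    𝟙 : Set → ℕ
    𝟙 A with lem A
    ... | yes _ = 1
    ... | no  _ = 0

    module _ {A : Set} where

      𝟙-yes : A → 𝟙 A ≡ 1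
      𝟙-yes a with lem A
      ... | yes _ = refl
      ... | no ¬a = contradiction a ¬a

      𝟙-no : ¬ A → 𝟙 A ≡ 0
      𝟙-no ¬a with lem A
      ... | yes a = contradiction a ¬a
      ... | no  _ = refl

      𝟙≤1 : 𝟙 A ≤ 1
      𝟙≤1 with lem A
      ... | yes _ = ≤-refl
      ... | no  _ = z≤n

      𝟙-≤ : ∀ {m} → (A → 1 ≤ m) → 𝟙 A ≤ m
      𝟙-≤ A⇒ with lem A
      ... | yes a = A⇒ a
      ... | no  _ = z≤n

      𝟙-mono : {B : Set} → (A → B) → 𝟙 A ≤ 𝟙 B
      𝟙-mono f = 𝟙-≤ (λ a → ≤-reflexive (sym (lemma (f a))))
        where
        lemma : ∀ {B} → B → 𝟙 B ≡ 1
        lemma {B} b with lem B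
        ... | yes _ = refl
        ... | no ¬b = contradiction b ¬b

    𝟙-cong : {A B : Set} → (A → B) → (B → A) → 𝟙 A ≡ 𝟙 B
    𝟙-cong f g = ≤-antisym (𝟙-mono f) (𝟙-mono g)

    𝟙-× : {A B : Set} → 𝟙 (A × B) ≡ 𝟙 A * 𝟙 B
    𝟙-× {A} {B} with lem A | lem B
    ... | yes a | yes b = 𝟙-yes (a , b)
    ... | yes a | no ¬b = 𝟙-no (¬b ∘ proj₂)
    ... | no ¬a | _     = 𝟙-no (¬a ∘ proj₁)

    𝟙-split : {A B : Set} → 𝟙 A ≡ 𝟙 (A × B) + 𝟙 (A × ¬ B)
    𝟙-split {A} {B} with lem A | lem B
    ... | yes a | yes b = sym (cong₂ _+_ (𝟙-yes (a , b)) (𝟙-no (λ p → proj₂ p b)))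
    ... | yes a | no ¬b = sym (cong₂ _+_ (𝟙-no (¬b ∘ proj₂)) (𝟙-yes (a , ¬b)))
    ... | no ¬a | _     = sym (cong₂ _+_ (𝟙-no (¬a ∘ proj₁)) (𝟙-no (¬a ∘ proj₁)))

    𝟙-∏ : ∀ {A} m {f : Fin m → ℕ} → (A → ∀ i → 1 ≤ f i) → 𝟙 A ≤ ∏ m f
    𝟙-∏ m A⇒ = 𝟙-≤ (λ a → ∏-pos m (A⇒ a))

    module _ {n : ℕ} where

      # : (Fin n → Set) → ℕ
      # P = ∑ (allFin n) (𝟙 ∘ P)

      #-mono : {P Q : Fin n → Set} → (∀ v → P v → Q v) → # P ≤ # Q
      #-mono P⊆Q = ∑-mono (allFin n) (λ v → 𝟙-mono (P⊆Q v))

      #-none : {P : Fin n → Set} → (∀ v → ¬ P v) → # P ≡ 0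
      #-none ¬P = trans (∑-cong (allFin n) (λ v → 𝟙-no (¬P v))) (∑-zero (allFin n))

      #-some : {P : Fin n → Set} → ∀ v → P v → 1 ≤ # P
      #-some {P} v Pv = ≤-trans (≤-reflexive (sym (𝟙-yes Pv))) (∑-∈ (𝟙 ∘ P) (∈-allFin v))

      ⟪_⟫ : (Fin n → Set) → Subset n
      ⟪ P ⟫ = tabulate (λ v → does (lem (P v)))

      ∈⟪⟫⁺ : {P : Fin n → Set} → ∀ {v} → P v → v ∈ ⟪ P ⟫
      ∈⟪⟫⁺ {P} {v} Pv = lookup⇒[]= v ⟪ P ⟫ (trans (lookup∘tabulate _ v) lemma)
        where
        lemma : does (lem (P v)) ≡ true
        lemma with lem (P v)
        ... | yes _  = refl
        ... | no ¬Pv = contradiction Pv ¬Pv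

      ∈⟪⟫⁻ : {P : Fin n → Set} → ∀ {v} → v ∈ ⟪ P ⟫ → P v
      ∈⟪⟫⁻ {P} {v} v∈ = lemma (trans (sym (lookup∘tabulate _ v)) ([]=⇒lookup v∈))
        where
        lemma : does (lem (P v)) ≡ true → P v
        lemma eq with lem (P v)
        ... | yes Pv = Pv
        lemma () | no _

    #-∣∣ : ∀ {n} (K : Subset n) → # (_∈ K) ≡ ∣ K ∣
    #-∣∣ []      = refl
    #-∣∣ {suc n} (b ∷ K) = trans (∑-allFin-suc n _) (lemma b)
      where
      tail : ∀ {b} → ∑ (allFin n) (λ v → 𝟙 (suc v ∈ b ∷ K)) ≡ ∣ K ∣
      tail = trans (∑-cong (allFin n) (λ v → 𝟙-cong (λ { (Vec.there p) → p }) Vec.there)) (#-∣∣ K)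
      lemma : ∀ b → 𝟙 (zero ∈ b ∷ K) + ∑ (allFin n) (λ v → 𝟙 (suc v ∈ b ∷ K)) ≡ ∣ b ∷ K ∣
      lemma true  = cong₂ _+_ (𝟙-yes Vec.here) tail
      lemma false = cong₂ _+_ (𝟙-no λ ()) tail

    -- Power estimates and independent biased bits.

    bernoulli : ∀ x m → x ^ suc m + suc m * x ^ m ≤ suc x ^ suc m
    bernoulli x zero    = ≤-reflexive (lemma x)
      where
      lemma : ∀ x → x * 1 + 1 * 1 ≡ suc x * 1
      lemma = solve-∀
    bernoulli x (suc m) = begin
      x * (x * x ^ m) + suc (suc m) * (x * x ^ m)           ≡⟨ lemma x (x ^ m) m ⟩
      x * (x * x ^ m + suc m * x ^ m) + x * x ^ m           ≤⟨ +-monoʳ-≤ (x * (x * x ^ m + suc m * x ^ m)) (m≤m+n (x * x ^ m) (suc m * x ^ m)) ⟩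
      x * (x * x ^ m + suc m * x ^ m) + (x * x ^ m + suc m * x ^ m) ≡⟨ +-comm (x * (x * x ^ m + suc m * x ^ m)) _ ⟩
      suc x * (x ^ suc m + suc m * x ^ m)                   ≤⟨ *-monoʳ-≤ (suc x) (bernoulli x m) ⟩
      suc x * suc x ^ suc m                                 ∎
      where
      open ≤-Reasoning
      lemma : ∀ x y m → x * (x * y) + suc (suc m) * (x * y) ≡ x * (x * y + suc m * y) + x * y
      lemma = solve-∀

    -- With q = 1 + x this is (1 - 1/q)^q ≤ 1/2: an event of probability 1/q fails q times in a row
    -- at most half the time.
    2*q^q≤[1+q]^[1+q] : ∀ x → 2 * x ^ suc x ≤ suc x ^ suc x
    2*q^q≤[1+q]^[1+q] x = ≤-trans (+-monoʳ-≤ (x ^ suc x) step) (bernoulli x x)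
      where
      step : x ^ suc x + 0 ≤ suc x * x ^ x
      step = ≤-trans (≤-reflexive (+-identityʳ _)) (*-monoˡ-≤ (x ^ x) (n≤1+n x))

    ^-distribʳ-* : ∀ h x y → (x * y) ^ h ≡ x ^ h * y ^ h
    ^-distribʳ-* zero    x y = refl
    ^-distribʳ-* (suc h) x y =
      trans (cong (x * y *_) (^-distribʳ-* h x y)) ([m*n]*[o*p]≡[m*o]*[n*p] x y (x ^ h) (y ^ h))

    -- Each of `h` blocks of `q` factors halves the ratio, and the remaining `s ∸ q * h` factors do
    -- not increase it. It serves for absent bits and again for the decay of weights in `Duality`.
    2^h*x^s≤[1+x]^s : ∀ x h s → suc x * h ≤ s → 2 ^ h * x ^ s ≤ suc x ^ s
    2^h*x^s≤[1+x]^s x h s qh≤s = begin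
      2 ^ h * x ^ s                          ≡⟨ cong (λ s → 2 ^ h * x ^ s) (m+[n∸m]≡n qh≤s) ⟨
      2 ^ h * x ^ (q * h + e)                ≡⟨ cong (2 ^ h *_) (^-distribˡ-+-* x (q * h) e) ⟩
      2 ^ h * (x ^ (q * h) * x ^ e)          ≡⟨ *-assoc (2 ^ h) _ _ ⟨
      2 ^ h * x ^ (q * h) * x ^ e            ≡⟨ cong (λ z → 2 ^ h * z * x ^ e) (^-*-assoc x q h) ⟨
      2 ^ h * (x ^ q) ^ h * x ^ e            ≡⟨ cong (_* x ^ e) (^-distribʳ-* h 2 (x ^ q)) ⟨
      (2 * x ^ q) ^ h * x ^ e                ≤⟨ *-mono-≤ (^-monoˡ-≤ h (2*q^q≤[1+q]^[1+q] x)) (^-monoˡ-≤ e (n≤1+n x)) ⟩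
      (q ^ q) ^ h * q ^ e                    ≡⟨ cong (_* q ^ e) (^-*-assoc q q h) ⟩
      q ^ (q * h) * q ^ e                    ≡⟨ ^-distribˡ-+-* q (q * h) e ⟨
      q ^ (q * h + e)                        ≡⟨ cong (q ^_) (m+[n∸m]≡n qh≤s) ⟩
      q ^ s                                  ∎
      where
      open ≤-Reasoning
      q e : ℕ
      q = suc x
      e = s ∸ q * h

    -- Each of the n² bits is true with probability 1 / (1 + q′).
    module RandomBits (n q′ : ℕ) where

      q : ℕ
      q = suc q′

      coin : List Bool
      coin = true ∷ replicate q′ false

      ∑-coin : ∀ f → ∑ coin f ≡ f true + q′ * f false
      ∑-coin f = cong (f true +_) (lemma q′)
        where
        lemma : ∀ k → ∑ (replicate k false) f ≡ k * f false
        lemma zero    = refl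
        lemma (suc k) = cong (f false +_) (lemma k)

      Bits : Set
      Bits = Vec (Vec Bool n) n

      -- Outcomes recur here, since `coin` contains `false` with multiplicity `q′`; uniform counting
      -- over this list is therefore the biased product measure.
      Ω : List Bits
      Ω = vecs (vecs coin n) n

      bit : Bits → Fin n → Fin n → Bool
      bit ω u v = lookup (lookup ω u) v

      M : ℕ
      M = length Ω

      ∏∏ : (Fin n → Fin n → ℕ) → ℕ
      ∏∏ f = ∏ n (λ u → ∏ n (f u))

      ∑∑ : (Fin n → Fin n → ℕ) → ℕ
      ∑∑ f = ∑ (allFin n) (λ u → ∑ (allFin n) (f u))

      ∑-Ω-∏∏ : (φ : Fin n → Fin n → Bool → ℕ) →
               ∑ Ω (λ ω → ∏∏ (λ u v → φ u v (bit ω u v))) ≡ ∏∏ (λ u v → ∑ coin (φ u v))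
      ∑-Ω-∏∏ φ = trans (∑-vecs-∏ (vecs coin n) n (λ u row → ∏ n (λ v → φ u v (lookup row v))))
        (∏-cong n (λ u → ∑-vecs-∏ coin n (φ u)))

      ∏∏-^-* : ∀ x a b → ∏∏ (λ u v → x ^ a u v * b u v) ≡ x ^ ∑∑ a * ∏∏ b
      ∏∏-^-* x a b = begin
        ∏∏ (λ u v → x ^ a u v * b u v)
          ≡⟨ ∏-cong n (λ u → trans (∏-* n (λ v → x ^ a u v) (b u)) (cong (_* ∏ n (b u)) (∏-^ n x (a u)))) ⟩
        ∏ n (λ u → x ^ ∑ (allFin n) (a u) * ∏ n (b u))
          ≡⟨ ∏-* n (λ u → x ^ ∑ (allFin n) (a u)) (λ u → ∏ n (b u)) ⟩
        ∏ n (λ u → x ^ ∑ (allFin n) (a u)) * ∏∏ b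
          ≡⟨ cong (_* ∏∏ b) (∏-^ n x (λ u → ∑ (allFin n) (a u))) ⟩
        x ^ ∑∑ a * ∏∏ b ∎
        where open ≡-Reasoning

      module _ (A : Fin n → Fin n → Set) where

        private
          a : Fin n → Fin n → ℕ
          a u v = 𝟙 (A u v)

          -- length Ω is the sum of the constant 1, whose factors sum to q each.
          exposure : ∀ x φ → (∀ u v → ∑ coin (φ u v) ≡ x ^ a u v * q ^ (1 ∸ a u v)) →
                     ∑ Ω (λ ω → ∏∏ (λ u v → φ u v (bit ω u v))) * q ^ ∑∑ a ≡ x ^ ∑∑ a * M
          exposure x φ eq = begin
            ∑ Ω (λ ω → ∏∏ (λ u v → φ u v (bit ω u v))) * q ^ ∑∑ a
              ≡⟨ cong (_* q ^ ∑∑ a) (trans (∑-Ω-∏∏ φ) (∏-cong n (λ u → ∏-cong n (eq u)))) ⟩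
            ∏∏ (λ u v → x ^ a u v * q ^ (1 ∸ a u v)) * q ^ ∑∑ a
              ≡⟨ cong (_* q ^ ∑∑ a) (∏∏-^-* x a _) ⟩
            x ^ ∑∑ a * Q * q ^ ∑∑ a
              ≡⟨ lemma (x ^ ∑∑ a) Q (q ^ ∑∑ a) ⟩
            x ^ ∑∑ a * (q ^ ∑∑ a * Q)
              ≡⟨ cong (x ^ ∑∑ a *_) (∏∏-^-* q a _) ⟨
            x ^ ∑∑ a * ∏∏ (λ u v → q ^ a u v * q ^ (1 ∸ a u v))
              ≡⟨ cong (x ^ ∑∑ a *_) (∏-cong n (λ u → ∏-cong n (λ v → one u v))) ⟩
            x ^ ∑∑ a * ∏∏ (λ u v → ∑ coin (λ _ → 1))
              ≡⟨ cong (x ^ ∑∑ a *_) (∑-Ω-∏∏ (λ _ _ _ → 1)) ⟨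
            x ^ ∑∑ a * ∑ Ω (λ ω → ∏∏ (λ _ _ → 1))
              ≡⟨ cong (x ^ ∑∑ a *_) (trans (∑-cong Ω (λ _ → ∏∏1)) (trans (∑-const Ω 1) (*-identityʳ M))) ⟩
            x ^ ∑∑ a * M ∎
            where
            open ≡-Reasoning
            Q : ℕ
            Q = ∏∏ (λ u v → q ^ (1 ∸ a u v))
            lemma : ∀ a b c → a * b * c ≡ a * (c * b)
            lemma = solve-∀
            one : ∀ u v → q ^ a u v * q ^ (1 ∸ a u v) ≡ ∑ coin (λ _ → 1)
            one u v = begin
              q ^ a u v * q ^ (1 ∸ a u v) ≡⟨ ^-distribˡ-+-* q (a u v) _ ⟨
              q ^ (a u v + (1 ∸ a u v))   ≡⟨ cong (q ^_) (m+[n∸m]≡n 𝟙≤1) ⟩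
              q * 1                       ≡⟨ cong (λ z → 1 + z) refl ⟩
              1 + q′ * 1                  ≡⟨ ∑-coin (λ _ → 1) ⟨
              ∑ coin (λ _ → 1)            ∎
            ∏1 : ∀ m → ∏ m (λ _ → 1) ≡ 1
            ∏1 zero    = refl
            ∏1 (suc m) = trans (+-identityʳ _) (∏1 m)
            ∏∏1 : ∏∏ (λ _ _ → 1) ≡ 1
            ∏∏1 = trans (∏-cong n (λ _ → ∏1 n)) (∏1 n)

          0<q^ : ∀ s → 0 < q ^ s
          0<q^ s = m^n>0 q s

        -- A constrained pair retains `q′` of its `q` coin entries, so the probability is at most (1
        -- - 1/q) to the number of pairs in `A`.
        avoidance : ∀ h → q * h ≤ ∑∑ a →
          2 ^ h * ∑ Ω (λ ω → 𝟙 (∀ u v → A u v → bit ω u v ≡ false)) ≤ M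
        avoidance h qh≤s = *-cancelʳ-≤ _ _ (q ^ ∑∑ a) ⦃ >-nonZero (0<q^ (∑∑ a)) ⦄ (begin
          2 ^ h * ∑ Ω E * q ^ ∑∑ a          ≤⟨ *-monoˡ-≤ (q ^ ∑∑ a) (*-monoʳ-≤ (2 ^ h) (∑-mono Ω E≤)) ⟩
          2 ^ h * P * q ^ ∑∑ a              ≡⟨ *-assoc (2 ^ h) P _ ⟩
          2 ^ h * (P * q ^ ∑∑ a)            ≡⟨ cong (2 ^ h *_) (exposure q′ φ sum) ⟩
          2 ^ h * (q′ ^ ∑∑ a * M)           ≡⟨ *-assoc (2 ^ h) _ M ⟨
          2 ^ h * q′ ^ ∑∑ a * M             ≤⟨ *-monoˡ-≤ M (2^h*x^s≤[1+x]^s q′ h (∑∑ a) qh≤s) ⟩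
          q ^ ∑∑ a * M                      ≡⟨ *-comm (q ^ ∑∑ a) M ⟩
          M * q ^ ∑∑ a                      ∎)
          where
          open ≤-Reasoning
          E : Bits → ℕ
          E ω = 𝟙 (∀ u v → A u v → bit ω u v ≡ false)
          φ : Fin n → Fin n → Bool → ℕ
          φ u v true  = 1 ∸ a u v
          φ u v false = 1
          P : ℕ
          P = ∑ Ω (λ ω → ∏∏ (λ u v → φ u v (bit ω u v)))
          sum : ∀ u v → ∑ coin (φ u v) ≡ q′ ^ a u v * q ^ (1 ∸ a u v)
          sum u v = trans (∑-coin (φ u v)) (cases (lem (A u v)))
            where
            cases : Dec (A u v) → 1 ∸ a u v + q′ * 1 ≡ q′ ^ a u v * q ^ (1 ∸ a u v)
            cases (yes p) rewrite 𝟙-yes p = sym (*-identityʳ _)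
            cases (no ¬p) rewrite 𝟙-no ¬p = sym (+-identityʳ _)
          E≤ : ∀ ω → E ω ≤ ∏∏ (λ u v → φ u v (bit ω u v))
          E≤ ω = 𝟙-∏ n (λ e u → ∏-pos n (λ v → factor u v (e u v)))
            where
            factor : ∀ u v → (A u v → bit ω u v ≡ false) → 1 ≤ φ u v (bit ω u v)
            factor u v e with bit ω u v | lem (A u v)
            ... | false | _     = ≤-refl
            ... | true  | yes p with () ← e p
            ... | true  | no ¬p = ≤-reflexive (cong (1 ∸_) (sym (𝟙-no ¬p)))

        -- A constrained pair retains one of its `q` coin entries. The exponent `j` is a lower bound
        -- for the number of pairs, which is the form that `∑∑-Unique` delivers.
        containment : ∀ j → j ≤ ∑∑ a →
          q ^ j * ∑ Ω (λ ω → 𝟙 (∀ u v → A u v → bit ω u v ≡ true)) ≤ M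
        containment j j≤s = begin
          q ^ j * ∑ Ω E             ≤⟨ *-mono-≤ (^-monoʳ-≤ q j≤s) (∑-mono Ω E≤) ⟩
          q ^ ∑∑ a * P              ≡⟨ *-comm (q ^ ∑∑ a) P ⟩
          P * q ^ ∑∑ a              ≡⟨ exposure 1 φ sum ⟩
          1 ^ ∑∑ a * M              ≡⟨ cong (_* M) (^-zeroˡ (∑∑ a)) ⟩
          1 * M                     ≡⟨ *-identityˡ M ⟩
          M                         ∎
          where
          open ≤-Reasoning
          E : Bits → ℕ
          E ω = 𝟙 (∀ u v → A u v → bit ω u v ≡ true)
          φ : Fin n → Fin n → Bool → ℕ
          φ u v true  = 1
          φ u v false = 1 ∸ a u v
          P : ℕ
          P = ∑ Ω (λ ω → ∏∏ (λ u v → φ u v (bit ω u v)))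
          sum : ∀ u v → ∑ coin (φ u v) ≡ 1 ^ a u v * q ^ (1 ∸ a u v)
          sum u v = trans (∑-coin (φ u v)) (cases (lem (A u v)))
            where
            cases : Dec (A u v) → 1 + q′ * (1 ∸ a u v) ≡ 1 ^ a u v * q ^ (1 ∸ a u v)
            cases (yes p) rewrite 𝟙-yes p = cong suc (*-zeroʳ q′)
            cases (no ¬p) rewrite 𝟙-no ¬p = sym (+-identityʳ _)
          E≤ : ∀ ω → E ω ≤ ∏∏ (λ u v → φ u v (bit ω u v))
          E≤ ω = 𝟙-∏ n (λ e u → ∏-pos n (λ v → factor u v (e u v)))
            where
            factor : ∀ u v → (A u v → bit ω u v ≡ true) → 1 ≤ φ u v (bit ω u v)
            factor u v e with bit ω u v | lem (A u v)
            ... | true  | _     = ≤-refl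
            ... | false | yes p with () ← e p
            ... | false | no ¬p = ≤-reflexive (cong (1 ∸_) (sym (𝟙-no ¬p)))

      -- The head `p` is absent from the tail, so the indicators of the two add up without overlap.
      -- This converts the edge list of a cycle into an exponent for `containment`.
      ∑∑-Unique : (L : List (Fin n × Fin n)) → Unique L →
                  length L ≤ ∑∑ (λ u v → 𝟙 ((u , v) List.∈ L))
      ∑∑-Unique []      _          = z≤n
      ∑∑-Unique (p ∷ L) (p∉L ∷ uL) = begin
        1 + length L
          ≤⟨ +-mono-≤ one (∑∑-Unique L uL) ⟩
        ∑∑ (λ u v → 𝟙 ((u , v) ≡ p)) + ∑∑ (λ u v → 𝟙 ((u , v) List.∈ L))
          ≡⟨ trans (∑-cong (allFin n) (λ u → ∑-+ (allFin n) _ _)) (∑-+ (allFin n) _ _) ⟨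
        ∑∑ (λ u v → 𝟙 ((u , v) ≡ p) + 𝟙 ((u , v) List.∈ L))
          ≤⟨ ∑-mono (allFin n) (λ u → ∑-mono (allFin n) (λ v → disjoint u v)) ⟩
        ∑∑ (λ u v → 𝟙 ((u , v) List.∈ p ∷ L)) ∎
        where
        open ≤-Reasoning
        one : 1 ≤ ∑∑ (λ u v → 𝟙 ((u , v) ≡ p))
        one = ≤-trans (#-some (proj₂ p) refl) (∑-∈ (λ u → # (λ v → (u , v) ≡ p)) (∈-allFin (proj₁ p)))
        disjoint : ∀ u v → 𝟙 ((u , v) ≡ p) + 𝟙 ((u , v) List.∈ L) ≤ 𝟙 ((u , v) List.∈ p ∷ L)
        disjoint u v with lem ((u , v) ≡ p)
        ... | yes refl = ≤-reflexive (trans (cong suc (𝟙-no (All.All¬⇒¬Any p∉L))) (sym (𝟙-yes (here refl))))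
        ... | no _     = 𝟙-mono there

    -- Random subgraphs and the mean size of rich edgeless sets.

    1+d≤2^d : ∀ d → suc d ≤ 2 ^ d
    1+d≤2^d zero    = ≤-refl
    1+d≤2^d (suc d) = begin
      suc (suc d)       ≤⟨ s≤s (m≤n+m (suc d) d) ⟩
      suc (d + suc d)   ≡⟨ cong (suc d +_) (+-identityʳ (suc d)) ⟨
      2 * suc d         ≤⟨ *-monoʳ-≤ 2 (1+d≤2^d d) ⟩
      2 * 2 ^ d         ∎
      where open ≤-Reasoning

    -- On integers, s ↦ 2 ^ s lies above the line of slope 2 ^ a through (a , 2 ^ a).
    2^-tangent : ∀ a s → 2 ^ a * suc s ≤ 2 ^ a * a + 2 ^ s
    2^-tangent a s with a ≤? s
    ... | yes a≤s = begin
      2 ^ a * suc s                      ≡⟨ cong (λ s → 2 ^ a * suc s) (m+[n∸m]≡n a≤s) ⟨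
      2 ^ a * suc (a + d)                ≡⟨ lemma (2 ^ a) a d ⟩
      2 ^ a * a + 2 ^ a * suc d          ≤⟨ +-monoʳ-≤ (2 ^ a * a) (*-monoʳ-≤ (2 ^ a) (1+d≤2^d d)) ⟩
      2 ^ a * a + 2 ^ a * 2 ^ d          ≡⟨ cong (2 ^ a * a +_) (^-distribˡ-+-* 2 a d) ⟨
      2 ^ a * a + 2 ^ (a + d)            ≡⟨ cong (λ s → 2 ^ a * a + 2 ^ s) (m+[n∸m]≡n a≤s) ⟩
      2 ^ a * a + 2 ^ s                  ∎
      where
      open ≤-Reasoning
      d : ℕ
      d = s ∸ a
      lemma : ∀ x a d → x * suc (a + d) ≡ x * a + x * suc d
      lemma = solve-∀
    ... | no a≰s = ≤-trans (*-monoʳ-≤ (2 ^ a) (≰⇒> a≰s)) (m≤m+n _ _)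

    module _ (K : ℕ) where

      private
        y : ℕ
        y = 2 * K

      -- In quotients, (1 + 1/(2K))^j ≤ 1 + j/K. The inductive step reduces to K + j ≤ 2K, which is
      -- why the base involves 2K and the range ends at K.
      [1+2K]^-chord : ∀ j → j ≤ K → K * suc y ^ j ≤ (K + j) * y ^ j
      [1+2K]^-chord zero    _   = ≤-reflexive (cong (_* 1) (sym (+-identityʳ K)))
      [1+2K]^-chord (suc j) j<K = begin
        K * (suc y * suc y ^ j)      ≡⟨ swap K (suc y) (suc y ^ j) ⟩
        suc y * (K * suc y ^ j)      ≤⟨ *-monoʳ-≤ (suc y) ([1+2K]^-chord j (<⇒≤ j<K)) ⟩
        suc y * ((K + j) * y ^ j)    ≡⟨ *-assoc (suc y) (K + j) _ ⟨
        suc y * (K + j) * y ^ j      ≤⟨ *-monoˡ-≤ (y ^ j) step ⟩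
        (K + suc j) * y * y ^ j      ≡⟨ *-assoc (K + suc j) y _ ⟩
        (K + suc j) * (y * y ^ j)    ∎
        where
        open ≤-Reasoning
        swap : ∀ a b c → a * (b * c) ≡ b * (a * c)
        swap = solve-∀
        expand : ∀ K j → 2 * K * (K + j) + 2 * K ≡ (K + suc j) * (2 * K)
        expand = solve-∀
        step : suc y * (K + j) ≤ (K + suc j) * y
        step = begin
          suc y * (K + j)            ≡⟨ +-comm (K + j) _ ⟩
          y * (K + j) + (K + j)      ≤⟨ +-monoʳ-≤ (y * (K + j)) (+-monoʳ-≤ K (<⇒≤ j<K)) ⟩
          y * (K + j) + (K + K)      ≡⟨ cong (λ z → y * (K + j) + (K + z)) (+-identityʳ K) ⟨
          y * (K + j) + 2 * K        ≡⟨ expand K j ⟩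
          (K + suc j) * y            ∎

      [1+2K]^K≤2*[2K]^K : .⦃ _ : NonZero K ⦄ → suc y ^ K ≤ 2 * y ^ K
      [1+2K]^K≤2*[2K]^K = *-cancelˡ-≤ K (≤-trans ([1+2K]^-chord K ≤-refl) (≤-reflexive (lemma K (y ^ K))))
        where
        lemma : ∀ K z → (K + K) * z ≡ K * (2 * z)
        lemma = solve-∀

      -- A block of `K` factors costs 2 and the remainder follows the chord, so the bound
      -- interpolates 2^(k/K) linearly between multiples of `K`. The inequality `2^-tangent` has the
      -- same slope there, and the powers of two cancel in `mean-size`.
      [1+2K]^-bound : .⦃ _ : NonZero K ⦄ → ∀ a j → j ≤ K →
                      K * suc y ^ (j + a * K) ≤ 2 ^ a * (K + j) * y ^ (j + a * K)
      [1+2K]^-bound a j j≤K = begin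
        K * suc y ^ (j + a * K)                    ≡⟨ cong (K *_) (split (suc y)) ⟩
        K * (suc y ^ j * (suc y ^ K) ^ a)          ≡⟨ *-assoc K _ _ ⟨
        K * suc y ^ j * (suc y ^ K) ^ a            ≤⟨ *-mono-≤ ([1+2K]^-chord j j≤K) (^-monoˡ-≤ a [1+2K]^K≤2*[2K]^K) ⟩
        (K + j) * y ^ j * (2 * y ^ K) ^ a          ≡⟨ cong ((K + j) * y ^ j *_) (^-distribʳ-* a 2 (y ^ K)) ⟩
        (K + j) * y ^ j * (2 ^ a * (y ^ K) ^ a)    ≡⟨ lemma (K + j) (y ^ j) (2 ^ a) ((y ^ K) ^ a) ⟩
        2 ^ a * (K + j) * (y ^ j * (y ^ K) ^ a)    ≡⟨ cong (2 ^ a * (K + j) *_) (split y) ⟨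
        2 ^ a * (K + j) * y ^ (j + a * K)          ∎
        where
        open ≤-Reasoning
        split : ∀ x → x ^ (j + a * K) ≡ x ^ j * (x ^ K) ^ a
        split x = trans (^-distribˡ-+-* x j (a * K))
          (cong (x ^ j *_) (trans (cong (x ^_) (*-comm a K)) (sym (^-*-assoc x K a))))
        lemma : ∀ a b c d → a * b * (c * d) ≡ c * a * (b * d)
        lemma = solve-∀

    -- Every edge is governed by the bit in the row of the endpoint with the smaller key.
    module RandomSubgraph {n : ℕ} (G : Graph n) (key : Fin n → ℕ)
                          (key-injective : ∀ {u v} → key u ≡ key v → u ≡ v) (q′ : ℕ) where

      open RandomBits n q′ public
      open Graph G

      edgeBit : Bits → Fin n → Fin n → Bool
      edgeBit ω u v = ((key u <ᵇ key v) ∧ bit ω u v) ∨ ((key v <ᵇ key u) ∧ bit ω v u)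

      H : Bits → Graph n
      H ω = record
        { V          = V
        ; adj        = λ u v → adj u v ∧ edgeBit ω u v
        ; adj-sym    = λ {u} {v} e → let (g , b) = to T-∧ e in
            from T-∧ (adj-sym g , subst T (∨-comm ((key u <ᵇ key v) ∧ bit ω u v) _) b)
        ; adj-irrefl = λ e → adj-irrefl (proj₁ (to T-∧ e))
        ; adj⇒∈      = λ e → adj⇒∈ (proj₁ (to T-∧ e))
        }
        where open Equivalence

      module _ (ω : Bits) where
        open Equivalence

        H⇒G : ∀ {u v} → Graph.Adj (H ω) u v → Adj u v
        H⇒G e = proj₁ (to T-∧ e)

        H⇒bit : ∀ {u v} → key u < key v → Graph.Adj (H ω) u v → bit ω u v ≡ true
        H⇒bit {u} {v} u<v e with to (T-∨ {(key u <ᵇ key v) ∧ bit ω u v}) (proj₂ (to (T-∧ {adj u v}) e))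
        ... | inj₁ b = to T-≡ (proj₂ (to (T-∧ {key u <ᵇ key v}) b))
        ... | inj₂ b = contradiction (<ᵇ⇒< _ _ (proj₁ (to (T-∧ {key v <ᵇ key u}) b))) (<-asym u<v)

        bit⇒H : ∀ {u v} → key u < key v → Adj u v → bit ω u v ≡ true → Graph.Adj (H ω) u v
        bit⇒H {u} {v} u<v e b = from T-∧ (e , from (T-∨ {(key u <ᵇ key v) ∧ bit ω u v})
          (inj₁ (from T-∧ (<⇒<ᵇ u<v , from T-≡ b))))

      Back : Subset n → Fin n → Fin n → Set
      Back X u v = u ∈ X × v ∈ X × key u < key v × Adj u v

      size pairs : Subset n → ℕ
      size X  = # (_∈ X)
      pairs X = ∑∑ (λ u v → 𝟙 (Back X u v))

      Edgeless : Bits → Subset n → Set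
      Edgeless ω X = ∀ {u v} → u ∈ X → v ∈ X → ¬ Graph.Adj (H ω) u v

      edgeless-rare : ∀ X h → q * h ≤ pairs X → 2 ^ h * ∑ Ω (λ ω → 𝟙 (Edgeless ω X)) ≤ M
      edgeless-rare X h qh≤ = ≤-trans (*-monoʳ-≤ (2 ^ h) (∑-mono Ω (λ ω → 𝟙-mono (unlucky ω))))
        (avoidance (Back X) h qh≤)
        where
        unlucky : ∀ ω → Edgeless ω X → ∀ u v → Back X u v → bit ω u v ≡ false
        unlucky ω e u v (u∈ , v∈ , u<v , uv) with bit ω u v in eq
        ... | false = refl
        ... | true  = contradiction (bit⇒H ω u<v uv eq) (e u∈ v∈)

      module Moment (K κ : ℕ) .⦃ _ : NonZero K ⦄ (4K≤2^κ : 4 * K ≤ 2 ^ κ) where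

        -- The threshold at which `edgeless-rare` gives probability at most 2^(-κ size), and hence
        -- at most (4K)^(-size).
        Rich : Subset n → Set
        Rich X = q * (κ * size X) ≤ pairs X

        module _ (U : Fin n → Set) where

          private
            k : ℕ
            k = # U

            Good : Subset n → Set
            Good S = (∀ {v} → v ∈ S → U v) × Rich S

            -- The factor `2 ^ size S` makes `Y` dominate `2 ^ size X` for every rich edgeless `X`
            -- inside `U`, so the mean of `Y` controls an exponential moment of the size.
            Y : Bits → ℕ
            Y ω = ∑ (allSubsets n) (λ S → 𝟙 (Good S) * (2 ^ size S * 𝟙 (Edgeless ω S)))

            -- Vertex factors whose product is (2K)^(k - size S) when `S` lies in `U`; the factor 0
            -- excludes the sets that leave `U`.
            ψ′ : {A : Set} → Dec A → Bool → ℕ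
            ψ′ (yes _) true  = 1
            ψ′ (yes _) false = 2 * K
            ψ′ (no _)  true  = 0
            ψ′ (no _)  false = 1

            ψ : Fin n → Bool → ℕ
            ψ i = ψ′ (lem (U i))

            k-split : ∀ {S} → (∀ {v} → v ∈ S → U v) → k ≡ size S + # (λ v → U v × ¬ v ∈ S)
            k-split {S} S⊆U = begin
              # U ≡⟨ ∑-cong (allFin n) (λ v → 𝟙-split {U v} {v ∈ S}) ⟩
              ∑ (allFin n) (λ v → 𝟙 (U v × v ∈ S) + 𝟙 (U v × ¬ v ∈ S)) ≡⟨ ∑-+ (allFin n) _ _ ⟩
              # (λ v → U v × v ∈ S) + # (λ v → U v × ¬ v ∈ S)
                ≡⟨ cong (_+ # (λ v → U v × ¬ v ∈ S)) (∑-cong (allFin n) (λ v → 𝟙-cong proj₂ (λ v∈ → S⊆U v∈ , v∈))) ⟩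
              size S + # (λ v → U v × ¬ v ∈ S) ∎
              where open ≡-Reasoning

            ∏ψ : ∀ {S} → (∀ {v} → v ∈ S → U v) →
                 ∏ n (λ i → ψ i (lookup S i)) ≡ (2 * K) ^ # (λ v → U v × ¬ v ∈ S)
            ∏ψ {S} S⊆U = trans (∏-cong n factor) (∏-^ n (2 * K) _)
              where
              factor : ∀ i → ψ i (lookup S i) ≡ (2 * K) ^ 𝟙 (U i × ¬ i ∈ S)
              factor i with lookup S i in eq | lem (U i)
              ... | true  | yes _ = sym (cong ((2 * K) ^_) (𝟙-no (λ p → proj₂ p (lookup⇒[]= i S eq))))
              ... | true  | no ¬u = contradiction (S⊆U (lookup⇒[]= i S eq)) ¬u
              ... | false | yes u = sym (trans (cong ((2 * K) ^_) (𝟙-yes (u , i∉))) (*-identityʳ (2 * K)))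
                where
                i∉ : ¬ i ∈ S
                i∉ i∈ with () ← trans (sym eq) ([]=⇒lookup i∈)
              ... | false | no ¬u = sym (cong ((2 * K) ^_) (𝟙-no (λ p → ¬u (proj₁ p))))

            ∏∑ψ : ∏ n (λ i → ψ i false + ψ i true) ≡ suc (2 * K) ^ k
            ∏∑ψ = trans (∏-cong n factor) (∏-^ n (suc (2 * K)) _)
              where
              factor : ∀ i → ψ i false + ψ i true ≡ suc (2 * K) ^ 𝟙 (U i)
              factor i with lem (U i)
              ... | yes u = trans (+-comm (2 * K) 1) (sym (*-identityʳ _))
              ... | no ¬u = refl

            -- By `4 * K ≤ 2 ^ κ`, the factor 2^size times the probability 2^(-κ size) is at most
            -- (2K)^(-size). Multiplication by (2K)^k leaves one factor 2K for each vertex of `U`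
            -- outside `S`.
            summand : ∀ S → 𝟙 (Good S) * (2 ^ size S * ∑ Ω (λ ω → 𝟙 (Edgeless ω S))) * (2 * K) ^ k ≤
                      M * ∏ n (λ i → ψ i (lookup S i))
            summand S with lem (Good S)
            ... | no _ = z≤n
            ... | yes (S⊆U , rich) = begin
              1 * (2 ^ s * N) * y ^ k            ≡⟨ cong (λ k → 1 * (2 ^ s * N) * y ^ k) (k-split S⊆U) ⟩
              1 * (2 ^ s * N) * y ^ (s + e)      ≡⟨ cong (1 * (2 ^ s * N) *_) (^-distribˡ-+-* y s e) ⟩
              1 * (2 ^ s * N) * (y ^ s * y ^ e)  ≡⟨ lemma (2 ^ s) N (y ^ s) (y ^ e) ⟩
              2 ^ s * y ^ s * N * y ^ e          ≡⟨ cong (λ z → z * N * y ^ e) (^-distribʳ-* s 2 y) ⟨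
              (2 * y) ^ s * N * y ^ e            ≤⟨ *-monoˡ-≤ (y ^ e) (*-monoˡ-≤ N (^-monoˡ-≤ s 2y≤)) ⟩
              (2 ^ κ) ^ s * N * y ^ e            ≡⟨ cong (λ z → z * N * y ^ e) (^-*-assoc 2 κ s) ⟩
              2 ^ (κ * s) * N * y ^ e            ≤⟨ *-monoˡ-≤ (y ^ e) (edgeless-rare S (κ * s) rich) ⟩
              M * y ^ e                          ≡⟨ cong (M *_) (∏ψ S⊆U) ⟨
              M * ∏ n (λ i → ψ i (lookup S i))   ∎
              where
              open ≤-Reasoning
              s y N e : ℕ
              s = size S
              y = 2 * K
              N = ∑ Ω (λ ω → 𝟙 (Edgeless ω S))
              e = # (λ v → U v × ¬ v ∈ S)
              lemma : ∀ a b c d → 1 * (a * b) * (c * d) ≡ a * c * b * d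
              lemma = solve-∀
              2y≤ : 2 * y ≤ 2 ^ κ
              2y≤ = ≤-trans (≤-reflexive (sym (*-assoc 2 2 K))) 4K≤2^κ

            ∑Y-bound : ∑ Ω Y * (2 * K) ^ k ≤ M * suc (2 * K) ^ k
            ∑Y-bound = begin
              ∑ Ω Y * (2 * K) ^ k
                ≡⟨ cong (_* (2 * K) ^ k) (trans (∑-swap Ω (allSubsets n) _) (∑-cong (allSubsets n) factor)) ⟩
              ∑ (allSubsets n) (λ S → 𝟙 (Good S) * (2 ^ size S * N S)) * (2 * K) ^ k
                ≡⟨ ∑-*ʳ (allSubsets n) _ _ ⟨
              ∑ (allSubsets n) (λ S → 𝟙 (Good S) * (2 ^ size S * N S) * (2 * K) ^ k)
                ≤⟨ ∑-mono (allSubsets n) summand ⟩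
              ∑ (allSubsets n) (λ S → M * ∏ n (λ i → ψ i (lookup S i)))
                ≡⟨ ∑-* (allSubsets n) M _ ⟩
              M * ∑ (allSubsets n) (λ S → ∏ n (λ i → ψ i (lookup S i)))
                ≡⟨ cong (M *_) (trans (∑-allSubsets-∏ n ψ) ∏∑ψ) ⟩
              M * suc (2 * K) ^ k ∎
              where
              open ≤-Reasoning
              N : Subset n → ℕ
              N S = ∑ Ω (λ ω → 𝟙 (Edgeless ω S))
              factor : ∀ S → ∑ Ω (λ ω → 𝟙 (Good S) * (2 ^ size S * 𝟙 (Edgeless ω S))) ≡
                             𝟙 (Good S) * (2 ^ size S * N S)
              factor S = trans (∑-* Ω (𝟙 (Good S)) _) (cong (𝟙 (Good S) *_) (∑-* Ω (2 ^ size S) _))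

          module _ (X : Bits → Subset n) (X⊆U : ∀ ω {v} → v ∈ X ω → U v)
                   (edgeless : ∀ ω → Edgeless ω (X ω)) (rich : ∀ ω → Rich (X ω)) where

            private
              a j : ℕ
              a = k / K
              j = k % K

              k≡ : k ≡ j + a * K
              k≡ = m≡m%n+[m/n]*n k K

              Z : ℕ
              Z = ∑ Ω (size ∘ X)

              2^≤Y : ∀ ω → 2 ^ size (X ω) ≤ Y ω
              2^≤Y ω = ≤-trans (≤-reflexive (sym lemma)) (∑-∈ _ (∈-allSubsets (X ω)))
                where
                lemma : 𝟙 (Good (X ω)) * (2 ^ size (X ω) * 𝟙 (Edgeless ω (X ω))) ≡ 2 ^ size (X ω)
                lemma rewrite 𝟙-yes {Good (X ω)} (X⊆U ω , rich ω) | 𝟙-yes {Edgeless ω (X ω)} (edgeless ω) =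
                  trans (+-identityʳ _) (*-identityʳ _)

              K∑Y≤ : K * ∑ Ω Y ≤ M * (2 ^ a * (K + j))
              K∑Y≤ = *-cancelʳ-≤ _ _ ((2 * K) ^ k) ⦃ m^n≢0 (2 * K) k ⦃ m*n≢0 2 K ⦄ ⦄ (begin
                K * ∑ Ω Y * (2 * K) ^ k                 ≡⟨ *-assoc K _ _ ⟩
                K * (∑ Ω Y * (2 * K) ^ k)               ≤⟨ *-monoʳ-≤ K ∑Y-bound ⟩
                K * (M * suc (2 * K) ^ k)               ≡⟨ swap K M _ ⟩
                M * (K * suc (2 * K) ^ k)               ≤⟨ *-monoʳ-≤ M (subst (λ k → K * suc (2 * K) ^ k ≤ 2 ^ a * (K + j) * (2 * K) ^ k)
                                                             (sym k≡) ([1+2K]^-bound K a j (<⇒≤ (m%n<n k K)))) ⟩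
                M * (2 ^ a * (K + j) * (2 * K) ^ k)     ≡⟨ *-assoc M _ _ ⟨
                M * (2 ^ a * (K + j)) * (2 * K) ^ k     ∎)
                where
                open ≤-Reasoning
                swap : ∀ a b c → a * (b * c) ≡ b * (a * c)
                swap = solve-∀

              2^a∑≤ : 2 ^ a * (Z + M) ≤ M * (2 ^ a * a) + ∑ Ω Y
              2^a∑≤ = begin
                2 ^ a * (Z + M)
                  ≡⟨ cong (2 ^ a *_) (trans (cong (Z +_) (sym (trans (∑-const Ω 1) (*-identityʳ M)))) (sym (∑-+ Ω _ _))) ⟩
                2 ^ a * ∑ Ω (λ ω → size (X ω) + 1)
                  ≡⟨ ∑-* Ω (2 ^ a) _ ⟨
                ∑ Ω (λ ω → 2 ^ a * (size (X ω) + 1))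
                  ≤⟨ ∑-mono Ω (λ ω → ≤-trans (≤-reflexive (cong (2 ^ a *_) (+-comm _ 1)))
                       (≤-trans (2^-tangent a (size (X ω))) (+-monoʳ-≤ (2 ^ a * a) (2^≤Y ω)))) ⟩
                ∑ Ω (λ ω → 2 ^ a * a + Y ω)
                  ≡⟨ trans (∑-+ Ω _ Y) (cong (_+ ∑ Ω Y) (∑-const Ω (2 ^ a * a))) ⟩
                M * (2 ^ a * a) + ∑ Ω Y ∎
                where open ≤-Reasoning

            -- Linearise 2 ^ size (X ω) ≤ Y ω at a = k / K; unlike a tail bound, this loses nothing for k < K.
            mean-size : K * ∑ Ω (size ∘ X) ≤ M * # U
            mean-size = +-cancelʳ-≤ (K * M) _ _ (*-cancelˡ-≤ (2 ^ a) ⦃ m^n≢0 2 a ⦄ (begin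
              2 ^ a * (K * Z + K * M)                            ≡⟨ eq₁ (2 ^ a) K Z M ⟩
              K * (2 ^ a * (Z + M))                              ≤⟨ *-monoʳ-≤ K 2^a∑≤ ⟩
              K * (M * (2 ^ a * a) + ∑ Ω Y)                      ≡⟨ *-distribˡ-+ K _ _ ⟩
              K * (M * (2 ^ a * a)) + K * ∑ Ω Y                  ≤⟨ +-monoʳ-≤ (K * (M * (2 ^ a * a))) K∑Y≤ ⟩
              K * (M * (2 ^ a * a)) + M * (2 ^ a * (K + j))      ≡⟨ eq₂ (2 ^ a) K M a j ⟩
              2 ^ a * (M * (j + a * K) + K * M)                  ≡⟨ cong (λ k → 2 ^ a * (M * k + K * M)) k≡ ⟨
              2 ^ a * (M * k + K * M)                            ∎))
              where
              open ≤-Reasoning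
              eq₁ : ∀ x K Z M → x * (K * Z + K * M) ≡ K * (x * (Z + M))
              eq₁ = solve-∀
              eq₂ : ∀ x K M a j → K * (M * (x * a)) + M * (x * (K + j)) ≡ x * (M * (j + a * K) + K * M)
              eq₂ = solve-∀

    by-contradiction : {A : Set} → ¬ ¬ A → A
    by-contradiction {A} = decidable-stable (lem A)

    -- Weighted graphs: degenerate sets, layers and concentration.

    module Weighted {n : ℕ} (G : Graph n) (w : Fin n → ℕ) where

      open Graph G

      wt : (Fin n → Set) → ℕ
      wt P = ∑ (allFin n) (λ v → w v * 𝟙 (P v))

      W : ℕ
      W = ∑ (allFin n) w

      wt-mono : {P Q : Fin n → Set} → (∀ v → P v → Q v) → wt P ≤ wt Q
      wt-mono P⇒Q = ∑-mono (allFin n) (λ v → *-monoʳ-≤ (w v) (𝟙-mono (P⇒Q v)))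

      wt-cong : {P Q : Fin n → Set} → (∀ v → P v → Q v) → (∀ v → Q v → P v) → wt P ≡ wt Q
      wt-cong f g = ≤-antisym (wt-mono f) (wt-mono g)

      wt-split : {P Q : Fin n → Set} → wt P ≡ wt (λ v → P v × Q v) + wt (λ v → P v × ¬ Q v)
      wt-split {P} {Q} = trans
        (∑-cong (allFin n) (λ v → trans (cong (w v *_) (𝟙-split {P v} {Q v})) (*-distribˡ-+ (w v) _ _)))
        (∑-+ (allFin n) _ _)

      w≤W : ∀ v → w v ≤ W
      w≤W v = ∑-∈ w (∈-allFin v)

      module Degeneracy (key : Fin n → ℕ) (key-injective : ∀ {u v} → key u ≡ key v → u ≡ v) where

        -- The independent set built greedily along increasing keys.
        module Kernel (P : Fin n → Set) where

          -- The number is fuel for a recursion that descends along keys; by `Greedy-stable` every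
          -- value above `key v` gives the same answer.
          Greedy : ℕ → Fin n → Set
          Greedy zero    v = ⊥
          Greedy (suc k) v = P v × ¬ (∃[ u ] key u < key v × Adj u v × Greedy k u)

          Greedy-stable : ∀ k k′ {v} → key v < k → key v < k′ → Greedy k v → Greedy k′ v
          Greedy-stable (suc k) (suc k′) v<k v<k′ (Pv , none) =
            Pv , λ (u , u<v , uv , gu) → none (u , u<v , uv ,
              Greedy-stable k′ k (<-≤-trans u<v (s≤s⁻¹ v<k′)) (<-≤-trans u<v (s≤s⁻¹ v<k)) gu)

          I : Fin n → Set
          I v = Greedy (suc (key v)) v

          I⊆P : ∀ {v} → I v → P v
          I⊆P = proj₁

          I-back : ∀ {u v} → key u < key v → I u → I v → ¬ Adj u v
          I-back u<v Iu (_ , none) uv = none (_ , u<v , uv , Greedy-stable _ _ ≤-refl u<v Iu)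

          I-independent : ∀ {u v} → I u → I v → ¬ Adj u v
          I-independent {u} {v} Iu Iv uv with <-cmp (key u) (key v)
          ... | tri< u<v _ _ = I-back u<v Iu Iv uv
          ... | tri≈ _ u≡v _ with refl ← key-injective u≡v = adj-irrefl uv
          ... | tri> _ _ v<u = I-back v<u Iv Iu (adj-sym uv)

          -- A vertex is refused only because an earlier chosen neighbour blocks it. This makes all
          -- remaining back-degrees drop when `I` is removed.
          I-dominating : ∀ {v} → P v → ¬ I v → ∃[ u ] key u < key v × Adj u v × I u
          I-dominating Pv ¬Iv = by-contradiction λ none → ¬Iv (Pv , λ (u , u<v , uv , gu) →
            none (u , u<v , uv , Greedy-stable _ _ u<v ≤-refl gu))

        module _ (L : ℕ) (light : ∀ I → IsIndependent G I → L * wt (_∈ I) ≤ W) where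

          -- Removing the greedy set takes a back-neighbour from every remaining vertex, so `d`
          -- rounds exhaust `P`, and each round removes an independent set of weight at most W / L.
          degenerate-light : ∀ d (P : Fin n → Set) → (∀ {v} → P v → v ∈ V) →
            (∀ {v} → P v → # (λ u → P u × key u < key v × Adj u v) < d) → L * wt P ≤ d * W
          degenerate-light zero P P⊆V deg<d =
            ≤-reflexive (trans (cong (L *_) (trans (∑-cong (allFin n) empty) (∑-zero (allFin n)))) (*-zeroʳ L))
            where
            empty : ∀ v → w v * 𝟙 (P v) ≡ 0
            empty v = trans (cong (w v *_) (𝟙-no (λ Pv → n≮0 (deg<d Pv)))) (*-zeroʳ (w v))
          degenerate-light (suc d) P P⊆V deg<d = begin
            L * wt P                                 ≡⟨ cong (L *_) (wt-split {P} {I}) ⟩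
            L * (wt (λ v → P v × I v) + wt P′)        ≡⟨ *-distribˡ-+ L _ _ ⟩
            L * wt (λ v → P v × I v) + L * wt P′      ≤⟨ +-mono-≤ (*-monoʳ-≤ L (wt-mono (λ v p → ∈⟪⟫⁺ (proj₂ p)))) (degenerate-light d P′ (P⊆V ∘ proj₁) deg′<d) ⟩
            L * wt (_∈ ⟪ I ⟫) + d * W                ≤⟨ +-monoˡ-≤ (d * W) (light ⟪ I ⟫ independent) ⟩
            W + d * W                                ∎
            where
            open ≤-Reasoning
            open Kernel P
            P′ : Fin n → Set
            P′ v = P v × ¬ I v
            independent : IsIndependent G ⟪ I ⟫
            independent = (λ v∈ → P⊆V (I⊆P (∈⟪⟫⁻ v∈))) , λ u∈ v∈ → I-independent (∈⟪⟫⁻ u∈) (∈⟪⟫⁻ v∈)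
            deg′<d : ∀ {v} → P′ v → # (λ u → P′ u × key u < key v × Adj u v) < d
            deg′<d {v} (Pv , ¬Iv) with I-dominating Pv ¬Iv
            ... | u₀ , u₀<v , u₀v , Iu₀ = s≤s⁻¹ (≤-trans (s≤s (begin
              suc (# (λ u → P′ u × Nb u))                  ≤⟨ +-monoˡ-≤ _ (#-some u₀ (I⊆P Iu₀ , Iu₀ , u₀<v , u₀v)) ⟩
              # (λ u → P u × I u × Nb u) + # (λ u → P′ u × Nb u) ≡⟨ +-comm (# (λ u → P u × I u × Nb u)) _ ⟩
              # (λ u → P′ u × Nb u) + # (λ u → P u × I u × Nb u) ≡⟨ ∑-+ (allFin n) _ _ ⟨
              ∑ (allFin n) (λ u → 𝟙 (P′ u × Nb u) + 𝟙 (P u × I u × Nb u)) ≤⟨ ∑-mono (allFin n) disjoint ⟩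
              # (λ u → P u × Nb u)                         ∎)) (deg<d Pv))
              where
              Nb : Fin n → Set
              Nb u = key u < key v × Adj u v
              disjoint : ∀ u → 𝟙 (P′ u × Nb u) + 𝟙 (P u × I u × Nb u) ≤ 𝟙 (P u × Nb u)
              disjoint u = ≤-trans
                (+-mono-≤ (𝟙-mono {B = (P u × Nb u) × ¬ I u} (λ ((p , ¬i) , nb) → (p , nb) , ¬i))
                          (𝟙-mono {B = (P u × Nb u) × I u} (λ (p , i , nb) → (p , nb) , i)))
                (≤-reflexive (trans (+-comm (𝟙 ((P u × Nb u) × ¬ I u)) _) (sym (𝟙-split {P u × Nb u} {I u}))))

      -- Layer-cake summation: `w v` counts the thresholds below it, and thresholds below `W`
      -- suffice because `w v ≤ W`.
      layers : ∀ (P : Fin n → Set) → wt P ≡ ∑ (upTo W) (λ θ → # (λ v → P v × θ < w v))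
      layers P = begin
        wt P ≡⟨ ∑-cong (allFin n) (λ v → sym (layer v)) ⟩
        ∑ (allFin n) (λ v → ∑ (upTo W) (λ θ → 𝟙 (P v × θ < w v))) ≡⟨ ∑-swap (allFin n) (upTo W) _ ⟩
        ∑ (upTo W) (λ θ → # (λ v → P v × θ < w v)) ∎
        where
        open ≡-Reasoning
        count : ∀ m k → m ≤ k → ∑ (upTo k) (λ θ → 𝟙 (θ < m)) ≡ m
        count m zero z≤n = refl
        count zero    (suc k) _ = trans (∑-cong (upTo (suc k)) (λ θ → 𝟙-no n≮0)) (∑-zero (upTo (suc k)))
        count (suc m) (suc k) (s≤s m≤k) = trans (∑-upTo-suc k _)
          (cong₂ _+_ (𝟙-yes z<s) (trans (∑-cong (upTo k) (λ θ → 𝟙-cong s<s⁻¹ s<s)) (count m k m≤k)))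
        layer : ∀ v → ∑ (upTo W) (λ θ → 𝟙 (P v × θ < w v)) ≡ w v * 𝟙 (P v)
        layer v = begin
          ∑ (upTo W) (λ θ → 𝟙 (P v × θ < w v))          ≡⟨ ∑-cong (upTo W) (λ θ → 𝟙-×) ⟩
          ∑ (upTo W) (λ θ → 𝟙 (P v) * 𝟙 (θ < w v))      ≡⟨ ∑-* (upTo W) (𝟙 (P v)) _ ⟩
          𝟙 (P v) * ∑ (upTo W) (λ θ → 𝟙 (θ < w v))      ≡⟨ cong (𝟙 (P v) *_) (count (w v) W (w≤W v)) ⟩
          𝟙 (P v) * w v                                 ≡⟨ *-comm (𝟙 (P v)) (w v) ⟩
          w v * 𝟙 (P v)                                 ∎

      wt-all : ∀ {P : Fin n → Set} → (∀ v → P v) → wt P ≡ W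
      wt-all p = ∑-cong (allFin n) (λ v → trans (cong (w v *_) (𝟙-yes (p v))) (*-identityʳ (w v)))

      module Concentration
        (key : Fin n → ℕ) (key-injective : ∀ {u v} → key u ≡ key v → u ≡ v)
        (key-antitone : ∀ {u v} → key u < key v → w v ≤ w u)
        (q′ K κ L : ℕ) .⦃ _ : NonZero K ⦄ .⦃ _ : NonZero κ ⦄
        (4K≤2^κ : 4 * K ≤ 2 ^ κ) (L≤K : L ≤ K)
        (light : ∀ I → IsIndependent G I → L * wt (_∈ I) ≤ W)
        where

        open RandomSubgraph G key key-injective q′ public
        open Moment K κ 4K≤2^κ
        open Degeneracy key key-injective

        module _ (S : Bits → Subset n) (S⊆V : ∀ ω → S ω ⊆ V) (edgeless : ∀ ω → Edgeless ω (S ω)) where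

          private
            -- Four times the richness threshold, so that heavy vertices are a minority of every
            -- poor layer and their share can be absorbed in `pointwise`.
            d : ℕ
            d = 4 * (q * κ)

            Heavy : Bits → Fin n → Set
            Heavy ω v = d ≤ # (λ u → Back (S ω) u v)

            layer : ℕ → Bits → Subset n
            layer θ ω = ⟪ (λ v → v ∈ S ω × θ < w v) ⟫

            richLayer′ : ∀ θ ω → Dec (Rich (layer θ ω)) → Subset n
            richLayer′ θ ω (yes _) = layer θ ω
            richLayer′ θ ω (no _)  = ⟪ (λ _ → ⊥) ⟫

            -- A poor layer is replaced by the empty set, which is trivially rich; this gives a
            -- family with the hypotheses of `mean-size` at every outcome.
            richLayer : ℕ → Bits → Subset n
            richLayer θ ω = richLayer′ θ ω (lem _)

            richLayer⊆ : ∀ θ ω {v} → v ∈ richLayer θ ω → v ∈ S ω × θ < w v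
            richLayer⊆ θ ω v∈ with lem (Rich (layer θ ω))
            ... | yes _ = ∈⟪⟫⁻ v∈
            ... | no _  = ⊥-elim (∈⟪⟫⁻ v∈)

            size-∅ : size ⟪ (λ _ → ⊥) ⟫ ≡ 0
            size-∅ = #-none {n = n} {P = _∈ ⟪ (λ _ → ⊥) ⟫} (λ v v∈ → ∈⟪⟫⁻ {P = λ _ → ⊥} v∈)

            richLayer-rich : ∀ θ ω → Rich (richLayer θ ω)
            richLayer-rich θ ω with lem (Rich (layer θ ω))
            ... | yes rich = rich
            ... | no _     = ≤-trans (≤-reflexive (trans (cong (λ s → q * (κ * s)) size-∅)
                               (trans (cong (q *_) (*-zeroʳ κ)) (*-zeroʳ q)))) z≤n

            size-layer : ∀ θ ω → size (layer θ ω) ≡ # (λ v → v ∈ S ω × θ < w v)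
            size-layer θ ω = ∑-cong (allFin n) (λ v → 𝟙-cong ∈⟪⟫⁻ ∈⟪⟫⁺)

            heavy : ℕ → Bits → ℕ
            heavy θ ω = # (λ v → (v ∈ S ω × Heavy ω v) × θ < w v)

            -- Back-neighbours are at least as heavy, so they stay in the layer.
            pairs-layer : ∀ θ ω → d * heavy θ ω ≤ pairs (layer θ ω)
            pairs-layer θ ω = begin
              d * heavy θ ω
                ≡⟨ ∑-* (allFin n) d _ ⟨
              ∑ (allFin n) (λ v → d * 𝟙 ((v ∈ S ω × Heavy ω v) × θ < w v))
                ≤⟨ ∑-mono (allFin n) degree ⟩
              ∑ (allFin n) (λ v → # (λ u → Back (layer θ ω) u v))
                ≡⟨ ∑-swap (allFin n) (allFin n) _ ⟩
              pairs (layer θ ω) ∎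
              where
              open ≤-Reasoning
              degree : ∀ v → d * 𝟙 ((v ∈ S ω × Heavy ω v) × θ < w v) ≤ # (λ u → Back (layer θ ω) u v)
              degree v with lem ((v ∈ S ω × Heavy ω v) × θ < w v)
              ... | no _ = ≤-trans (≤-reflexive (*-zeroʳ d)) z≤n
              ... | yes ((v∈ , d≤) , θ<) = ≤-trans (≤-reflexive (*-identityʳ d)) (≤-trans d≤
                (#-mono {P = λ u → Back (S ω) u v} {Q = λ u → Back (layer θ ω) u v} (λ u (u∈ , _ , u<v , uv) →
                  ∈⟪⟫⁺ (u∈ , <-≤-trans θ< (key-antitone u<v)) , ∈⟪⟫⁺ (v∈ , θ<) , u<v , uv)))

            -- A rich layer is charged in full to `richLayer`. In a poor one, `d` pairs per heavy
            -- vertex leave room for less than a quarter of the layer.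
            heavy-layer : ∀ θ ω → 4 * heavy θ ω ≤ # (λ v → v ∈ S ω × θ < w v) + 4 * size (richLayer θ ω)
            heavy-layer θ ω with lem (Rich (layer θ ω))
            ... | yes _ = ≤-trans (*-monoʳ-≤ 4 (≤-trans
              (#-mono {P = λ v → (v ∈ S ω × Heavy ω v) × θ < w v} {Q = λ v → v ∈ S ω × θ < w v}
                (λ v ((v∈ , _) , θ<) → v∈ , θ<))
              (≤-reflexive (sym (size-layer θ ω))))) (m≤n+m (4 * size (layer θ ω)) (# (λ v → v ∈ S ω × θ < w v)))
            ... | no poor = ≤-trans (<⇒≤ (*-cancelˡ-< (q * κ) _ _ (begin-strict
              q * κ * (4 * heavy θ ω)   ≡⟨ eq (q * κ) (heavy θ ω) ⟩
              d * heavy θ ω             ≤⟨ pairs-layer θ ω ⟩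
              pairs (layer θ ω)         <⟨ ≰⇒> poor ⟩
              q * (κ * size (layer θ ω)) ≡⟨ trans (sym (*-assoc q κ _)) (cong (q * κ *_) (size-layer θ ω)) ⟩
              q * κ * # (λ v → v ∈ S ω × θ < w v) ∎))) (m≤m+n _ _)
              where
              open ≤-Reasoning
              eq : ∀ x y → x * (4 * y) ≡ 4 * x * y
              eq = solve-∀

            R : Bits → ℕ
            R ω = ∑ (upTo W) (λ θ → size (richLayer θ ω))

            s : Bits → ℕ
            s ω = wt (_∈ S ω)

            heavy-wt : ∀ ω → 4 * wt (λ v → v ∈ S ω × Heavy ω v) ≤ s ω + 4 * R ω
            heavy-wt ω = begin
              4 * wt (λ v → v ∈ S ω × Heavy ω v)
                ≡⟨ cong (4 *_) (layers _) ⟩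
              4 * ∑ (upTo W) (λ θ → heavy θ ω)
                ≡⟨ ∑-* (upTo W) 4 _ ⟨
              ∑ (upTo W) (λ θ → 4 * heavy θ ω)
                ≤⟨ ∑-mono (upTo W) (λ θ → heavy-layer θ ω) ⟩
              ∑ (upTo W) (λ θ → # (λ v → v ∈ S ω × θ < w v) + 4 * size (richLayer θ ω))
                ≡⟨ trans (∑-+ (upTo W) _ _) (cong₂ _+_ (sym (layers (_∈ S ω))) (∑-* (upTo W) 4 _)) ⟩
              s ω + 4 * R ω ∎
              where open ≤-Reasoning

            light-wt : ∀ ω → L * wt (λ v → v ∈ S ω × ¬ Heavy ω v) ≤ d * W
            light-wt ω = degenerate-light L light d _ (S⊆V ω ∘ proj₁)
              (λ {v} (v∈ , ¬heavy) → ≤-<-trans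
                (#-mono {P = λ u → (u ∈ S ω × ¬ Heavy ω u) × key u < key v × Adj u v} {Q = λ u → Back (S ω) u v}
                  (λ u ((u∈ , _) , u<v , uv) → u∈ , v∈ , u<v , uv)) (≰⇒> ¬heavy))

            -- Of four copies of `L * s ω`, the poor layers give back one, which is cancelled; hence
            -- the factor 3.
            pointwise : ∀ ω → 3 * (L * s ω) ≤ 4 * (d * W) + 4 * (L * R ω)
            pointwise ω = +-cancelʳ-≤ (L * s ω) _ _ (begin
              3 * (L * s ω) + L * s ω           ≡⟨ eq₁ (L * s ω) ⟩
              4 * (L * s ω)                     ≡⟨ cong (λ z → 4 * (L * z)) (wt-split {_∈ S ω} {Heavy ω}) ⟩
              4 * (L * (h + l))                 ≡⟨ eq₂ L h l ⟩
              4 * (L * l) + L * (4 * h)         ≤⟨ +-mono-≤ (*-monoʳ-≤ 4 (light-wt ω)) (*-monoʳ-≤ L (heavy-wt ω)) ⟩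
              4 * (d * W) + L * (s ω + 4 * R ω) ≡⟨ eq₃ (4 * (d * W)) L (s ω) (R ω) ⟩
              4 * (d * W) + 4 * (L * R ω) + L * s ω ∎)
              where
              open ≤-Reasoning
              h l : ℕ
              h = wt (λ v → v ∈ S ω × Heavy ω v)
              l = wt (λ v → v ∈ S ω × ¬ Heavy ω v)
              eq₁ : ∀ x → 3 * x + x ≡ 4 * x
              eq₁ = solve-∀
              eq₂ : ∀ L h l → 4 * (L * (h + l)) ≡ 4 * (L * l) + L * (4 * h)
              eq₂ = solve-∀
              eq₃ : ∀ x L s R → x + L * (s + 4 * R) ≡ x + 4 * (L * R) + L * s
              eq₃ = solve-∀

            -- At each threshold `mean-size` compares with the layer of the whole vertex set, and
            -- these layers add up to `W`. Neither the number of vertices nor that of thresholds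
            -- enters.
            L∑R≤ : L * ∑ Ω R ≤ M * W
            L∑R≤ = begin
              L * ∑ Ω R
                ≤⟨ *-monoˡ-≤ (∑ Ω R) L≤K ⟩
              K * ∑ Ω R
                ≡⟨ cong (K *_) (∑-swap Ω (upTo W) _) ⟩
              K * ∑ (upTo W) (λ θ → ∑ Ω (λ ω → size (richLayer θ ω)))
                ≡⟨ ∑-* (upTo W) K _ ⟨
              ∑ (upTo W) (λ θ → K * ∑ Ω (λ ω → size (richLayer θ ω)))
                ≤⟨ ∑-mono (upTo W) mean ⟩
              ∑ (upTo W) (λ θ → M * # (λ v → θ < w v))
                ≡⟨ ∑-* (upTo W) M _ ⟩
              M * ∑ (upTo W) (λ θ → # (λ v → θ < w v))
                -- The predicate `0 ≤ 0` stands for one that holds everywhere.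
                ≡⟨ cong (M *_) (trans (∑-cong (upTo W) (λ θ → ∑-cong (allFin n) (λ v → 𝟙-cong (z≤n {0} ,_) proj₂))) (sym (layers (λ _ → 0 ≤ 0)))) ⟩
              M * wt (λ _ → 0 ≤ 0)
                ≡⟨ cong (M *_) (wt-all (λ _ → z≤n)) ⟩
              M * W ∎
              where
              open ≤-Reasoning
              mean : ∀ θ → K * ∑ Ω (λ ω → size (richLayer θ ω)) ≤ M * # (λ v → θ < w v)
              mean θ = mean-size (λ v → θ < w v) (richLayer θ) (λ ω v∈ → proj₂ (richLayer⊆ θ ω v∈))
                (λ ω u∈ v∈ → edgeless ω (proj₁ (richLayer⊆ θ ω u∈)) (proj₁ (richLayer⊆ θ ω v∈)))
                (richLayer-rich θ)

          -- With `d = 4 * (q * κ)`, the light vertices contribute 16 q κ, and the rich layers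
          -- another 16 q κ after their share `4 * (M * W)` is enlarged by the factor `d`.
          mean-weight : 3 * (L * ∑ Ω (λ ω → wt (_∈ S ω))) ≤ 32 * (q * κ) * (M * W)
          mean-weight = begin
            3 * (L * ∑ Ω s)
              ≡⟨ trans (∑-* Ω 3 _) (cong (3 *_) (∑-* Ω L s)) ⟨
            ∑ Ω (λ ω → 3 * (L * s ω))
              ≤⟨ ∑-mono Ω pointwise ⟩
            ∑ Ω (λ ω → 4 * (d * W) + 4 * (L * R ω))
              ≡⟨ trans (∑-+ Ω _ _) (cong₂ _+_ (∑-const Ω _) (trans (∑-* Ω 4 _) (cong (4 *_) (∑-* Ω L R)))) ⟩
            M * (4 * (d * W)) + 4 * (L * ∑ Ω R)
              ≤⟨ +-monoʳ-≤ (M * (4 * (d * W))) (*-monoʳ-≤ 4 L∑R≤) ⟩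
            M * (4 * (d * W)) + 4 * (M * W)
              ≤⟨ +-monoʳ-≤ (M * (4 * (d * W))) (*-monoʳ-≤ 4 (m≤n*m (M * W) d ⦃ m*n≢0 4 (q * κ) ⦃ _ ⦄ ⦃ m*n≢0 q κ ⦄ ⦄)) ⟩
            M * (4 * (d * W)) + 4 * (d * (M * W))
              ≡⟨ eq (q * κ) M W ⟩
            32 * (q * κ) * (M * W) ∎
            where
            open ≤-Reasoning
            eq : ∀ x M W → M * (4 * (4 * x * W)) + 4 * (4 * x * (M * W)) ≡ 32 * x * (M * W)
            eq = solve-∀

    -- The sparse subgraph: surviving short cycles and the choice of an outcome.

    argmax : {A : Set} (f : A → ℕ) (P : A → Set) {a : A} → P a → ∀ xs →
             ∃[ m ] (P m × ∀ {x} → x List.∈ xs → P x → f x ≤ f m)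
    argmax f P {a} Pa []       = a , Pa , λ ()
    argmax f P {a} Pa (x ∷ xs) with argmax f P Pa xs
    ... | m , Pm , m-max with lem (P x × f m ≤ f x)
    ... | yes (Px , m≤x) = x , Px , λ
      { (here refl) _ → ≤-refl
      ; (there y∈) Py → ≤-trans (m-max y∈ Py) m≤x }
    ... | no ¬x = m , Pm , λ
      { (here refl) Px → <⇒≤ (≰⇒> (λ m≤x → ¬x (Px , m≤x)))
      ; (there y∈) Py → m-max y∈ Py }

    -- The cyclic successor, by which the closing edge of a cycle is treated like all others.
    next : ∀ {m} → Fin (suc m) → Fin (suc m)
    next i with view i
    ... | ‵fromℕ     = zero
    ... | ‵inject₁ j = suc j

    next-fromℕ : ∀ m → next (fromℕ m) ≡ zero
    next-fromℕ m rewrite view-fromℕ m = refl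

    next-inject₁ : ∀ {m} (j : Fin m) → next (inject₁ j) ≡ suc j
    next-inject₁ j rewrite view-inject₁ j = refl

    -- Here the length is at least 3: on a cycle of length 2, both steps would use the same edge and
    -- thus the same bit.
    next-next≢ : ∀ {k} (i : Fin (3 + k)) → next (next i) ≢ i
    next-next≢ {k} i = cases (view i)
      where
      cases : ∀ {i} → View i → next (next i) ≢ i
      cases ‵fromℕ eq with () ← trans (sym (cong next (next-fromℕ (2 + k)))) eq
      cases (‵inject₁ j) eq = cases′ (view j) (trans (sym (cong next (next-inject₁ j))) eq)
        where
        cases′ : ∀ {j} → View j → next (suc j) ≢ inject₁ j
        cases′ ‵fromℕ e with () ← trans (sym (next-fromℕ (2 + k))) e
        cases′ (‵inject₁ j) e = m+1+n≢n 1 (begin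
          2 + toℕ j                        ≡⟨ cong toℕ (next-inject₁ (suc j)) ⟨
          toℕ (next (inject₁ (suc j)))     ≡⟨ cong toℕ e ⟩
          toℕ (inject₁ (inject₁ j))        ≡⟨ trans (toℕ-inject₁ (inject₁ j)) (toℕ-inject₁ j) ⟩
          toℕ j                            ∎)
          where open ≡-Reasoning

    k<r∸3⇒3+k<r : ∀ {k r} → k < r ∸ 3 → 3 + k < r
    k<r∸3⇒3+k<r {r = suc (suc (suc r))} k<r = s<s (s<s (s<s k<r))

    induced-independent : ∀ {n} (G : Graph n) (U : Subset n) {S : Subset n} →
                          IsIndependent (induced G U) S → IsIndependent G S
    induced-independent G U {S} (S⊆ , nonadj) =
      (λ v∈ → proj₁ (x∈p∩q⁻ (Graph.V G) U (S⊆ v∈))) ,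
      λ {u} {v} u∈ v∈ e → nonadj u∈ v∈
        (from (T-∧ {Graph.adj G u v}) (e , from (T-∧ {lookup U u}) (chosen u∈ , chosen v∈)))
      where
      open Equivalence
      chosen : ∀ {v} → v ∈ S → T (lookup U v)
      chosen v∈ = from T-≡ ([]=⇒lookup (proj₂ (x∈p∩q⁻ (Graph.V G) U (S⊆ v∈))))

    module SparseSubgraph
      {n : ℕ} (G : Graph n) (w : Fin n → ℕ) (w-support : ∀ v → ¬ v ∈ Graph.V G → w v ≡ 0)
      (r : ℕ) .⦃ _ : NonZero r ⦄ (𝒦 : List (Subset n)) (cover : IsCycleCliqueCover r G 𝒦)
      (B N : ℕ) (overlap≤B : ∀ v → ∑ 𝒦 (λ K → 𝟙 (v ∈ K)) ≤ B) (small : All (λ K → ∣ K ∣ ≤ N) 𝒦)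
      -- A vertex has at most `B` cliques and N^(2+k) choices of companions in each, and a cycle
      -- survives with probability at most q^-(3+k). The inequality bounds the expected number of
      -- survivors by 1/(4r) for each length.
      (q′ : ℕ) (sparse : ∀ k → 3 + k < r → 4 * r * B * N ^ (2 + k) ≤ suc q′ ^ (3 + k))
      (L κ A : ℕ) .⦃ _ : NonZero L ⦄ .⦃ _ : NonZero κ ⦄ (4L≤2^κ : 4 * L ≤ 2 ^ κ)
      (64Aqκ≤L : 64 * A * (suc q′ * κ) ≤ L)
      where

      open Weighted G w
      open Graph G

      module _ (light : ∀ I → IsIndependent G I → L * wt (_∈ I) < W) where

        -- A two-digit number in base `n`: decreasing weight first, then the index to break ties,
        -- since `Concentration` requires injective keys.
        key : Fin n → ℕ
        key v = (W ∸ w v) * n + toℕ v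

        key-mono : ∀ {u v} → W ∸ w u < W ∸ w v → key u < key v
        key-mono {u} {v} lt = begin-strict
          (W ∸ w u) * n + toℕ u     <⟨ +-monoʳ-< ((W ∸ w u) * n) (toℕ<n u) ⟩
          (W ∸ w u) * n + n         ≡⟨ +-comm _ n ⟩
          suc (W ∸ w u) * n         ≤⟨ *-monoˡ-≤ n lt ⟩
          (W ∸ w v) * n             ≤⟨ m≤m+n _ _ ⟩
          key v                     ∎
          where open ≤-Reasoning

        key-injective : ∀ {u v} → key u ≡ key v → u ≡ v
        key-injective {u} {v} eq with <-cmp (W ∸ w u) (W ∸ w v)
        ... | tri< lt _ _ = contradiction eq (<⇒≢ (key-mono lt))
        ... | tri> _ _ gt = contradiction (sym eq) (<⇒≢ (key-mono gt))
        ... | tri≈ _ e _  = toℕ-injective (+-cancelˡ-≡ ((W ∸ w u) * n) _ _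
                              (trans eq (cong (λ x → x * n + toℕ v) (sym e))))

        key-antitone : ∀ {u v} → key u < key v → w v ≤ w u
        key-antitone {u} {v} u<v with w v ≤? w u
        ... | yes p = p
        ... | no ¬p = contradiction (key-mono (∸-monoʳ-< (≰⇒> ¬p) (w≤W v))) (<-asym u<v)

        open Concentration key key-injective key-antitone q′ L κ L 4L≤2^κ ≤-refl (λ I ind → <⇒≤ (light I ind))

        -- The position of the bit that governs the edge; different edges have different positions
        -- and therefore independent bits.
        arc : Fin n → Fin n → Fin n × Fin n
        arc u v with key u <? key v
        ... | yes _ = u , v
        ... | no _  = v , u

        arc-≡ : ∀ {u v u′ v′} → arc u v ≡ arc u′ v′ → (u ≡ u′ × v ≡ v′) ⊎ (u ≡ v′ × v ≡ u′)
        arc-≡ {u} {v} {u′} {v′} eq with key u <? key v | key u′ <? key v′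
        ... | yes _ | yes _ = inj₁ (cong proj₁ eq , cong proj₂ eq)
        ... | yes _ | no _  = inj₂ (cong proj₁ eq , cong proj₂ eq)
        ... | no _  | yes _ = inj₂ (cong proj₂ eq , cong proj₁ eq)
        ... | no _  | no _  = inj₁ (cong proj₂ eq , cong proj₁ eq)

        arc-bit : ∀ {ω u v a b} → Graph.Adj (H ω) u v → (a , b) ≡ arc u v → bit ω a b ≡ true
        arc-bit {ω} {u} {v} e eq with key u <? key v
        arc-bit {ω} {u} {v} e refl | yes u<v = H⇒bit ω u<v e
        arc-bit {ω} {u} {v} e refl | no ¬u<v = H⇒bit ω
          (≤∧≢⇒< (≮⇒≥ ¬u<v) (λ eq → adj-irrefl (subst (Adj u) (key-injective eq) (H⇒G ω e))))
          (Graph.adj-sym (H ω) e)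

        Loop : ∀ {k} → Bits → Vec (Fin n) (3 + k) → Set
        Loop ω x = Injective _≡_ _≡_ (lookup x) × (∀ i → Graph.Adj (H ω) (lookup x i) (lookup x (next i)))

        -- The edges of a cycle occupy `3 + k` distinct positions, so `containment` applies with
        -- this exponent; a sequence with a repetition is never a loop.
        loop-rare : ∀ {k} (x : Vec (Fin n) (3 + k)) → q ^ (3 + k) * ∑ Ω (λ ω → 𝟙 (Loop ω x)) ≤ M
        loop-rare {k} x with lem (Injective _≡_ _≡_ (lookup x))
        ... | no ¬inj = ≤-trans (≤-reflexive (trans (cong (q ^ (3 + k) *_)
                (trans (∑-cong Ω (λ ω → 𝟙-no (¬inj ∘ proj₁))) (∑-zero Ω))) (*-zeroʳ (q ^ (3 + k))))) z≤n
        ... | yes inj = ≤-trans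
          (*-monoʳ-≤ (q ^ (3 + k)) (∑-mono Ω (λ ω → 𝟙-mono (λ (_ , adjacent) u v uv∈ →
            let i , eq = ∈-tabulate⁻ {f = arcAt} uv∈ in arc-bit {ω} (adjacent i) eq))))
          (containment (λ u v → (u , v) List.∈ arcs) (3 + k)
            (≤-trans (≤-reflexive (sym (length-tabulate arcAt))) (∑∑-Unique arcs (tabulate⁺ distinct))))
          where
          arcAt : Fin (3 + k) → Fin n × Fin n
          arcAt i = arc (lookup x i) (lookup x (next i))
          arcs : List (Fin n × Fin n)
          arcs = List.tabulate arcAt
          distinct : ∀ {i j} → arcAt i ≡ arcAt j → i ≡ j
          distinct {i} {j} eq with arc-≡ {lookup x i} {lookup x (next i)} eq
          ... | inj₁ (e , _)  = inj e
          -- The same edge traversed in opposite directions would make `i` its own second successor.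
          ... | inj₂ (e , e′) = contradiction (trans (cong next (inj e′)) (sym (inj e))) (next-next≢ i)

        Local : ∀ {k} → Bits → Fin n → Subset n → Vec (Fin n) (2 + k) → Set
        Local ω v K x = v ∈ K × (∀ i → lookup x i ∈ K) × Loop ω (v ∷ x)

        -- Walks are confined to members of `𝒦` so that `B` and `N` bound their number; by the
        -- cover, every short cycle of `G` is of this kind.
        Bad : Bits → Fin n → Set
        Bad ω v = ∃[ k ] (3 + k < r × ∃[ K ] (K List.∈ 𝒦 × ∃[ x ] Local {k} ω v K x))

        private
          walks : ∀ k → List (Vec (Fin n) (2 + k))
          walks k = vecs (allFin n) (2 + k)

          count : ℕ → Fin n → ℕ
          count k v = ∑ Ω (λ ω → ∑ 𝒦 (λ K → ∑ (walks k) (λ x → 𝟙 (Local ω v K x))))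

        local-rare : ∀ {k} v K (x : Vec (Fin n) (2 + k)) →
          q ^ (3 + k) * ∑ Ω (λ ω → 𝟙 (Local ω v K x)) ≤ 𝟙 (v ∈ K) * ∏ (2 + k) (λ i → 𝟙 (lookup x i ∈ K)) * M
        local-rare {k} v K x = begin
          q ^ (3 + k) * ∑ Ω (λ ω → 𝟙 (Local ω v K x))
            ≤⟨ *-monoʳ-≤ (q ^ (3 + k)) (∑-mono Ω (λ ω → ≤-trans (≤-reflexive 𝟙-×)
                 (*-monoʳ-≤ (𝟙 (v ∈ K)) (≤-trans (≤-reflexive 𝟙-×)
                   (*-monoˡ-≤ _ (𝟙-∏ (2 + k) (λ x∈ i → ≤-reflexive (sym (𝟙-yes (x∈ i)))))))))) ⟩
          q ^ (3 + k) * ∑ Ω (λ ω → 𝟙 (v ∈ K) * (P * 𝟙 (Loop ω (v ∷ x))))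
            ≡⟨ cong (q ^ (3 + k) *_) (trans (∑-* Ω (𝟙 (v ∈ K)) _) (cong (𝟙 (v ∈ K) *_) (∑-* Ω P _))) ⟩
          q ^ (3 + k) * (𝟙 (v ∈ K) * (P * ∑ Ω (λ ω → 𝟙 (Loop ω (v ∷ x)))))
            ≡⟨ eq (q ^ (3 + k)) (𝟙 (v ∈ K)) P _ ⟩
          𝟙 (v ∈ K) * P * (q ^ (3 + k) * ∑ Ω (λ ω → 𝟙 (Loop ω (v ∷ x))))
            ≤⟨ *-monoʳ-≤ (𝟙 (v ∈ K) * P) (loop-rare (v ∷ x)) ⟩
          𝟙 (v ∈ K) * P * M ∎
          where
          open ≤-Reasoning
          P : ℕ
          P = ∏ (2 + k) (λ i → 𝟙 (lookup x i ∈ K))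
          eq : ∀ a b c d → a * (b * (c * d)) ≡ b * c * (a * d)
          eq = solve-∀

        count-bound : ∀ k v → q ^ (3 + k) * count k v ≤ B * N ^ (2 + k) * M
        count-bound k v = begin
          q ^ (3 + k) * count k v
            ≡⟨ cong (q ^ (3 + k) *_) (trans (∑-swap Ω 𝒦 _) (∑-cong 𝒦 (λ K → ∑-swap Ω (walks k) _))) ⟩
          q ^ (3 + k) * ∑ 𝒦 (λ K → ∑ (walks k) (λ x → ∑ Ω (λ ω → 𝟙 (Local ω v K x))))
            ≡⟨ trans (∑-cong 𝒦 (λ K → ∑-* (walks k) (q ^ (3 + k)) _)) (∑-* 𝒦 (q ^ (3 + k)) _) ⟨
          ∑ 𝒦 (λ K → ∑ (walks k) (λ x → q ^ (3 + k) * ∑ Ω (λ ω → 𝟙 (Local ω v K x))))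
            ≤⟨ ∑-mono 𝒦 (λ K → ∑-mono (walks k) (local-rare v K)) ⟩
          ∑ 𝒦 (λ K → ∑ (walks k) (λ x → 𝟙 (v ∈ K) * ∏ (2 + k) (λ i → 𝟙 (lookup x i ∈ K)) * M))
            ≡⟨ trans (∑-cong 𝒦 (λ K → trans (∑-*ʳ (walks k) M _) (cong (_* M) (∑-* (walks k) (𝟙 (v ∈ K)) _)))) (∑-*ʳ 𝒦 M _) ⟩
          ∑ 𝒦 (λ K → 𝟙 (v ∈ K) * ∑ (walks k) (λ x → ∏ (2 + k) (λ i → 𝟙 (lookup x i ∈ K)))) * M
            ≤⟨ *-monoˡ-≤ M (∑-mono-All (All.map (λ {K} ∣K∣≤N → *-monoʳ-≤ (𝟙 (v ∈ K)) (inside K ∣K∣≤N)) small)) ⟩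
          ∑ 𝒦 (λ K → 𝟙 (v ∈ K) * N ^ (2 + k)) * M
            ≡⟨ cong (_* M) (∑-*ʳ 𝒦 (N ^ (2 + k)) _) ⟩
          ∑ 𝒦 (λ K → 𝟙 (v ∈ K)) * N ^ (2 + k) * M
            ≤⟨ *-monoˡ-≤ M (*-monoˡ-≤ (N ^ (2 + k)) (overlap≤B v)) ⟩
          B * N ^ (2 + k) * M ∎
          where
          open ≤-Reasoning
          inside : ∀ K → ∣ K ∣ ≤ N → ∑ (walks k) (λ x → ∏ (2 + k) (λ i → 𝟙 (lookup x i ∈ K))) ≤ N ^ (2 + k)
          inside K ∣K∣≤N = begin
            ∑ (walks k) (λ x → ∏ (2 + k) (λ i → 𝟙 (lookup x i ∈ K)))
              ≡⟨ ∑-vecs-∏ (allFin n) (2 + k) (λ _ u → 𝟙 (u ∈ K)) ⟩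
            ∏ (2 + k) (λ _ → # (_∈ K))
              ≤⟨ ∏-mono (2 + k) (λ _ → ≤-trans (≤-reflexive (#-∣∣ K)) ∣K∣≤N) ⟩
            ∏ (2 + k) (λ _ → N)
              ≡⟨ ∏-const (2 + k) ⟩
            N ^ (2 + k) ∎
            where
            ∏-const : ∀ m → ∏ m (λ _ → N) ≡ N ^ m
            ∏-const zero    = refl
            ∏-const (suc m) = cong (N *_) (∏-const m)

        4r*count≤M : ∀ k v → 3 + k < r → 4 * r * count k v ≤ M
        4r*count≤M k v 3+k<r = *-cancelˡ-≤ (q ^ (3 + k)) ⦃ m^n≢0 q (3 + k) ⦄ (begin
          q ^ (3 + k) * (4 * r * count k v)        ≡⟨ eq₁ (q ^ (3 + k)) (4 * r) (count k v) ⟩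
          4 * r * (q ^ (3 + k) * count k v)        ≤⟨ *-monoʳ-≤ (4 * r) (count-bound k v) ⟩
          4 * r * (B * N ^ (2 + k) * M)            ≡⟨ eq₂ (4 * r) B (N ^ (2 + k)) M ⟩
          4 * r * B * N ^ (2 + k) * M              ≤⟨ *-monoˡ-≤ M (sparse k 3+k<r) ⟩
          q ^ (3 + k) * M                          ∎)
          where
          open ≤-Reasoning
          eq₁ : ∀ a b c → a * (b * c) ≡ b * (a * c)
          eq₁ = solve-∀
          eq₂ : ∀ a b c d → a * (b * c * d) ≡ a * b * c * d
          eq₂ = solve-∀

        -- A union bound over the `r ∸ 3` lengths, each contributing at most `M / (4 * r)`.
        bad-rare : ∀ v → 4 * ∑ Ω (λ ω → 𝟙 (Bad ω v)) ≤ M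
        bad-rare v = *-cancelˡ-≤ r (begin
          r * (4 * ∑ Ω (λ ω → 𝟙 (Bad ω v)))
            ≡⟨ eq r (∑ Ω (λ ω → 𝟙 (Bad ω v))) ⟩
          4 * r * ∑ Ω (λ ω → 𝟙 (Bad ω v))
            ≤⟨ *-monoʳ-≤ (4 * r) (∑-mono Ω union) ⟩
          4 * r * ∑ Ω (λ ω → ∑ (upTo (r ∸ 3)) (λ k → ∑ 𝒦 (λ K → ∑ (walks k) (λ x → 𝟙 (Local ω v K x)))))
            ≡⟨ cong (4 * r *_) (∑-swap Ω (upTo (r ∸ 3)) _) ⟩
          4 * r * ∑ (upTo (r ∸ 3)) (λ k → count k v)
            ≡⟨ ∑-* (upTo (r ∸ 3)) (4 * r) _ ⟨
          ∑ (upTo (r ∸ 3)) (λ k → 4 * r * count k v)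
            ≤⟨ ∑-mono-All (All.tabulate (λ {k} k∈ → 4r*count≤M k v (k<r∸3⇒3+k<r (∈-upTo⁻ k∈)))) ⟩
          ∑ (upTo (r ∸ 3)) (λ _ → M)
            ≡⟨ trans (∑-const (upTo (r ∸ 3)) M) (cong (_* M) (length-upTo (r ∸ 3))) ⟩
          (r ∸ 3) * M
            ≤⟨ *-monoˡ-≤ M (m∸n≤m r 3) ⟩
          r * M ∎)
          where
          open ≤-Reasoning
          eq : ∀ r x → r * (4 * x) ≡ 4 * r * x
          eq = solve-∀
          union : ∀ ω → 𝟙 (Bad ω v) ≤
                  ∑ (upTo (r ∸ 3)) (λ k → ∑ 𝒦 (λ K → ∑ (walks k) (λ x → 𝟙 (Local ω v K x))))
          union ω = 𝟙-≤ λ (k , 3+k<r , K , K∈ , x , local) →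
            ≤-trans (≤-reflexive (sym (𝟙-yes local)))
            (≤-trans (∑-∈ (λ x → 𝟙 (Local ω v K x)) (∈-vecs (allFin n) ∈-allFin x))
            (≤-trans (∑-∈ (λ K → ∑ (walks k) (λ x → 𝟙 (Local ω v K x))) K∈)
                     (∑-∈ (λ k → ∑ 𝒦 (λ K → ∑ (walks k) (λ x → 𝟙 (Local ω v K x))))
                       (∈-upTo⁺ (m+n≤o⇒m≤o∸n (suc k) (subst (_≤ r) (cong suc (+-comm 3 k)) 3+k<r))))))

        bad-weight : 4 * ∑ Ω (λ ω → wt (Bad ω)) ≤ M * W
        bad-weight = begin
          4 * ∑ Ω (λ ω → wt (Bad ω))
            ≡⟨ cong (4 *_) (trans (∑-swap Ω (allFin n) _) (∑-cong (allFin n) (λ v → ∑-* Ω (w v) _))) ⟩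
          4 * ∑ (allFin n) (λ v → w v * ∑ Ω (λ ω → 𝟙 (Bad ω v)))
            ≡⟨ ∑-* (allFin n) 4 _ ⟨
          ∑ (allFin n) (λ v → 4 * (w v * ∑ Ω (λ ω → 𝟙 (Bad ω v))))
            ≤⟨ ∑-mono (allFin n) (λ v → ≤-trans (≤-reflexive (eq (w v) (∑ Ω (λ ω → 𝟙 (Bad ω v)))))
                 (*-monoʳ-≤ (w v) (bad-rare v))) ⟩
          ∑ (allFin n) (λ v → w v * M)
            ≡⟨ trans (∑-*ʳ (allFin n) M w) (*-comm W M) ⟩
          M * W ∎
          where
          open ≤-Reasoning
          eq : ∀ x y → 4 * (x * y) ≡ x * (4 * y)
          eq = solve-∀

        -- `mean-weight` speaks of one edgeless set per outcome; taking a set of maximal weight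
        -- makes it a bound for all of them.
        heaviest : ∀ ω → ∃[ S ] (IsIndependent (H ω) S ×
                   ∀ {S′} → S′ List.∈ allSubsets n → IsIndependent (H ω) S′ → wt (_∈ S′) ≤ wt (_∈ S))
        heaviest ω = argmax (λ S → wt (_∈ S)) (IsIndependent (H ω)) {⟪ (λ _ → ⊥) ⟫}
          ((λ v∈ → ⊥-elim (∈⟪⟫⁻ v∈)) , λ v∈ _ → ⊥-elim (∈⟪⟫⁻ v∈)) (allSubsets n)

        S : Bits → Subset n
        S ω = proj₁ (heaviest ω)

        s : Bits → ℕ
        s ω = wt (_∈ S ω)

        -- `mean-weight` bounds the mean of `s` by 32 q κ W / (3L). For positive `A`, the assumption
        -- `64Aqκ≤L` turns this into W / (6A).
        independent-weight : 4 * A * ∑ Ω s ≤ M * W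
        independent-weight = *-cancelˡ-≤ (3 * L) ⦃ m*n≢0 3 L ⦄ (begin
          3 * L * (4 * A * ∑ Ω s)            ≡⟨ eq₁ L A (∑ Ω s) ⟩
          4 * A * (3 * (L * ∑ Ω s))          ≤⟨ *-monoʳ-≤ (4 * A) (mean-weight S (λ ω → proj₁ (proj₁ (proj₂ (heaviest ω))))
                                                  (λ ω → proj₂ (proj₁ (proj₂ (heaviest ω))))) ⟩
          4 * A * (32 * (q * κ) * (M * W))   ≡⟨ eq₂ A (q * κ) (M * W) ⟩
          2 * (64 * A * (q * κ)) * (M * W)   ≤⟨ *-monoˡ-≤ (M * W) (*-mono-≤ {2} {3} (s≤s (s≤s z≤n)) 64Aqκ≤L) ⟩
          3 * L * (M * W)                    ∎)
          where
          open ≤-Reasoning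
          eq₁ : ∀ L A x → 3 * L * (4 * A * x) ≡ 4 * A * (3 * (L * x))
          eq₁ = solve-∀
          eq₂ : ∀ A x y → 4 * A * (32 * x * y) ≡ 2 * (64 * A * x) * y
          eq₂ = solve-∀

        0<M : 0 < M
        0<M = nonempty Ω (subst (0 <_) (sym (∑-Ω-∏∏ (λ _ _ _ → 1)))
          (∏-pos n (λ _ → ∏-pos n (λ _ → s≤s z≤n))))
          where
          nonempty : ∀ {A : Set} (xs : List A) {f} → 0 < ∑ xs f → 0 < length xs
          nonempty (x ∷ xs) _ = s≤s z≤n

        good-bits : ∃[ ω ] 4 * A * s ω + 4 * wt (Bad ω) ≤ 2 * W
        good-bits = ∑-average Ω _ (2 * W) 0<M (begin
          ∑ Ω (λ ω → 4 * A * s ω + 4 * wt (Bad ω))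
            ≡⟨ trans (∑-+ Ω _ _) (cong₂ _+_ (∑-* Ω (4 * A) s) (∑-* Ω 4 _)) ⟩
          4 * A * ∑ Ω s + 4 * ∑ Ω (λ ω → wt (Bad ω))
            ≤⟨ +-mono-≤ independent-weight bad-weight ⟩
          M * W + M * W
            ≡⟨ eq M W ⟩
          M * (2 * W) ∎)
          where
          open ≤-Reasoning
          eq : ∀ M W → M * W + M * W ≡ M * (2 * W)
          eq = solve-∀

        -- The strict inequality in `light`, applied to the empty set.
        0<W : 0 < W
        0<W = ≤-trans (s≤s z≤n) (light ⟪ (λ _ → ⊥) ⟫
          ((λ v∈ → ⊥-elim (∈⟪⟫⁻ v∈)) , λ v∈ _ → ⊥-elim (∈⟪⟫⁻ v∈)))

        module FromBits (ω : Bits) (bound : 4 * A * s ω + 4 * wt (Bad ω) ≤ 2 * W) where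
          open Equivalence
          Good : Fin n → Set
          Good v = ¬ Bad ω v

          F : Graph n
          F = induced (H ω) ⟪ Good ⟫

          F⊆H : ∀ {u v} → Graph.Adj F u v → Graph.Adj (H ω) u v
          F⊆H e = proj₁ (to T-∧ e)

          F⊆G : F ⊆ᴳ G
          F⊆G = (λ v∈ → proj₁ (x∈p∩q⁻ V ⟪ Good ⟫ v∈)) , λ e → H⇒G ω (F⊆H e)

          -- A short cycle lies in a clique of the cover; read from `vertex zero`, it shows that
          -- this vertex is bad although it survived the deletion.
          girth : Girth≥ r F
          girth k C with r ≤? 3 + k
          ... | yes r≤ = r≤
          ... | no r≰ = contradiction bad
                  (∈⟪⟫⁻ (proj₂ (x∈p∩q⁻ V ⟪ Good ⟫ (Graph.adj⇒∈ F (step zero)))))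
            where
            open Cycle C
            K∋C : ∃[ K ] (K List.∈ 𝒦 × (∀ i → vertex i ∈ K))
            K∋C = find (proj₂ cover k (record
              { vertex    = vertex
              ; injective = injective
              ; step      = λ i → proj₂ F⊆G (step i)
              ; close     = proj₂ F⊆G close
              }) (≰⇒> r≰))
            rest : Vec (Fin n) (2 + k)
            rest = Vec.tabulate (vertex ∘ suc)
            lookup-rest : ∀ i → lookup (vertex zero ∷ rest) i ≡ vertex i
            lookup-rest zero    = refl
            lookup-rest (suc i) = lookup∘tabulate (vertex ∘ suc) i
            adjacent : ∀ i → Graph.Adj F (vertex i) (vertex (next i))
            adjacent i with view i
            ... | ‵fromℕ     = close
            ... | ‵inject₁ j = step j
            bad : Bad ω (vertex zero)
            bad = k , ≰⇒> r≰ , proj₁ K∋C , proj₁ (proj₂ K∋C) , rest ,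
              proj₂ (proj₂ K∋C) zero ,
              (λ i → subst (_∈ proj₁ K∋C) (sym (lookup-rest (suc i))) (proj₂ (proj₂ K∋C) (suc i))) ,
              (λ {i} {j} e → injective (trans (sym (lookup-rest i)) (trans e (lookup-rest j)))) ,
              λ i → subst₂ (Graph.Adj (H ω)) (sym (lookup-rest i)) (sym (lookup-rest (next i)))
                      (F⊆H (adjacent i))

          -- `Good` is not confined to `V`, but by `w-support` there is no weight outside `V`.
          good≤F : wt Good ≤ wt (_∈ Graph.V F)
          good≤F = ∑-mono (allFin n) (λ v → pointwise v (v ∈? V))
            where
            pointwise : ∀ v → Dec (v ∈ V) → w v * 𝟙 (Good v) ≤ w v * 𝟙 (v ∈ Graph.V F)
            pointwise v (yes v∈V) = *-monoʳ-≤ (w v) (𝟙-mono (λ good → x∈p∩q⁺ (v∈V , ∈⟪⟫⁺ good)))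
            pointwise v (no v∉V) = ≤-trans (≤-reflexive (cong (_* 𝟙 (Good v)) (w-support v v∉V))) z≤n

          W≡ : W ≡ wt (Bad ω) + wt Good
          W≡ = begin
            W ≡⟨ wt-all {λ _ → 0 ≤ 0} (λ _ → z≤n) ⟨
            wt (λ _ → 0 ≤ 0) ≡⟨ wt-split {λ _ → 0 ≤ 0} {Bad ω} ⟩
            wt (λ v → 0 ≤ 0 × Bad ω v) + wt (λ v → 0 ≤ 0 × Good v)
              ≡⟨ cong₂ _+_ (wt-cong (λ _ → proj₂) (λ _ → z≤n ,_)) (wt-cong (λ _ → proj₂) (λ _ → z≤n ,_)) ⟩
            wt (Bad ω) + wt Good ∎
            where open ≡-Reasoning

          -- Write b and g for the bad and the good weight. As W = b + g, half of `bound` reads 2As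
          -- + 2b ≤ b + g.
          2As+b≤g : 2 * (A * s ω) + wt (Bad ω) ≤ wt Good
          2As+b≤g = +-cancelʳ-≤ (wt (Bad ω)) _ _ (*-cancelˡ-≤ 2 (begin
            2 * (2 * (A * s ω) + wt (Bad ω) + wt (Bad ω)) ≡⟨ eq A (s ω) (wt (Bad ω)) ⟩
            4 * A * s ω + 4 * wt (Bad ω)                  ≤⟨ bound ⟩
            2 * W                                         ≡⟨ cong (2 *_) (trans W≡ (+-comm (wt (Bad ω)) _)) ⟩
            2 * (wt Good + wt (Bad ω))                    ∎))
            where
            open ≤-Reasoning
            eq : ∀ A s b → 2 * (2 * (A * s) + b + b) ≡ 4 * A * s + 4 * b
            eq = solve-∀

          -- If the good weight vanished, so would the bad weight by `2As+b≤g`, and then `W`.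
          0<good : 0 < wt Good
          0<good = n≢0⇒n>0 (λ g≡0 → <-irrefl (sym (trans W≡ (cong₂ _+_ (b≡0 g≡0) g≡0))) 0<W)
            where
            b≡0 : wt Good ≡ 0 → wt (Bad ω) ≡ 0
            b≡0 g≡0 = n≤0⇒n≡0 (≤-trans (m≤n+m _ (2 * (A * s ω))) (≤-trans 2As+b≤g (≤-reflexive g≡0)))

          0<wt : 0 < wt (_∈ Graph.V F)
          0<wt = ≤-trans 0<good good≤F

          light-in-F : ∀ S′ → IsIndependent F S′ → A * wt (_∈ S′) ≤ wt (_∈ Graph.V F)
          light-in-F S′ (S′⊆F , nonadj) = begin
            A * wt (_∈ S′)                    ≤⟨ *-monoʳ-≤ A (proj₂ (proj₂ (heaviest ω)) (∈-allSubsets S′) S′-indep) ⟩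
            A * s ω                           ≤⟨ m≤n*m (A * s ω) 2 ⟩
            2 * (A * s ω)                     ≤⟨ m≤m+n _ (wt (Bad ω)) ⟩
            2 * (A * s ω) + wt (Bad ω)        ≤⟨ 2As+b≤g ⟩
            wt Good                           ≤⟨ good≤F ⟩
            wt (_∈ Graph.V F)                 ∎
            where
            open ≤-Reasoning
            S′-indep : IsIndependent (H ω) S′
            S′-indep = induced-independent (H ω) ⟪ Good ⟫ (S′⊆F , nonadj)

        sparse-subgraph : ∃[ F ] (F ⊆ᴳ G × Girth≥ r F × 0 < wt (_∈ Graph.V F) ×
                          ∀ S → IsIndependent F S → A * wt (_∈ S) ≤ wt (_∈ Graph.V F))
        sparse-subgraph = F , F⊆G , girth , 0<wt , light-in-F
          where open FromBits (proj₁ good-bits) (proj₂ good-bits)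

    -- An index outside the vertex set lies in no clique, so the maximum over vertices bounds the
    -- overlap at every index.
    local-overlap : ∀ {n} (G : Graph n) 𝒦 → All (IsClique G) 𝒦 →
                    ∀ v → ∑ 𝒦 (λ K → 𝟙 (v ∈ K)) ≤ localOverlap G 𝒦
    local-overlap {n} G 𝒦 cliques v with v ∈? Graph.V G
    ... | yes v∈V = ≤-trans (≤-reflexive (count 𝒦)) (All.lookup (xs≤max 0 _) (∈-map⁺ _ (∈-filter⁺ (_∈? Graph.V G) (∈-allFin v) v∈V)))
      where
      count : ∀ 𝒦 → ∑ 𝒦 (λ K → 𝟙 (v ∈ K)) ≡ length (filter (v ∈?_) 𝒦)
      count []      = refl
      count (K ∷ 𝒦) with v ∈? K
      ... | yes v∈ = cong₂ _+_ (𝟙-yes v∈) (count 𝒦)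
      ... | no v∉  = cong₂ _+_ (𝟙-no v∉) (count 𝒦)
    ... | no v∉V = ≤-trans (∑-mono-All {g = λ _ → 0} (All.map (λ clique → ≤-reflexive (𝟙-no (λ v∈K → v∉V (proj₁ clique v∈K)))) cliques))
                     (≤-trans (≤-reflexive (∑-zero 𝒦)) z≤n)

    -- Duality by multiplicative weights.

    2^-cancel-≤ : ∀ {a b} → 2 ^ a ≤ 2 ^ b → a ≤ b
    2^-cancel-≤ {a} {b} le with a ≤? b
    ... | yes a≤b = a≤b
    ... | no a≰b = contradiction le (<⇒≱ (^-monoʳ-< 2 (s≤s (s≤s z≤n)) (≰⇒> a≰b)))

    multiplicity : ∀ {n} → List (Subset n) → Fin n → ℕ
    multiplicity ℐ v = ∑ ℐ (λ I → 𝟙 (v ∈ I))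

    -- A multiplicative-weights argument: the vertices of a chosen independent set
    -- keep their weight while all other weights double.
    module Duality {n : ℕ} (G : Graph n) (l : ℕ) where

      open Graph G

      -- The quotient `y / L` is 2 - 1/L, the largest growth of the total weight in one round.
      L y : ℕ
      L = suc l
      y = suc (l + l)

      Light : (Fin n → ℕ) → Set
      Light w = ∀ I → IsIndependent G I → L * Weighted.wt G w (_∈ I) < Weighted.W G w

      Supported : (Fin n → ℕ) → Set
      Supported w = ∀ v → ¬ v ∈ V → w v ≡ 0

      weight : List (Subset n) → Fin n → ℕ
      weight []      v = 𝟙 (v ∈ V)
      weight (I ∷ ℐ) v = weight ℐ v * (2 ∸ 𝟙 (v ∈ I))

      weight-support : ∀ ℐ → Supported (weight ℐ)
      weight-support []      v v∉ = 𝟙-no v∉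
      weight-support (I ∷ ℐ) v v∉ = cong (_* (2 ∸ 𝟙 (v ∈ I))) (weight-support ℐ v v∉)

      total : List (Subset n) → ℕ
      total ℐ = ∑ (allFin n) (weight ℐ)

      weight-multiplicity : ∀ ℐ {v} → v ∈ V → weight ℐ v * 2 ^ multiplicity ℐ v ≡ 2 ^ length ℐ
      weight-multiplicity []      v∈ = cong (_* 1) (𝟙-yes v∈)
      weight-multiplicity (I ∷ ℐ) {v} v∈ = begin
        weight ℐ v * (2 ∸ 𝟙 (v ∈ I)) * 2 ^ (𝟙 (v ∈ I) + multiplicity ℐ v) ≡⟨ step (lem (v ∈ I)) ⟩
        2 * (weight ℐ v * 2 ^ multiplicity ℐ v)                           ≡⟨ cong (2 *_) (weight-multiplicity ℐ v∈) ⟩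
        2 * 2 ^ length ℐ                                                  ∎
        where
        open ≡-Reasoning
        eq₁ : ∀ a b → a * 1 * (2 * b) ≡ 2 * (a * b)
        eq₁ = solve-∀
        eq₂ : ∀ a b → a * 2 * b ≡ 2 * (a * b)
        eq₂ = solve-∀
        step : Dec (v ∈ I) → weight ℐ v * (2 ∸ 𝟙 (v ∈ I)) * 2 ^ (𝟙 (v ∈ I) + multiplicity ℐ v) ≡
                             2 * (weight ℐ v * 2 ^ multiplicity ℐ v)
        step (yes v∈I) rewrite 𝟙-yes v∈I = eq₁ (weight ℐ v) (2 ^ multiplicity ℐ v)
        step (no v∉I)  rewrite 𝟙-no v∉I  = eq₂ (weight ℐ v) (2 ^ multiplicity ℐ v)

      total-∷ : ∀ I ℐ → total (I ∷ ℐ) + Weighted.wt G (weight ℐ) (_∈ I) ≡ 2 * total ℐ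
      total-∷ I ℐ = begin
        total (I ∷ ℐ) + Weighted.wt G (weight ℐ) (_∈ I)
          ≡⟨ ∑-+ (allFin n) _ _ ⟨
        ∑ (allFin n) (λ v → weight ℐ v * (2 ∸ 𝟙 (v ∈ I)) + weight ℐ v * 𝟙 (v ∈ I))
          ≡⟨ ∑-cong (allFin n) (λ v → trans (sym (*-distribˡ-+ (weight ℐ v) _ _))
               (trans (cong (weight ℐ v *_) (m∸n+n≡m {2} (≤-trans 𝟙≤1 (s≤s z≤n)))) (*-comm (weight ℐ v) 2))) ⟩
        ∑ (allFin n) (λ v → 2 * weight ℐ v)
          ≡⟨ ∑-* (allFin n) 2 (weight ℐ) ⟩
        2 * total ℐ ∎
        where open ≡-Reasoning

      Run : ℕ → Set
      Run τ = ∃[ ℐ ] (All (IsIndependent G) ℐ × length ℐ ≡ τ × L ^ τ * total ℐ ≤ y ^ τ * n)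

      -- While no weighting is light, some independent set carries at least 1/L of the current
      -- total; sparing it from the doubling keeps the growth at 2 - 1/L.
      run : ¬ (∃[ w ] (Supported w × Light w)) → ∀ τ → Run τ
      run none zero = [] , [] , refl , ≤-trans (≤-reflexive (+-identityʳ _))
        (≤-trans (∑-mono (allFin n) (λ v → 𝟙≤1))
        (≤-reflexive (trans (∑-const (allFin n) 1) (trans (*-identityʳ _) (trans (length-tabulate id) (sym (+-identityʳ n)))))))
      run none (suc τ) with run none τ
      ... | ℐ , indep , len , bound = I ∷ ℐ , I-indep ∷ indep , cong suc len , step
        where
        heavy : ∃[ I ] (IsIndependent G I × total ℐ ≤ L * Weighted.wt G (weight ℐ) (_∈ I))
        heavy = by-contradiction λ ¬heavy → none (weight ℐ , weight-support ℐ , λ I ind →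
          ≰⇒> (λ le → ¬heavy (I , ind , le)))
        I : Subset n
        I = proj₁ heavy
        I-indep : IsIndependent G I
        I-indep = proj₁ (proj₂ heavy)
        shrink : L * total (I ∷ ℐ) ≤ y * total ℐ
        shrink = +-cancelʳ-≤ (total ℐ) _ _ (begin
          L * total (I ∷ ℐ) + total ℐ
            ≤⟨ +-monoʳ-≤ (L * total (I ∷ ℐ)) (proj₂ (proj₂ heavy)) ⟩
          L * total (I ∷ ℐ) + L * Weighted.wt G (weight ℐ) (_∈ I)
            ≡⟨ *-distribˡ-+ L (total (I ∷ ℐ)) _ ⟨
          L * (total (I ∷ ℐ) + Weighted.wt G (weight ℐ) (_∈ I))
            ≡⟨ cong (L *_) (total-∷ I ℐ) ⟩
          L * (2 * total ℐ)
            ≡⟨ eq l (total ℐ) ⟩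
          y * total ℐ + total ℐ ∎)
          where
          open ≤-Reasoning
          eq : ∀ l t → suc l * (2 * t) ≡ suc (l + l) * t + t
          eq = solve-∀
        step : L ^ suc τ * total (I ∷ ℐ) ≤ y ^ suc τ * n
        step = begin
          L * L ^ τ * total (I ∷ ℐ)     ≡⟨ eq₁ L (L ^ τ) (total (I ∷ ℐ)) ⟩
          L ^ τ * (L * total (I ∷ ℐ))   ≤⟨ *-monoʳ-≤ (L ^ τ) shrink ⟩
          L ^ τ * (y * total ℐ)         ≡⟨ eq₂ (L ^ τ) y (total ℐ) ⟩
          y * (L ^ τ * total ℐ)         ≤⟨ *-monoʳ-≤ y bound ⟩
          y * (y ^ τ * n)               ≡⟨ *-assoc y (y ^ τ) n ⟨
          y * y ^ τ * n                 ∎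
          where
          open ≤-Reasoning
          eq₁ : ∀ a b c → a * b * c ≡ b * (a * c)
          eq₁ = solve-∀
          eq₂ : ∀ a b c → a * (b * c) ≡ b * (a * c)
          eq₂ = solve-∀

      -- After τ rounds the total is at most 2^(τ-2m) n, whereas a vertex in c of the sets alone
      -- weighs 2^(τ-c). Hence 2^(2m) ≤ n 2^c, and n ≤ 2^m yields c ≥ m; the colouring value is τ /
      -- m = 4L.
      dual-or-cover : (∃[ w ] (Supported w × Light w)) ⊎
        (∃[ m ] (0 < m × ∃[ ℐ ] (All (IsIndependent G) ℐ × length ℐ ≡ 4 * L * m ×
          ∀ v → v ∈ V → m ≤ multiplicity ℐ v)))
      dual-or-cover with lem (∃[ w ] (Supported w × Light w))
      ... | yes dual = inj₁ dual
      ... | no none = inj₂ (m , s≤s z≤n , proj₁ steps , proj₁ (proj₂ steps) ,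
              trans (proj₁ (proj₂ (proj₂ steps))) (lengths l m) , covered)
        where
        m τ : ℕ
        -- This choice gives `n ≤ 2 ^ m` and stays positive for `n = 0`. As `suc y = 2 * L`, every
        -- `suc y` rounds halve the total relative to a full doubling, and `τ` provides for `2 * m`
        -- halvings.
        m = suc n
        τ = suc y * (2 * m)
        lengths : ∀ l m → suc (suc (l + l)) * (2 * m) ≡ 4 * suc l * m
        lengths = solve-∀
        steps : Run τ
        steps = run none τ
        ℐ : List (Subset n)
        ℐ = proj₁ steps
        2^h*total≤ : 2 ^ (2 * m) * total ℐ ≤ 2 ^ τ * n
        2^h*total≤ = *-cancelˡ-≤ (L ^ τ) ⦃ m^n≢0 L τ ⦄ (begin
          L ^ τ * (2 ^ (2 * m) * total ℐ)   ≡⟨ eq (L ^ τ) (2 ^ (2 * m)) (total ℐ) ⟩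
          2 ^ (2 * m) * (L ^ τ * total ℐ)   ≤⟨ *-monoʳ-≤ (2 ^ (2 * m)) (proj₂ (proj₂ (proj₂ steps))) ⟩
          2 ^ (2 * m) * (y ^ τ * n)         ≡⟨ *-assoc (2 ^ (2 * m)) _ n ⟨
          2 ^ (2 * m) * y ^ τ * n           ≤⟨ *-monoˡ-≤ n (2^h*x^s≤[1+x]^s y (2 * m) τ ≤-refl) ⟩
          suc y ^ τ * n                     ≡⟨ cong (λ z → z ^ τ * n) (double l) ⟩
          (L * 2) ^ τ * n                   ≡⟨ cong (_* n) (^-distribʳ-* τ L 2) ⟩
          L ^ τ * 2 ^ τ * n                 ≡⟨ *-assoc (L ^ τ) _ n ⟩
          L ^ τ * (2 ^ τ * n)               ∎)
          where
          open ≤-Reasoning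
          eq : ∀ a b c → a * (b * c) ≡ b * (a * c)
          eq = solve-∀
          double : ∀ l → suc (suc (l + l)) ≡ suc l * 2
          double = solve-∀
        covered : ∀ v → v ∈ V → m ≤ multiplicity ℐ v
        covered v v∈ = +-cancelˡ-≤ m _ _ (2^-cancel-≤ (begin
          2 ^ (m + m)          ≡⟨ cong (λ z → 2 ^ (m + z)) (+-identityʳ m) ⟨
          2 ^ (2 * m)          ≤⟨ *-cancelˡ-≤ (2 ^ τ) ⦃ m^n≢0 2 τ ⦄ scaled ⟩
          n * 2 ^ c            ≤⟨ *-monoˡ-≤ (2 ^ c) (≤-trans (n≤1+n n) (≤-trans (n≤1+n m) (1+d≤2^d m))) ⟩
          2 ^ m * 2 ^ c        ≡⟨ ^-distribˡ-+-* 2 m c ⟨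
          2 ^ (m + c)          ∎))
          where
          open ≤-Reasoning
          c : ℕ
          c = multiplicity ℐ v
          eq₁ : ∀ a b x → a * b * x ≡ x * a * b
          eq₁ = solve-∀
          scaled : 2 ^ τ * 2 ^ (2 * m) ≤ 2 ^ τ * (n * 2 ^ c)
          scaled = begin
            2 ^ τ * 2 ^ (2 * m)                ≡⟨ cong (λ t → 2 ^ t * 2 ^ (2 * m)) (proj₁ (proj₂ (proj₂ steps))) ⟨
            2 ^ length ℐ * 2 ^ (2 * m)         ≡⟨ cong (_* 2 ^ (2 * m)) (weight-multiplicity ℐ v∈) ⟨
            weight ℐ v * 2 ^ c * 2 ^ (2 * m)   ≡⟨ eq₁ (weight ℐ v) (2 ^ c) (2 ^ (2 * m)) ⟩
            2 ^ (2 * m) * weight ℐ v * 2 ^ c   ≤⟨ *-monoˡ-≤ (2 ^ c) (*-monoʳ-≤ (2 ^ (2 * m)) (∑-∈ (weight ℐ) (∈-allFin v))) ⟩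
            2 ^ (2 * m) * total ℐ * 2 ^ c      ≤⟨ *-monoˡ-≤ (2 ^ c) 2^h*total≤ ⟩
            2 ^ τ * n * 2 ^ c                  ≡⟨ *-assoc (2 ^ τ) n _ ⟩
            2 ^ τ * (n * 2 ^ c)                ∎

module Reals (ℝ : CompleteOrderedField) where

  open CompleteOrderedField ℝ
  open RealAnalysis ℝ
  open FractionalColouring ℝ
  open Combinatorics

  open import Algebra.Bundles using (CommutativeRing)
  open import Data.Bool.Base using (true; false)
  open import Data.Fin.Base using (Fin)
  open import Data.Fin.Subset using (_∈_; ⁅_⁆)
  open import Data.Fin.Subset.Properties using (_∈?_; x∈⁅x⁆; x∈⁅y⁆⇒x≡y)
  open import Data.List.Base using ([]; _∷_; length; map; allFin; filter)
  open import Data.List.Membership.Propositional.Properties using (∈-allFin; ∈-map⁺; ∈-filter⁺; ∈-filter⁻)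
  open import Data.List.Properties using (length-tabulate; length-filter; length-map)
  open import Data.List.Relation.Unary.All as All using ()
  import Data.List.Relation.Unary.All.Properties as All
  open import Data.Nat.Base as ℕ using (zero; suc; _!)
  import Data.Nat.DivMod as ℕ
  import Data.Nat.Properties as ℕ
  open import Data.Nat.Tactic.RingSolver using (solve-∀)
  open import Data.Product.Base using (∃; _,_; proj₁; proj₂)
  open import Data.Sum.Base using (_⊎_; inj₁; inj₂)
  open import Data.Vec.Base using ([]; _∷_)
  open import Data.Vec.Properties using (∷-injectiveʳ)
  open import Function.Base using (_∘_)
  open import Relation.Binary.Bundles using (StrictPartialOrder)
  open import Relation.Binary.Definitions using (tri<; tri≈; tri>)
  import Relation.Binary.Reasoning.StrictPartialOrder as StrictPartialOrderReasoning
  open import Relation.Binary.Structures using (IsStrictTotalOrder)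
  open import Relation.Binary.PropositionalEquality as ≡ using (_≡_)
  open import Relation.Nullary using (¬_; Dec; yes; no; contradiction)

  open CommutativeRing commutativeRing
    using (refl; sym; trans; reflexive; +-cong; +-congˡ; +-congʳ; *-cong; *-congˡ; *-congʳ; -‿cong;
           +-identityˡ; +-identityʳ; *-identityˡ; *-identityʳ; +-assoc; *-assoc; +-comm; *-comm;
           distribˡ; distribʳ; zeroˡ; zeroʳ; -‿inverseˡ; -‿inverseʳ; ring; commutativeSemiring)
  open import Algebra.Properties.Ring ring using (-‿involutive; -‿distribˡ-*; -‿distribʳ-*; -0#≈0#; -‿+-comm)
  open import Algebra.Solver.Ring.NaturalCoefficients.Default commutativeSemiring
    using (solve; con; _:=_; _:+_; _:*_)
  import Algebra.Properties.Semiring.Mult semiring as Mult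
  import Algebra.Properties.Semiring.Exp semiring as Exp
  import Algebra.Properties.CommutativeSemiring.Exp commutativeSemiring as CExp

  open IsStrictTotalOrder isStrictTotalOrder
    using (compare; isStrictPartialOrder; <-respʳ-≈; <-respˡ-≈)
    renaming (trans to <-trans; irrefl to <-irrefl; asym to <-asym)

  -- Arithmetic in an ordered field.

  strictPartialOrder : StrictPartialOrder _ _ _
  strictPartialOrder = record { isStrictPartialOrder = isStrictPartialOrder }

  module Reasoning = StrictPartialOrderReasoning strictPartialOrder

  open Reasoning

  <⇒≤ : ∀ {x y} → x < y → x ≤ y
  <⇒≤ = inj₁

  ≈⇒≤ : ∀ {x y} → x ≈ y → x ≤ y
  ≈⇒≤ = inj₂

  ≤-refl : ∀ {x} → x ≤ x
  ≤-refl = inj₂ refl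

  <-≤-trans : ∀ {x y z} → x < y → y ≤ z → x < z
  <-≤-trans x<y (inj₁ y<z) = <-trans x<y y<z
  <-≤-trans x<y (inj₂ y≈z) = <-respʳ-≈ y≈z x<y

  ≤-<-trans : ∀ {x y z} → x ≤ y → y < z → x < z
  ≤-<-trans (inj₁ x<y) y<z = <-trans x<y y<z
  ≤-<-trans (inj₂ x≈y) y<z = <-respˡ-≈ (sym x≈y) y<z

  ≤-trans : ∀ {x y z} → x ≤ y → y ≤ z → x ≤ z
  ≤-trans (inj₁ x<y) y≤z        = inj₁ (<-≤-trans x<y y≤z)
  ≤-trans (inj₂ x≈y) (inj₁ y<z) = inj₁ (<-respˡ-≈ (sym x≈y) y<z)
  ≤-trans (inj₂ x≈y) (inj₂ y≈z) = inj₂ (trans x≈y y≈z)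

  ≤⇒≯ : ∀ {x y} → x ≤ y → ¬ y < x
  ≤⇒≯ x≤y y<x = <-irrefl refl (≤-<-trans x≤y y<x)

  ≤-or-> : ∀ x y → x ≤ y ⊎ y < x
  ≤-or-> x y with compare x y
  ... | tri< x<y _ _ = inj₁ (inj₁ x<y)
  ... | tri≈ _ x≈y _ = inj₁ (inj₂ x≈y)
  ... | tri> _ _ y<x = inj₂ y<x

  ≮⇒≥ : ∀ {x y} → ¬ x < y → y ≤ x
  ≮⇒≥ {x} {y} x≮y with ≤-or-> y x
  ... | inj₁ y≤x = y≤x
  ... | inj₂ x<y = contradiction x<y x≮y

  ≤-antisym : ∀ {x y} → x ≤ y → y ≤ x → x ≈ y
  ≤-antisym (inj₂ x≈y) _   = x≈y
  ≤-antisym (inj₁ x<y) y≤x = contradiction x<y (≤⇒≯ y≤x)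

  +-monoˡ-< : ∀ z {x y} → x < y → x + z < y + z
  +-monoˡ-< z {x} {y} x<y = <-respˡ-≈ (+-comm z x) (<-respʳ-≈ (+-comm z y) (+-monoʳ-< z x<y))

  +-monoʳ-≤ : ∀ z {x y} → x ≤ y → z + x ≤ z + y
  +-monoʳ-≤ z (inj₁ x<y) = inj₁ (+-monoʳ-< z x<y)
  +-monoʳ-≤ z (inj₂ x≈y) = inj₂ (+-congˡ x≈y)

  +-monoˡ-≤ : ∀ z {x y} → x ≤ y → x + z ≤ y + z
  +-monoˡ-≤ z (inj₁ x<y) = inj₁ (+-monoˡ-< z x<y)
  +-monoˡ-≤ z (inj₂ x≈y) = inj₂ (+-congʳ x≈y)

  +-mono-≤ : ∀ {x y u v} → x ≤ y → u ≤ v → x + u ≤ y + v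
  +-mono-≤ x≤y u≤v = ≤-trans (+-monoˡ-≤ _ x≤y) (+-monoʳ-≤ _ u≤v)

  x+y-y : ∀ x y → x + y + - y ≈ x
  x+y-y x y = trans (+-assoc x y (- y)) (trans (+-congˡ (-‿inverseʳ y)) (+-identityʳ x))

  x-y+y : ∀ x y → x + - y + y ≈ x
  x-y+y x y = trans (+-assoc x (- y) y) (trans (+-congˡ (-‿inverseˡ y)) (+-identityʳ x))

  +-cancelʳ-≤ : ∀ z {x y} → x + z ≤ y + z → x ≤ y
  +-cancelʳ-≤ z {x} {y} le = begin
    x             ≈⟨ x+y-y x z ⟨
    x + z + - z   ≤⟨ +-monoˡ-≤ (- z) le ⟩
    y + z + - z   ≈⟨ x+y-y y z ⟩
    y             ∎

  +-cancelʳ-< : ∀ z {x y} → x + z < y + z → x < y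
  +-cancelʳ-< z {x} {y} lt = begin-strict
    x             ≈⟨ x+y-y x z ⟨
    x + z + - z   <⟨ +-monoˡ-< (- z) lt ⟩
    y + z + - z   ≈⟨ x+y-y y z ⟩
    y             ∎

  x≤x+y : ∀ {x y} → 0# ≤ y → x ≤ x + y
  x≤x+y {x} {y} 0≤y = begin
    x        ≈⟨ +-identityʳ x ⟨
    x + 0#   ≤⟨ +-monoʳ-≤ x 0≤y ⟩
    x + y    ∎

  x≤y+x : ∀ {x y} → 0# ≤ y → x ≤ y + x
  x≤y+x 0≤y = ≤-trans (x≤x+y 0≤y) (≈⇒≤ (+-comm _ _))

  0≤+ : ∀ {x y} → 0# ≤ x → 0# ≤ y → 0# ≤ x + y
  0≤+ 0≤x 0≤y = ≤-trans 0≤x (x≤x+y 0≤y)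

  -‿anti-≤ : ∀ {x y} → x ≤ y → - y ≤ - x
  -‿anti-≤ {x} {y} x≤y = +-cancelʳ-≤ (x + y) (begin
    - y + (x + y)   ≈⟨ trans (+-congˡ (+-comm x y)) (trans (sym (+-assoc (- y) y x)) (trans (+-congʳ (-‿inverseˡ y)) (+-identityˡ x))) ⟩
    x               ≤⟨ x≤y ⟩
    y               ≈⟨ trans (sym (+-assoc (- x) x y)) (trans (+-congʳ (-‿inverseˡ x)) (+-identityˡ y)) ⟨
    - x + (x + y)   ∎)

  0≤y-x : ∀ {x y} → x ≤ y → 0# ≤ y + - x
  0≤y-x {x} {y} x≤y = begin
    0#        ≈⟨ -‿inverseʳ x ⟨
    x + - x   ≤⟨ +-monoˡ-≤ (- x) x≤y ⟩
    y + - x   ∎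

  0<y-x : ∀ {x y} → x < y → 0# < y + - x
  0<y-x {x} {y} x<y = begin-strict
    0#        ≈⟨ -‿inverseʳ x ⟨
    x + - x   <⟨ +-monoˡ-< (- x) x<y ⟩
    y + - x   ∎

  *-monoʳ-< : ∀ {z x y} → 0# < z → x < y → z * x < z * y
  *-monoʳ-< {z} {x} {y} 0<z x<y = +-cancelʳ-< (- (z * x)) (begin-strict
    z * x + - (z * x)   ≈⟨ -‿inverseʳ (z * x) ⟩
    0#                  <⟨ *-pos 0<z (0<y-x x<y) ⟩
    z * (y + - x)       ≈⟨ distribˡ z y (- x) ⟩
    z * y + z * - x     ≈⟨ +-congˡ (sym (-‿distribʳ-* z x)) ⟩
    z * y + - (z * x)   ∎)

  *-monoʳ-≤ : ∀ {z x y} → 0# ≤ z → x ≤ y → z * x ≤ z * y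
  *-monoʳ-≤ (inj₁ 0<z) (inj₁ x<y) = inj₁ (*-monoʳ-< 0<z x<y)
  *-monoʳ-≤ (inj₁ 0<z) (inj₂ x≈y) = inj₂ (*-congˡ x≈y)
  *-monoʳ-≤ {z} {x} {y} (inj₂ 0≈z) _ =
    inj₂ (trans (*-congʳ (sym 0≈z)) (trans (zeroˡ x) (trans (sym (zeroˡ y)) (*-congʳ 0≈z))))

  *-monoˡ-≤ : ∀ {z x y} → 0# ≤ z → x ≤ y → x * z ≤ y * z
  *-monoˡ-≤ {z} {x} {y} 0≤z x≤y = begin
    x * z   ≈⟨ *-comm x z ⟩
    z * x   ≤⟨ *-monoʳ-≤ 0≤z x≤y ⟩
    z * y   ≈⟨ *-comm z y ⟩
    y * z   ∎

  *-mono-≤ : ∀ {x y u v} → 0# ≤ x → 0# ≤ v → x ≤ y → u ≤ v → x * u ≤ y * v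
  *-mono-≤ 0≤x 0≤v x≤y u≤v = ≤-trans (*-monoʳ-≤ 0≤x u≤v) (*-monoˡ-≤ 0≤v x≤y)

  0≤* : ∀ {x y} → 0# ≤ x → 0# ≤ y → 0# ≤ x * y
  0≤* {x} {y} 0≤x 0≤y = ≤-trans (≈⇒≤ (sym (zeroʳ x))) (*-monoʳ-≤ 0≤x 0≤y)

  *-cancelˡ-≤ : ∀ {z x y} → 0# < z → z * x ≤ z * y → x ≤ y
  *-cancelˡ-≤ {z} {x} {y} 0<z le with ≤-or-> x y
  ... | inj₁ x≤y = x≤y
  ... | inj₂ y<x = contradiction (*-monoʳ-< 0<z y<x) (≤⇒≯ le)

  *-cancelʳ-≤ : ∀ {z x y} → 0# < z → x * z ≤ y * z → x ≤ y
  *-cancelʳ-≤ {z} {x} {y} 0<z le = *-cancelˡ-≤ 0<z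
    (≤-trans (≈⇒≤ (*-comm z x)) (≤-trans le (≈⇒≤ (*-comm y z))))

  0≤1 : 0# ≤ 1#
  0≤1 = inj₁ 0<1

  >⇒≉0 : ∀ {x} → 0# < x → ¬ x ≈ 0#
  >⇒≉0 0<x x≈0 = <-irrefl (sym x≈0) 0<x

  *-⁻¹ : ∀ {x} → 0# < x → x * x ⁻¹ ≈ 1#
  *-⁻¹ 0<x = *-inverseʳ (>⇒≉0 0<x)

  ⁻¹-* : ∀ {x} → 0# < x → x ⁻¹ * x ≈ 1#
  ⁻¹-* 0<x = trans (*-comm _ _) (*-⁻¹ 0<x)

  0<⁻¹ : ∀ {x} → 0# < x → 0# < x ⁻¹
  0<⁻¹ {x} 0<x with ≤-or-> (x ⁻¹) 0#
  ... | inj₂ 0<x⁻¹ = 0<x⁻¹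
  ... | inj₁ x⁻¹≤0 = contradiction 0<1 (≤⇒≯ (begin
    1#         ≈⟨ *-⁻¹ 0<x ⟨
    x * x ⁻¹   ≤⟨ *-monoʳ-≤ (inj₁ 0<x) x⁻¹≤0 ⟩
    x * 0#     ≈⟨ zeroʳ x ⟩
    0#         ∎))

  *-⁻¹-cancelʳ : ∀ {z} x → 0# < z → x * z * z ⁻¹ ≈ x
  *-⁻¹-cancelʳ {z} x 0<z = trans (*-assoc x z _) (trans (*-congˡ (*-⁻¹ 0<z)) (*-identityʳ x))

  /-*-cancelʳ : ∀ {z} x → 0# < z → x / z * z ≈ x
  /-*-cancelʳ {z} x 0<z = trans (*-assoc x _ z) (trans (*-congˡ (⁻¹-* 0<z)) (*-identityʳ x))

  x≤y*z⇒x/z≤y : ∀ {x y z} → 0# < z → x ≤ y * z → x / z ≤ y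
  x≤y*z⇒x/z≤y {x} {y} {z} 0<z le = *-cancelʳ-≤ 0<z (≤-trans (≈⇒≤ (/-*-cancelʳ x 0<z)) le)

  x*z≤y⇒x≤y/z : ∀ {x y z} → 0# < z → x * z ≤ y → x ≤ y / z
  x*z≤y⇒x≤y/z {x} {y} {z} 0<z le = *-cancelʳ-≤ 0<z (≤-trans le (≈⇒≤ (sym (/-*-cancelʳ y 0<z))))

  0≤/ : ∀ {x y} → 0# ≤ x → 0# < y → 0# ≤ x / y
  0≤/ 0≤x 0<y = 0≤* 0≤x (inj₁ (0<⁻¹ 0<y))

  -- Natural numbers inside the field.

  fromℕ-+ : ∀ m n → fromℕ (m ℕ.+ n) ≈ fromℕ m + fromℕ n
  fromℕ-+ = Mult.×-homo-+ 1#

  fromℕ-* : ∀ m n → fromℕ (m ℕ.* n) ≈ fromℕ m * fromℕ n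
  fromℕ-* = Mult.×1-homo-*

  fromℕ-1 : fromℕ 1 ≈ 1#
  fromℕ-1 = +-identityʳ 1#

  fromℕ-^ : ∀ m n → fromℕ (m ℕ.^ n) ≈ fromℕ m Exp.^ n
  fromℕ-^ m zero    = fromℕ-1
  fromℕ-^ m (suc n) = trans (fromℕ-* m (m ℕ.^ n)) (*-congˡ (fromℕ-^ m n))

  0≤fromℕ : ∀ n → 0# ≤ fromℕ n
  0≤fromℕ zero    = ≤-refl
  0≤fromℕ (suc n) = 0≤+ 0≤1 (0≤fromℕ n)

  fromℕ-mono-≤ : ∀ {m n} → m ℕ.≤ n → fromℕ m ≤ fromℕ n
  fromℕ-mono-≤ {n = n} ℕ.z≤n = 0≤fromℕ n
  fromℕ-mono-≤ (ℕ.s≤s m≤n) = +-monoʳ-≤ 1# (fromℕ-mono-≤ m≤n)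

  x<1+x : ∀ x → x < 1# + x
  x<1+x x = <-respˡ-≈ (+-identityˡ x) (+-monoˡ-< x 0<1)

  fromℕ-mono-< : ∀ {m n} → m ℕ.< n → fromℕ m < fromℕ n
  fromℕ-mono-< {m} m<n = <-≤-trans (x<1+x (fromℕ m)) (fromℕ-mono-≤ m<n)

  0<fromℕ : ∀ n → .⦃ ℕ.NonZero n ⦄ → 0# < fromℕ n
  0<fromℕ n = fromℕ-mono-< (ℕ.>-nonZero⁻¹ n)

  fromℕ-cancel-≤ : ∀ {m n} → fromℕ m ≤ fromℕ n → m ℕ.≤ n
  fromℕ-cancel-≤ le = ℕ.≮⇒≥ (λ n<m → ≤⇒≯ le (fromℕ-mono-< n<m))

  ^-mono-≤ : ∀ k {x y} → 0# ≤ x → x ≤ y → x Exp.^ k ≤ y Exp.^ k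
  0≤^ : ∀ k {x} → 0# ≤ x → 0# ≤ x Exp.^ k
  0≤^ zero    0≤x = 0≤1
  0≤^ (suc k) 0≤x = 0≤* 0≤x (0≤^ k 0≤x)
  ^-mono-≤ zero    0≤x x≤y = ≤-refl
  ^-mono-≤ (suc k) 0≤x x≤y = *-mono-≤ 0≤x (0≤^ k (≤-trans 0≤x x≤y)) x≤y (^-mono-≤ k 0≤x x≤y)

  -- The supremum of {0} ∪ {1 | A} is positive exactly when A holds.
  lem : (A : Set) → Dec A
  lem A with ≤-or-> (sup P) 0#
    where
    P : Carrier → Set
    P x = x ≈ 0# ⊎ (x ≈ 1# × A)
  ... | inj₁ sup≤0 = no λ a → ≤⇒≯ (≤-trans (sup-upper (0# , inj₁ refl) bounded 1# (inj₂ (refl , a))) sup≤0) 0<1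
    where
    bounded : ∃ (UpperBound (λ x → x ≈ 0# ⊎ (x ≈ 1# × A)))
    bounded = 1# , λ { x (inj₁ x≈0) → ≤-trans (≈⇒≤ x≈0) 0≤1 ; x (inj₂ (x≈1 , _)) → ≈⇒≤ x≈1 }
  ... | inj₂ 0<sup with sup-approx (0# , inj₁ refl)
    (1# , λ { x (inj₁ x≈0) → ≤-trans (≈⇒≤ x≈0) 0≤1 ; x (inj₂ (x≈1 , _)) → ≈⇒≤ x≈1 }) 0<sup
  ...   | x , inj₁ x≈0 , 0<x = contradiction (sym x≈0) (λ e → <-irrefl e 0<x)
  ...   | x , inj₂ (_ , a) , _ = yes a

  open Combinatorics.Classical lem

  -- Archimedean property, floors, suprema and infima.

  archimedean : ∀ x → ∃[ n ] x < fromℕ n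
  archimedean x = by-contradiction λ none →
    let bounded : ∃ (UpperBound P)
        bounded = x , λ { y (n , y≈n) → ≤-trans (≈⇒≤ y≈n) (≮⇒≥ (λ x<n → none (n , x<n))) }
        s-1<s : sup P + - 1# < sup P
        s-1<s = <-respʳ-≈ (x-y+y (sup P) 1#) (<-respʳ-≈ (+-comm 1# (sup P + - 1#)) (x<1+x (sup P + - 1#)))
        (y , (n , y≈n) , s-1<y) = sup-approx inhabited bounded s-1<s
    in ≤⇒≯ (sup-upper inhabited bounded (fromℕ (suc n)) (suc n , refl)) (begin-strict
         sup P                 ≈⟨ x-y+y (sup P) 1# ⟨
         sup P + - 1# + 1#     <⟨ +-monoˡ-< 1# s-1<y ⟩
         y + 1#                ≈⟨ +-comm y 1# ⟩
         1# + y                ≈⟨ +-congˡ y≈n ⟩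
         fromℕ (suc n)         ∎)
    where
    P : Carrier → Set
    P y = ∃[ n ] y ≈ fromℕ n
    inhabited : ∃ P
    inhabited = 0# , 0 , refl

  floor : ∀ {x} → 0# ≤ x → ∃[ n ] (fromℕ n ≤ x × x < fromℕ (suc n))
  floor {x} 0≤x = search (proj₁ (archimedean x)) (proj₂ (archimedean x))
    where
    search : ∀ n → x < fromℕ n → ∃[ n ] (fromℕ n ≤ x × x < fromℕ (suc n))
    search zero    x<0 = contradiction x<0 (≤⇒≯ 0≤x)
    search (suc n) x<1+n with ≤-or-> (fromℕ n) x
    ... | inj₁ n≤x = n , n≤x , x<1+n
    ... | inj₂ x<n = search n x<n

  module _ {P : Carrier → Set} where

    sup-least : ∃ P → ∀ {u} → UpperBound P u → sup P ≤ u
    sup-least inhabited {u} upper = ≮⇒≥ λ u<sup →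
      let (x , Px , u<x) = sup-approx inhabited (u , upper) u<sup in ≤⇒≯ (upper x Px) u<x

  module _ {P : Carrier → Set} {x : Carrier} (Px : P x) {l : Carrier} (lower : ∀ y → P y → l ≤ y)
           (P-resp : ∀ {x y} → x ≈ y → P x → P y) where

    private
      inhabited : ∃ (λ y → P (- y))
      inhabited = - x , P-resp (sym (-‿involutive x)) Px

      upper : UpperBound (λ y → P (- y)) (- l)
      upper y Py = ≤-trans (≈⇒≤ (sym (-‿involutive y))) (-‿anti-≤ (lower (- y) Py))

    -- As `inf` is a negated supremum of negatives, `P-resp` has to carry membership from `x` to its
    -- double negative.
    inf-lower : inf P ≤ x
    inf-lower = ≤-trans
      (-‿anti-≤ (sup-upper inhabited (- l , upper) (- x) (P-resp (sym (-‿involutive x)) Px)))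
      (≈⇒≤ (-‿involutive x))

    inf-greatest : l ≤ inf P
    inf-greatest = ≤-trans (≈⇒≤ (sym (-‿involutive l))) (-‿anti-≤ (sup-least inhabited upper))

  -- The exponential series

  Seq : Set
  Seq = ℕ → Carrier

  psum : Seq → Seq
  psum a zero    = 0#
  psum a (suc m) = psum a m + a m

  -- Coefficients of the Cauchy product, peeled off from the first factor.
  conv : Seq → Seq → Seq
  conv a b zero    = a 0 * b 0
  conv a b (suc m) = a 0 * b (suc m) + conv (a ∘ suc) b m

  psum-cong : ∀ {a b} → (∀ i → a i ≈ b i) → ∀ m → psum a m ≈ psum b m
  psum-cong a≈b zero    = refl
  psum-cong a≈b (suc m) = +-cong (psum-cong a≈b m) (a≈b m)

  psum-mono-≤ : ∀ {a b} → (∀ i → a i ≤ b i) → ∀ m → psum a m ≤ psum b m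
  psum-mono-≤ a≤b zero    = ≤-refl
  psum-mono-≤ a≤b (suc m) = +-mono-≤ (psum-mono-≤ a≤b m) (a≤b m)

  psum-suc : ∀ a m → psum a (suc m) ≈ a 0 + psum (a ∘ suc) m
  psum-suc a zero    = +-comm 0# (a 0)
  psum-suc a (suc m) = trans (+-congʳ (psum-suc a m)) (+-assoc (a 0) _ _)

  module _ {a : Seq} (0≤a : ∀ i → 0# ≤ a i) where

    0≤psum : ∀ m → 0# ≤ psum a m
    0≤psum zero    = ≤-refl
    0≤psum (suc m) = 0≤+ (0≤psum m) (0≤a m)

    psum-increasing : ∀ {m k} → m ℕ.≤ k → psum a m ≤ psum a k
    psum-increasing {zero}  {k}     _           = 0≤psum k
    psum-increasing {suc m} {suc k} (ℕ.s≤s m≤k) with ℕ.m≤n⇒m<n∨m≡n m≤k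
    ... | inj₁ m<k    = ≤-trans (psum-increasing m<k) (x≤x+y (0≤a k))
    ... | inj₂ ≡.refl = ≤-refl

  conv-cong : ∀ {a a′ b b′} → (∀ i → a i ≈ a′ i) → (∀ i → b i ≈ b′ i) → ∀ m → conv a b m ≈ conv a′ b′ m
  conv-cong a≈ b≈ zero    = *-cong (a≈ 0) (b≈ 0)
  conv-cong a≈ b≈ (suc m) = +-cong (*-cong (a≈ 0) (b≈ (suc m))) (conv-cong (a≈ ∘ suc) b≈ m)

  conv-last : ∀ a b m → conv a b (suc m) ≈ conv a (b ∘ suc) m + a (suc m) * b 0
  conv-last a b zero    = refl
  conv-last a b (suc m) = trans (+-congˡ (conv-last (a ∘ suc) b m)) (sym (+-assoc _ _ _))

  conv-scaleˡ : ∀ c a b m → conv (λ i → c * a i) b m ≈ c * conv a b m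
  conv-scaleˡ c a b zero    = *-assoc c (a 0) (b 0)
  conv-scaleˡ c a b (suc m) = trans (+-cong (*-assoc c _ _) (conv-scaleˡ c (a ∘ suc) b m)) (sym (distribˡ c _ _))

  conv-scaleʳ : ∀ c a b m → conv a (λ i → c * b i) m ≈ c * conv a b m
  conv-scaleʳ c a b zero    = solve 3 (λ a b c → a :* (c :* b) := c :* (a :* b)) refl (a 0) (b 0) c
  conv-scaleʳ c a b (suc m) = trans
    (+-cong (solve 3 (λ a b c → a :* (c :* b) := c :* (a :* b)) refl (a 0) (b (suc m)) c)
            (conv-scaleʳ c (a ∘ suc) b m))
    (sym (distribˡ c _ _))

  -- The Leibniz rule for the operator x d/dx on coefficients: indices of the factors add up to the
  -- index of the product. The offsets `c` and `d` absorb the shift in the recursion.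
  conv-leibniz : ∀ c d a b m →
    conv (λ i → fromℕ (c ℕ.+ i) * a i) b m + conv a (λ j → fromℕ (d ℕ.+ j) * b j) m ≈
    fromℕ (c ℕ.+ d ℕ.+ m) * conv a b m
  conv-leibniz c d a b zero = begin-equality
    fromℕ (c ℕ.+ 0) * a 0 * b 0 + a 0 * (fromℕ (d ℕ.+ 0) * b 0)
      ≡⟨ ≡.cong₂ (λ c d → fromℕ c * a 0 * b 0 + a 0 * (fromℕ d * b 0)) (ℕ.+-identityʳ c) (ℕ.+-identityʳ d) ⟩
    fromℕ c * a 0 * b 0 + a 0 * (fromℕ d * b 0)
      ≈⟨ solve 4 (λ c d a b → c :* a :* b :+ a :* (d :* b) := (c :+ d) :* (a :* b)) refl (fromℕ c) (fromℕ d) (a 0) (b 0) ⟩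
    (fromℕ c + fromℕ d) * (a 0 * b 0)
      ≈⟨ *-congʳ (sym (trans (reflexive (≡.cong fromℕ (ℕ.+-identityʳ (c ℕ.+ d)))) (fromℕ-+ c d))) ⟩
    fromℕ (c ℕ.+ d ℕ.+ 0) * (a 0 * b 0) ∎
  conv-leibniz c d a b (suc m) = begin-equality
    fromℕ (c ℕ.+ 0) * a 0 * b (suc m) + conv (λ i → fromℕ (c ℕ.+ suc i) * a (suc i)) b m +
      (a 0 * (fromℕ (d ℕ.+ suc m) * b (suc m)) + conv (a ∘ suc) (λ j → fromℕ (d ℕ.+ j) * b j) m)
      ≈⟨ +-congʳ (+-congˡ (conv-cong (λ i → *-congʳ (reflexive (≡.cong fromℕ (ℕ.+-suc c i)))) (λ _ → refl) m)) ⟩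
    fromℕ (c ℕ.+ 0) * a 0 * b (suc m) + X + (a 0 * (fromℕ (d ℕ.+ suc m) * b (suc m)) + Y)
      ≈⟨ solve 6 (λ c d a b x y → c :* a :* b :+ x :+ (a :* (d :* b) :+ y) := (c :+ d) :* (a :* b) :+ (x :+ y))
           refl (fromℕ (c ℕ.+ 0)) (fromℕ (d ℕ.+ suc m)) (a 0) (b (suc m)) X Y ⟩
    (fromℕ (c ℕ.+ 0) + fromℕ (d ℕ.+ suc m)) * (a 0 * b (suc m)) + (X + Y)
      ≈⟨ +-cong (*-congʳ (trans (sym (fromℕ-+ (c ℕ.+ 0) (d ℕ.+ suc m))) (reflexive (≡.cong fromℕ index))))
                (trans (conv-leibniz (suc c) d (a ∘ suc) b m) (*-congʳ (reflexive (≡.cong fromℕ (≡.sym (ℕ.+-suc (c ℕ.+ d) m)))))) ⟩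
    fromℕ (c ℕ.+ d ℕ.+ suc m) * (a 0 * b (suc m)) + fromℕ (c ℕ.+ d ℕ.+ suc m) * conv (a ∘ suc) b m
      ≈⟨ distribˡ _ _ _ ⟨
    fromℕ (c ℕ.+ d ℕ.+ suc m) * conv a b (suc m) ∎
    where
    X Y : Carrier
    X = conv (λ i → fromℕ (suc c ℕ.+ i) * a (suc i)) b m
    Y = conv (a ∘ suc) (λ j → fromℕ (d ℕ.+ j) * b j) m
    index : c ℕ.+ 0 ℕ.+ (d ℕ.+ suc m) ≡ c ℕ.+ d ℕ.+ suc m
    index = ≡.trans (≡.cong (ℕ._+ (d ℕ.+ suc m)) (ℕ.+-identityʳ c)) (≡.sym (ℕ.+-assoc c d (suc m)))

  psum-conv-suc : ∀ a b m → psum (conv a b) (suc m) ≈ a 0 * psum b (suc m) + psum (conv (a ∘ suc) b) m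
  psum-conv-suc a b zero = solve 2 (λ a b → con 0 :+ a :* b := a :* (con 0 :+ b) :+ con 0) refl (a 0) (b 0)
  psum-conv-suc a b (suc m) = trans (+-congʳ (psum-conv-suc a b m))
    (solve 5 (λ a s b u c → a :* s :+ u :+ (a :* b :+ c) := a :* (s :+ b) :+ (u :+ c)) refl
      (a 0) (psum b (suc m)) (b (suc m)) (psum (conv (a ∘ suc) b) m) (conv (a ∘ suc) b m))

  rearrangement : ∀ {x y s t} → x ≤ y → s ≤ t → x * t + y * s ≤ y * t + x * s
  rearrangement {x} {y} {s} {t} x≤y s≤t = begin
    x * t + y * s                                    ≈⟨ +-identityʳ _ ⟨
    x * t + y * s + 0#                               ≤⟨ +-monoʳ-≤ _ (0≤* (0≤y-x x≤y) (0≤y-x s≤t)) ⟩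
    x * t + y * s + (y + - x) * (t + - s)            ≈⟨ lemma ⟩
    y * t + x * s                                    ∎
    where
    lemma : x * t + y * s + (y + - x) * (t + - s) ≈ y * t + x * s
    lemma = begin-equality
      x * t + y * s + (y + - x) * (t + - s)
        ≈⟨ solve 6 (λ x y s t x′ s′ → x :* t :+ y :* s :+ (y :+ x′) :* (t :+ s′) :=
             y :* t :+ y :* (s :+ s′) :+ ((x :+ x′) :* t :+ x′ :* s′)) refl x y s t (- x) (- s) ⟩
      y * t + y * (s + - s) + ((x + - x) * t + - x * - s)
        ≈⟨ +-cong (+-congˡ (trans (*-congˡ (-‿inverseʳ s)) (zeroʳ y)))
                  (+-cong (trans (*-congʳ (-‿inverseʳ x)) (zeroˡ t)) neg*neg) ⟩
      y * t + 0# + (0# + x * s)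
        ≈⟨ +-cong (+-identityʳ _) (+-identityˡ _) ⟩
      y * t + x * s ∎
      where
      neg*neg : - x * - s ≈ x * s
      neg*neg = trans (sym (-‿distribˡ-* x (- s)))
        (trans (-‿cong (sym (-‿distribʳ-* x s))) (-‿involutive (x * s)))

  module _ {b : Seq} (0≤b : ∀ i → 0# ≤ b i) where

    0≤conv : ∀ {a} → (∀ i → 0# ≤ a i) → ∀ m → 0# ≤ conv a b m
    0≤conv 0≤a zero    = 0≤* (0≤a 0) (0≤b 0)
    0≤conv 0≤a (suc m) = 0≤+ (0≤* (0≤a 0) (0≤b (suc m))) (0≤conv (0≤a ∘ suc) m)

    -- The triangle of index pairs behind the Cauchy product lies in a square, and the terms are
    -- nonnegative; `psum-conv-≥` places a rectangle in a larger triangle.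
    psum-conv-≤ : ∀ {a} → (∀ i → 0# ≤ a i) → ∀ m → psum (conv a b) m ≤ psum a m * psum b m
    psum-conv-≤ 0≤a zero = ≈⇒≤ (sym (zeroˡ 0#))
    psum-conv-≤ {a} 0≤a (suc m) = begin
      psum (conv a b) (suc m)
        ≈⟨ psum-conv-suc a b m ⟩
      a 0 * psum b (suc m) + psum (conv (a ∘ suc) b) m
        ≤⟨ +-monoʳ-≤ _ (≤-trans (psum-conv-≤ (0≤a ∘ suc) m)
             (*-monoʳ-≤ (0≤psum (0≤a ∘ suc) m) (psum-increasing 0≤b (ℕ.n≤1+n m)))) ⟩
      a 0 * psum b (suc m) + psum (a ∘ suc) m * psum b (suc m)
        ≈⟨ trans (sym (distribʳ _ _ _)) (*-congʳ (sym (psum-suc a m))) ⟩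
      psum a (suc m) * psum b (suc m) ∎

    psum-conv-≥ : ∀ {a} → (∀ i → 0# ≤ a i) → ∀ m k → psum a m * psum b k ≤ psum (conv a b) (m ℕ.+ k)
    psum-conv-≥ 0≤a zero k = ≤-trans (≈⇒≤ (zeroˡ _)) (0≤psum (0≤conv 0≤a) k)
    psum-conv-≥ {a} 0≤a (suc m) k = begin
      psum a (suc m) * psum b k
        ≈⟨ trans (*-congʳ (psum-suc a m)) (distribʳ _ _ _) ⟩
      a 0 * psum b k + psum (a ∘ suc) m * psum b k
        ≤⟨ +-mono-≤ (*-monoʳ-≤ (0≤a 0) (psum-increasing 0≤b (ℕ.m≤n+m k (suc m)))) (psum-conv-≥ (0≤a ∘ suc) m k) ⟩
      a 0 * psum b (suc (m ℕ.+ k)) + psum (conv (a ∘ suc) b) (m ℕ.+ k)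
        ≈⟨ psum-conv-suc a b (m ℕ.+ k) ⟨
      psum (conv a b) (suc m ℕ.+ k) ∎

    -- The terms of psum a m * psum b n missing in psum (conv a b) m increase with a.
    psum-conv-defect : ∀ {a c} → (∀ i → c i ≤ a i) → ∀ m n → m ℕ.≤ n →
      psum c m * psum b n + psum (conv a b) m ≤ psum a m * psum b n + psum (conv c b) m
    psum-conv-defect c≤a zero n _ = ≤-refl
    psum-conv-defect {a} {c} c≤a (suc m) n m<n = begin
      psum c (suc m) * B + psum (conv a b) (suc m)
        ≈⟨ +-cong (*-congʳ (psum-suc c m)) (psum-conv-suc a b m) ⟩
      (c 0 + Sc) * B + (a 0 * B′ + Ua)
        ≈⟨ solve 6 (λ c s B a B′ u → (c :+ s) :* B :+ (a :* B′ :+ u) := c :* B :+ a :* B′ :+ (s :* B :+ u))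
             refl (c 0) Sc B (a 0) B′ Ua ⟩
      c 0 * B + a 0 * B′ + (Sc * B + Ua)
        ≤⟨ +-mono-≤ (rearrangement (c≤a 0) (psum-increasing 0≤b m<n))
                    (psum-conv-defect (c≤a ∘ suc) m n (ℕ.<⇒≤ m<n)) ⟩
      a 0 * B + c 0 * B′ + (Sa * B + Uc)
        ≈⟨ solve 6 (λ c s B a B′ u → (c :+ s) :* B :+ (a :* B′ :+ u) := c :* B :+ a :* B′ :+ (s :* B :+ u))
             refl (a 0) Sa B (c 0) B′ Uc ⟨
      (a 0 + Sa) * B + (c 0 * B′ + Uc)
        ≈⟨ +-cong (*-congʳ (psum-suc a m)) (psum-conv-suc c b m) ⟨
      psum a (suc m) * B + psum (conv c b) (suc m) ∎
      where
      B B′ Sa Sc Ua Uc : Carrier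
      B  = psum b n
      B′ = psum b (suc m)
      Sa = psum (a ∘ suc) m
      Sc = psum (c ∘ suc) m
      Ua = psum (conv (a ∘ suc) b) m
      Uc = psum (conv (c ∘ suc) b) m

  expTerm : Carrier → Seq
  expTerm x k = (x Exp.^ k) / fromℕ (k !)

  0<! : ∀ k → 0# < fromℕ (k !)
  0<! k = fromℕ-mono-< (ℕ.1≤n! k)

  *-cancelʳ-≈ : ∀ {z x y} → 0# < z → x * z ≈ y * z → x ≈ y
  *-cancelʳ-≈ {z} {x} {y} 0<z eq =
    trans (sym (*-⁻¹-cancelʳ x 0<z)) (trans (*-congʳ eq) (*-⁻¹-cancelʳ y 0<z))

  expSum-psum : ∀ x m → expSum x m ≈ psum (expTerm x) m
  expSum-psum x zero    = refl
  expSum-psum x (suc m) = +-congʳ (expSum-psum x m)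

  expTerm-cong : ∀ {x y} → x ≈ y → ∀ k → expTerm x k ≈ expTerm y k
  expTerm-cong x≈y k = *-congʳ (Exp.^-congˡ k x≈y)

  expTerm-0 : ∀ x → expTerm x 0 ≈ 1#
  expTerm-0 x = *-cancelʳ-≈ (0<! 0) (trans (/-*-cancelʳ 1# (0<! 0)) (sym (trans (*-identityˡ _) fromℕ-1)))

  expTerm-suc : ∀ x k → fromℕ (suc k) * expTerm x (suc k) ≈ x * expTerm x k
  expTerm-suc x k = *-cancelʳ-≈ (0<! k) (begin-equality
    fromℕ (suc k) * expTerm x (suc k) * fromℕ (k !)
      ≈⟨ solve 3 (λ a b c → a :* b :* c := b :* (a :* c)) refl (fromℕ (suc k)) (expTerm x (suc k)) (fromℕ (k !)) ⟩
    expTerm x (suc k) * (fromℕ (suc k) * fromℕ (k !))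
      ≈⟨ *-congˡ (fromℕ-* (suc k) (k !)) ⟨
    expTerm x (suc k) * fromℕ (suc k !)
      ≈⟨ /-*-cancelʳ _ (0<! (suc k)) ⟩
    x * x Exp.^ k
      ≈⟨ *-congˡ (/-*-cancelʳ _ (0<! k)) ⟨
    x * (expTerm x k * fromℕ (k !))
      ≈⟨ *-assoc x _ _ ⟨
    x * expTerm x k * fromℕ (k !) ∎)

  expTerm-1 : ∀ x → expTerm x 1 ≈ x
  expTerm-1 x = begin-equality
    expTerm x 1               ≈⟨ trans (*-congʳ fromℕ-1) (*-identityˡ _) ⟨
    fromℕ 1 * expTerm x 1     ≈⟨ expTerm-suc x 0 ⟩
    x * expTerm x 0           ≈⟨ trans (*-congˡ (expTerm-0 x)) (*-identityʳ x) ⟩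
    x                         ∎

  0≤expTerm : ∀ {x} → 0# ≤ x → ∀ k → 0# ≤ expTerm x k
  0≤expTerm 0≤x k = 0≤/ (0≤^ k 0≤x) (0<! k)

  -- Both sides satisfy (m + 1) c (m + 1) = (x + y) c m.
  expTerm-+ : ∀ x y m → conv (expTerm x) (expTerm y) m ≈ expTerm (x + y) m
  expTerm-+ x y zero = trans (*-cong (expTerm-0 x) (expTerm-0 y)) (trans (*-identityˡ 1#) (sym (expTerm-0 (x + y))))
  expTerm-+ x y (suc m) = *-cancelʳ-≈ (fromℕ-mono-< (ℕ.z<s {m})) (trans (*-comm _ _) (trans (begin-equality
    fromℕ (suc m) * conv a b (suc m)
      ≈⟨ conv-leibniz 0 0 a b (suc m) ⟨
    conv (λ i → fromℕ i * a i) b (suc m) + conv a (λ j → fromℕ j * b j) (suc m)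
      ≈⟨ +-cong left right ⟩
    x * conv a b m + y * conv a b m
      ≈⟨ distribʳ _ x y ⟨
    (x + y) * conv a b m
      ≈⟨ *-congˡ (expTerm-+ x y m) ⟩
    (x + y) * expTerm (x + y) m
      ≈⟨ expTerm-suc (x + y) m ⟨
    fromℕ (suc m) * expTerm (x + y) (suc m) ∎) (*-comm _ _)))
    where
    a b : Seq
    a = expTerm x
    b = expTerm y
    left : conv (λ i → fromℕ i * a i) b (suc m) ≈ x * conv a b m
    left = begin-equality
      0# * a 0 * b (suc m) + conv (λ i → fromℕ (suc i) * a (suc i)) b m
        ≈⟨ +-cong (trans (*-congʳ (zeroˡ (a 0))) (zeroˡ _)) (conv-cong (expTerm-suc x) (λ _ → refl) m) ⟩
      0# + conv (λ i → x * a i) b m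
        ≈⟨ trans (+-identityˡ _) (conv-scaleˡ x a b m) ⟩
      x * conv a b m ∎
    right : conv a (λ j → fromℕ j * b j) (suc m) ≈ y * conv a b m
    right = begin-equality
      conv a (λ j → fromℕ j * b j) (suc m)
        ≈⟨ conv-last a _ m ⟩
      conv a (λ j → fromℕ (suc j) * b (suc j)) m + a (suc m) * (0# * b 0)
        ≈⟨ +-cong (conv-cong (λ _ → refl) (expTerm-suc y) m) (trans (*-congˡ (zeroˡ (b 0))) (zeroʳ _)) ⟩
      conv a (λ j → y * b j) m + 0#
        ≈⟨ trans (+-identityʳ _) (conv-scaleʳ y a b m) ⟩
      y * conv a b m ∎

  E : Carrier → Seq
  E x = psum (expTerm x)

  E-cong : ∀ {x y} → x ≈ y → ∀ m → E x m ≈ E y m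
  E-cong x≈y = psum-cong (expTerm-cong x≈y)

  E-mono-≤ : ∀ {x y} → 0# ≤ x → x ≤ y → ∀ m → E x m ≤ E y m
  E-mono-≤ 0≤x x≤y = psum-mono-≤ (λ k → *-monoˡ-≤ (inj₁ (0<⁻¹ (0<! k))) (^-mono-≤ k 0≤x x≤y))

  E-zero : ∀ m → E 0# (suc m) ≈ 1#
  E-zero m = trans (psum-suc (expTerm 0#) m) (trans (+-cong (expTerm-0 0#) (tail m)) (+-identityʳ 1#))
    where
    tail : ∀ m → psum (expTerm 0# ∘ suc) m ≈ 0#
    tail zero    = refl
    tail (suc m) = trans (+-cong (tail m) (trans (*-congʳ (zeroˡ _)) (zeroˡ _))) (+-identityʳ 0#)

  module _ {x y : Carrier} (0≤x : 0# ≤ x) (0≤y : 0# ≤ y) where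

    E-+-≤ : ∀ m → E (x + y) m ≤ E x m * E y m
    E-+-≤ m = ≤-trans (≈⇒≤ (sym (psum-cong (expTerm-+ x y) m))) (psum-conv-≤ (0≤expTerm 0≤y) (0≤expTerm 0≤x) m)

    E-+-≥ : ∀ m k → E x m * E y k ≤ E (x + y) (m ℕ.+ k)
    E-+-≥ m k = ≤-trans (psum-conv-≥ (0≤expTerm 0≤y) (0≤expTerm 0≤x) m k) (≈⇒≤ (psum-cong (expTerm-+ x y) (m ℕ.+ k)))

  ½ : Carrier
  ½ = fromℕ 2 ⁻¹

  0<2 : 0# < fromℕ 2
  0<2 = 0<fromℕ 2

  0<½ : 0# < ½
  0<½ = 0<⁻¹ 0<2

  ½+½ : ½ + ½ ≈ 1#
  ½+½ = begin-equality
    ½ + ½         ≈⟨ solve 1 (λ h → h :+ h := (con 1 :+ (con 1 :+ con 0)) :* h) refl ½ ⟩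
    fromℕ 2 * ½   ≈⟨ *-⁻¹ 0<2 ⟩
    1#            ∎

  -- As `1 ≤ m !`, the geometric series of ratio ½ dominates; its missing tail is the term added on
  -- the left.
  E-½ : ∀ m → E ½ m + (½ Exp.^ m + ½ Exp.^ m) ≤ 1# + 1#
  E-½ zero    = ≈⇒≤ (+-identityˡ _)
  E-½ (suc m) = begin
    E ½ m + expTerm ½ m + (½ * h + ½ * h)   ≤⟨ +-mono-≤ (+-monoʳ-≤ (E ½ m) term) (≈⇒≤ halves) ⟩
    E ½ m + h + h                           ≈⟨ +-assoc (E ½ m) h h ⟩
    E ½ m + (h + h)                         ≤⟨ E-½ m ⟩
    1# + 1#                                 ∎
    where
    h : Carrier
    h = ½ Exp.^ m
    0≤h : 0# ≤ h
    0≤h = 0≤^ m (inj₁ 0<½)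
    halves : ½ * h + ½ * h ≈ h
    halves = trans (sym (distribʳ h ½ ½)) (trans (*-congʳ ½+½) (*-identityˡ h))
    term : expTerm ½ m ≤ h
    term = x≤y*z⇒x/z≤y (0<! m) (begin
      h                   ≈⟨ *-identityʳ h ⟨
      h * 1#              ≤⟨ *-monoʳ-≤ 0≤h (≤-trans (≈⇒≤ (sym fromℕ-1)) (fromℕ-mono-≤ (ℕ.1≤n! m))) ⟩
      h * fromℕ (m !)     ∎)

  -- Partial sums are submultiplicative by `E-+-≤`, so the crude bound 2 for exp ½ propagates. It
  -- bounds every series here and later gives lower bounds for logarithms.
  E-n½ : ∀ n m → E (fromℕ n * ½) m ≤ fromℕ (2 ℕ.^ n)
  E-n½ zero m = ≤-trans (≈⇒≤ (E-cong (zeroˡ ½) m)) (≤-trans (psum-increasing (0≤expTerm ≤-refl) (ℕ.n≤1+n m))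
    (≈⇒≤ (trans (E-zero m) (sym fromℕ-1))))
  E-n½ (suc n) m = begin
    E (fromℕ (suc n) * ½) m            ≈⟨ E-cong (trans (distribʳ ½ 1# (fromℕ n)) (+-congʳ (*-identityˡ ½))) m ⟩
    E (½ + fromℕ n * ½) m              ≤⟨ E-+-≤ (inj₁ 0<½) 0≤n½ m ⟩
    E ½ m * E (fromℕ n * ½) m          ≤⟨ *-mono-≤ (0≤psum (0≤expTerm (inj₁ 0<½)) m) (0≤fromℕ (2 ℕ.^ n)) half (E-n½ n m) ⟩
    fromℕ 2 * fromℕ (2 ℕ.^ n)          ≈⟨ fromℕ-* 2 (2 ℕ.^ n) ⟨
    fromℕ (2 ℕ.^ suc n)                ∎
    where
    0≤n½ : 0# ≤ fromℕ n * ½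
    0≤n½ = 0≤* (0≤fromℕ n) (inj₁ 0<½)
    half : E ½ m ≤ fromℕ 2
    half = ≤-trans (x≤x+y (0≤+ (0≤^ m (inj₁ 0<½)) (0≤^ m (inj₁ 0<½))))
      (≤-trans (E-½ m) (≈⇒≤ (+-congˡ (sym fromℕ-1))))

  E-bounded : ∀ {x} → 0# ≤ x → ∃[ n ] (∀ m → E x m ≤ fromℕ (2 ℕ.^ n))
  E-bounded {x} 0≤x with archimedean (x * fromℕ 2)
  ... | n , 2x<n = n , λ m → ≤-trans (E-mono-≤ 0≤x (x*z≤y⇒x≤y/z 0<2 (inj₁ 2x<n)) m) (E-n½ n m)

  module _ {x : Carrier} (0≤x : 0# ≤ x) where

    private
      P : Carrier → Set
      P y = Eventually (λ m → y ≤ expSum x m)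

      inhabited : ∃ P
      inhabited = 0# , 0 , λ m _ → ≤-trans (0≤psum (0≤expTerm 0≤x) m) (≈⇒≤ (sym (expSum-psum x m)))

      upper : ∀ {u} → (∀ m → E x m ≤ u) → UpperBound P u
      upper E≤u y (m , y≤) = ≤-trans (y≤ m ℕ.≤-refl) (≤-trans (≈⇒≤ (expSum-psum x m)) (E≤u m))

    -- For nonnegative arguments the partial sums increase, so each is an eventual lower bound and
    -- the limit inferior is their supremum.
    E≤exp : ∀ m → E x m ≤ exp x
    E≤exp m = sup-upper inhabited (_ , upper (proj₂ (E-bounded 0≤x))) (E x m)
      (m , λ k m≤k → ≤-trans (psum-increasing (0≤expTerm 0≤x) m≤k) (≈⇒≤ (sym (expSum-psum x k))))

    exp≤ : ∀ {u} → (∀ m → E x m ≤ u) → exp x ≤ u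
    exp≤ E≤u = sup-least inhabited (upper E≤u)

    1+x≤exp : 1# + x ≤ exp x
    1+x≤exp = begin
      1# + x    ≈⟨ +-cong (trans (+-identityˡ _) (expTerm-0 x)) (expTerm-1 x) ⟨
      E x 2     ≤⟨ E≤exp 2 ⟩
      exp x     ∎

    1≤exp : 1# ≤ exp x
    1≤exp = ≤-trans (x≤x+y 0≤x) 1+x≤exp

    0<exp : 0# < exp x
    0<exp = <-≤-trans 0<1 1≤exp

  exp-cong : ∀ {x y} → 0# ≤ x → x ≈ y → exp x ≈ exp y
  exp-cong 0≤x x≈y = ≤-antisym
    (exp≤ 0≤x (λ m → ≤-trans (≈⇒≤ (E-cong x≈y m)) (E≤exp 0≤y m)))
    (exp≤ 0≤y (λ m → ≤-trans (≈⇒≤ (E-cong (sym x≈y) m)) (E≤exp 0≤x m)))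
    where
    0≤y = ≤-trans 0≤x (≈⇒≤ x≈y)

  0<E-suc : ∀ {x} → 0# ≤ x → ∀ m → 0# < E x (suc m)
  0<E-suc {x} 0≤x m = <-≤-trans 0<1 (≤-trans (≈⇒≤ (sym (trans (+-identityˡ _) (expTerm-0 x))))
    (psum-increasing (0≤expTerm 0≤x) (ℕ.s≤s (ℕ.z≤n {m}))))

  -- For the lower bound, the two indices of `E-+-≥` are freed one at a time by dividing by the
  -- other factor. That factor must be positive, hence the partial sums with `suc k` terms.
  exp-+ : ∀ {x y} → 0# ≤ x → 0# ≤ y → exp (x + y) ≈ exp x * exp y
  exp-+ {x} {y} 0≤x 0≤y = ≤-antisym
    (exp≤ 0≤x+y (λ m → ≤-trans (E-+-≤ 0≤x 0≤y m)
      (*-mono-≤ (0≤psum (0≤expTerm 0≤x) m) (inj₁ (0<exp 0≤y)) (E≤exp 0≤x m) (E≤exp 0≤y m))))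
    (≤-trans (≈⇒≤ (*-comm (exp x) (exp y))) (≤-trans (*-monoˡ-≤ (inj₁ (0<exp 0≤x)) exp-y≤)
      (≈⇒≤ (/-*-cancelʳ B (0<exp 0≤x)))))
    where
    0≤x+y = 0≤+ 0≤x 0≤y
    B : Carrier
    B = exp (x + y)
    exp-x*E≤ : ∀ k → E y (suc k) * exp x ≤ B
    exp-x*E≤ k = ≤-trans (≈⇒≤ (*-comm _ _)) (≤-trans
      (*-monoˡ-≤ (inj₁ (0<E-suc 0≤y k)) (exp≤ 0≤x (λ m → x*z≤y⇒x≤y/z (0<E-suc 0≤y k)
        (≤-trans (E-+-≥ 0≤x 0≤y m (suc k)) (E≤exp 0≤x+y (m ℕ.+ suc k))))))
      (≈⇒≤ (/-*-cancelʳ B (0<E-suc 0≤y k))))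
    exp-y≤ : exp y ≤ B / exp x
    exp-y≤ = exp≤ 0≤y (λ k → ≤-trans (psum-increasing (0≤expTerm 0≤y) (ℕ.n≤1+n k))
      (x*z≤y⇒x≤y/z (0<exp 0≤x) (exp-x*E≤ k)))

  exp-^ : ∀ {x} → 0# ≤ x → ∀ k → exp (fromℕ k * x) ≈ exp x Exp.^ k
  exp-^ {x} 0≤x zero = ≤-antisym
    (exp≤ (≈⇒≤ (sym (zeroˡ x))) (λ m → ≤-trans (≈⇒≤ (E-cong (zeroˡ x) m))
      (≤-trans (psum-increasing (0≤expTerm ≤-refl) (ℕ.n≤1+n m)) (≈⇒≤ (E-zero m)))))
    (1≤exp (≈⇒≤ (sym (zeroˡ x))))
  exp-^ {x} 0≤x (suc k) = begin-equality
    exp (fromℕ (suc k) * x)       ≈⟨ exp-cong (0≤* (0≤fromℕ (suc k)) 0≤x) (trans (distribʳ x 1# (fromℕ k)) (+-congʳ (*-identityˡ x))) ⟩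
    exp (x + fromℕ k * x)         ≈⟨ exp-+ 0≤x (0≤* (0≤fromℕ k) 0≤x) ⟩
    exp x * exp (fromℕ k * x)     ≈⟨ *-congˡ (exp-^ 0≤x k) ⟩
    exp x * exp x Exp.^ k         ∎

  -^-cases : ∀ y k → (- y) Exp.^ k ≈ y Exp.^ k ⊎ (- y) Exp.^ k ≈ - (y Exp.^ k)
  -^-cases y zero = inj₁ refl
  -^-cases y (suc k) with -^-cases y k
  ... | inj₁ eq = inj₂ (trans (*-congˡ eq) (sym (-‿distribˡ-* y _)))
  ... | inj₂ eq = inj₁ (trans (*-congˡ eq) (trans (sym (-‿distribˡ-* y _))
                    (trans (-‿cong (sym (-‿distribʳ-* y _))) (-‿involutive _))))

  -- The argument is only `≈` to `- y`, because `exp-cong` covers nonnegative arguments.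
  module _ {y z : Carrier} (0≤y : 0# ≤ y) (z≈-y : z ≈ - y) where

    private
      f : ∀ k → 0# ≤ fromℕ (k !) ⁻¹
      f k = inj₁ (0<⁻¹ (0<! k))

      -x≤x : ∀ {x} → 0# ≤ x → - x ≤ x
      -x≤x 0≤x = ≤-trans (≤-trans (-‿anti-≤ 0≤x) (≈⇒≤ -0#≈0#)) 0≤x

      z^≤y^ : ∀ k → z Exp.^ k ≤ y Exp.^ k
      z^≤y^ k with -^-cases y k
      ... | inj₁ eq = ≈⇒≤ (trans (Exp.^-congˡ k z≈-y) eq)
      ... | inj₂ eq = ≤-trans (≈⇒≤ (trans (Exp.^-congˡ k z≈-y) eq)) (-x≤x (0≤^ k 0≤y))

      0≤z^+y^ : ∀ k → 0# ≤ z Exp.^ k + y Exp.^ k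
      0≤z^+y^ k with -^-cases y k
      ... | inj₁ eq = 0≤+ (≤-trans (0≤^ k 0≤y) (≈⇒≤ (sym (trans (Exp.^-congˡ k z≈-y) eq)))) (0≤^ k 0≤y)
      ... | inj₂ eq = ≈⇒≤ (sym (trans (+-congʳ (trans (Exp.^-congˡ k z≈-y) eq)) (-‿inverseˡ _)))

      term≤ : ∀ k → expTerm z k ≤ expTerm y k
      term≤ k = *-monoˡ-≤ (f k) (z^≤y^ k)

      0≤E+E : ∀ m → 0# ≤ E z m + E y m
      0≤E+E zero    = ≈⇒≤ (sym (+-identityˡ 0#))
      0≤E+E (suc m) = ≤-trans (0≤+ (0≤E+E m) (0≤* (0≤z^+y^ m) (f m)))
        (≈⇒≤ (solve 5 (λ a b c d e → a :+ b :+ (c :+ d) :* e := a :+ c :* e :+ (b :+ d :* e)) refl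
          (E z m) (E y m) (z Exp.^ m) (y Exp.^ m) (fromℕ (m !) ⁻¹)))

      P : Carrier → Set
      P w = Eventually (λ m → w ≤ expSum z m)

      inhabited : ∃ P
      inhabited = - exp y , 0 , λ m _ → begin
        - exp y                      ≤⟨ -‿anti-≤ (E≤exp 0≤y m) ⟩
        - E y m                      ≈⟨ +-identityˡ _ ⟨
        0# + - E y m                 ≤⟨ +-monoˡ-≤ _ (0≤E+E m) ⟩
        E z m + E y m + - E y m      ≈⟨ x+y-y _ _ ⟩
        E z m                        ≈⟨ expSum-psum z m ⟨
        expSum z m                   ∎

      2y : Carrier
      2y = y + y

      0≤2y : 0# ≤ 2y
      0≤2y = 0≤+ 0≤y 0≤y

      -- `psum-conv-defect` bounds the truncation error of the product at `z` and `y`, whose full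
      -- value is 1, by that of the product at `y` and `y`, whose full value is `exp 2y`.
      product-bound : ∀ m → E z (suc m) * E y (suc m) + E 2y (suc m) ≤ exp 2y + 1#
      product-bound m = begin
        E z (suc m) * E y (suc m) + E 2y (suc m)
          ≈⟨ +-congˡ (sym (psum-cong (expTerm-+ y y) (suc m))) ⟩
        E z (suc m) * E y (suc m) + psum (conv (expTerm y) (expTerm y)) (suc m)
          ≤⟨ psum-conv-defect (0≤expTerm 0≤y) term≤ (suc m) (suc m) ℕ.≤-refl ⟩
        E y (suc m) * E y (suc m) + psum (conv (expTerm z) (expTerm y)) (suc m)
          ≤⟨ +-mono-≤ (≤-trans (E-+-≥ 0≤y 0≤y (suc m) (suc m)) (E≤exp 0≤2y (suc m ℕ.+ suc m)))
                      (≈⇒≤ (trans (psum-cong (expTerm-+ z y) (suc m))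
                        (trans (E-cong (trans (+-congʳ z≈-y) (-‿inverseˡ y)) (suc m)) (E-zero m)))) ⟩
        exp 2y + 1# ∎

      upper : UpperBound P (exp y ⁻¹)
      -- Assuming that `w` exceeds `exp y ⁻¹` supplies its positivity, which the estimates below
      -- use.
      upper w (N , w≤) = ≮⇒≥ λ 1/expy<w → ≤⇒≯ (w≤1/expy (<-trans (0<⁻¹ (0<exp 0≤y)) 1/expy<w)) 1/expy<w
        where
        module _ (0<w : 0# < w) where
          -- A common index `M` above all the others decouples `m` from `k`, so the suprema can be
          -- taken separately: over `k` to get `w*E≤1`, then over `m`.
          joint : ∀ m k → w * E y m + E 2y k ≤ exp 2y + 1#
          joint m k = begin
            w * E y m + E 2y k       ≤⟨ +-mono-≤ (*-monoʳ-≤ (inj₁ 0<w) (psum-increasing (0≤expTerm 0≤y) m≤M))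
                                                 (psum-increasing (0≤expTerm 0≤2y) k≤M) ⟩
            w * E y M + E 2y M       ≤⟨ +-monoˡ-≤ (E 2y M) (*-monoˡ-≤ (0≤psum (0≤expTerm 0≤y) M)
                                          (≤-trans (w≤ M N≤M) (≈⇒≤ (expSum-psum z M)))) ⟩
            E z M * E y M + E 2y M   ≤⟨ product-bound (m ℕ.+ (k ℕ.+ N)) ⟩
            exp 2y + 1#              ∎
            where
            M : ℕ
            M = suc (m ℕ.+ (k ℕ.+ N))
            m≤M : m ℕ.≤ M
            m≤M = ℕ.≤-trans (ℕ.m≤m+n m (k ℕ.+ N)) (ℕ.n≤1+n _)
            k≤M : k ℕ.≤ M
            k≤M = ℕ.≤-trans (ℕ.m≤m+n k N) (ℕ.≤-trans (ℕ.m≤n+m (k ℕ.+ N) m) (ℕ.n≤1+n _))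
            N≤M : N ℕ.≤ M
            N≤M = ℕ.≤-trans (ℕ.m≤n+m N k) (ℕ.≤-trans (ℕ.m≤n+m (k ℕ.+ N) m) (ℕ.n≤1+n _))
          w*E≤1 : ∀ m → w * E y m ≤ 1#
          w*E≤1 m = +-cancelʳ-≤ (exp 2y) (begin
            w * E y m + exp 2y
              ≤⟨ +-monoʳ-≤ _ (exp≤ 0≤2y (λ k → +-cancelʳ-≤ (w * E y m) (begin
                   E 2y k + w * E y m                             ≈⟨ +-comm _ _ ⟩
                   w * E y m + E 2y k                             ≤⟨ joint m k ⟩
                   exp 2y + 1#                                    ≈⟨ x-y+y _ _ ⟨
                   exp 2y + 1# + - (w * E y m) + w * E y m        ∎))) ⟩
            w * E y m + (exp 2y + 1# + - (w * E y m))
              ≈⟨ trans (+-comm _ _) (trans (x-y+y _ _) (+-comm _ _)) ⟩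
            1# + exp 2y ∎)
          w≤1/expy : w ≤ exp y ⁻¹
          w≤1/expy = ≤-trans (x*z≤y⇒x≤y/z (0<exp 0≤y) (≤-trans (≈⇒≤ (*-comm w _))
            (≤-trans (*-monoˡ-≤ (inj₁ 0<w) (exp≤ 0≤y (λ m → x*z≤y⇒x≤y/z 0<w (≤-trans (≈⇒≤ (*-comm _ w)) (w*E≤1 m)))))
              (≈⇒≤ (/-*-cancelʳ 1# 0<w))))) (≈⇒≤ (*-identityˡ _))

    -- Serves the negative exponent of `p`. Since `p` is a factor of a quantity to be bounded from
    -- above, an upper bound is what is used.
    exp-neg : exp z ≤ exp y ⁻¹
    exp-neg = sup-least inhabited upper

  -- The logarithm.

  module _ {t : Carrier} (0≤t : 0# ≤ t) where

    private
      Q : Carrier → Set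
      Q x = exp x ≤ t

      upper : UpperBound Q t
      upper x expx≤t with ≤-or-> 0# x
      ... | inj₁ 0≤x = ≤-trans (x≤y+x 0≤1) (≤-trans (1+x≤exp 0≤x) expx≤t)
      ... | inj₂ x<0 = ≤-trans (inj₁ x<0) 0≤t

    exp≤⇒≤log : ∀ {x} → exp x ≤ t → x ≤ log t
    exp≤⇒≤log {x} expx≤t = sup-upper (x , expx≤t) (t , upper) x expx≤t

    2^k≤⇒k/2≤log : ∀ {k} → fromℕ (2 ℕ.^ k) ≤ t → fromℕ k * ½ ≤ log t
    2^k≤⇒k/2≤log {k} 2^k≤t = exp≤⇒≤log (≤-trans (exp≤ (0≤* (0≤fromℕ k) (inj₁ 0<½)) (E-n½ k)) 2^k≤t)

    -- A number above the supremum violates its defining condition. The constant factor lost against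
    -- `exp (log t)` is absorbed in `power-bound`.
    <exp-log+1 : t < exp (log t + 1#)
    <exp-log+1 with ≤-or-> (exp (log t + 1#)) t
    ... | inj₂ lt = lt
    ... | inj₁ le = contradiction (<-respʳ-≈ (+-comm 1# (log t)) (x<1+x (log t))) (≤⇒≯ (exp≤⇒≤log le))

  -- Fractional colourings

  module _ {A : Set} where

    sumOver-cong : ∀ (xs : List A) {f g} → (∀ x → f x ≈ g x) → sumOver xs f ≈ sumOver xs g
    sumOver-cong []       f≈g = refl
    sumOver-cong (x ∷ xs) f≈g = +-cong (f≈g x) (sumOver-cong xs f≈g)

    sumOver-mono-≤ : ∀ (xs : List A) {f g} → (∀ x → f x ≤ g x) → sumOver xs f ≤ sumOver xs g
    sumOver-mono-≤ []       f≤g = ≤-refl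
    sumOver-mono-≤ (x ∷ xs) f≤g = +-mono-≤ (f≤g x) (sumOver-mono-≤ xs f≤g)

    0≤sumOver : ∀ (xs : List A) {f} → (∀ x → 0# ≤ f x) → 0# ≤ sumOver xs f
    0≤sumOver []       0≤f = ≤-refl
    0≤sumOver (x ∷ xs) 0≤f = 0≤+ (0≤f x) (0≤sumOver xs 0≤f)

    sumOver-0 : ∀ (xs : List A) → sumOver xs (λ _ → 0#) ≈ 0#
    sumOver-0 []       = refl
    sumOver-0 (x ∷ xs) = trans (+-identityˡ _) (sumOver-0 xs)

    sumOver-+ : ∀ (xs : List A) f g → sumOver xs (λ x → f x + g x) ≈ sumOver xs f + sumOver xs g
    sumOver-+ []       f g = sym (+-identityˡ 0#)
    sumOver-+ (x ∷ xs) f g = trans (+-congˡ (sumOver-+ xs f g))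
      (solve 4 (λ a b c d → a :+ b :+ (c :+ d) := a :+ c :+ (b :+ d)) refl (f x) (g x) (sumOver xs f) (sumOver xs g))

    sumOver-*ʳ : ∀ (xs : List A) c f → sumOver xs (λ x → f x * c) ≈ sumOver xs f * c
    sumOver-*ʳ []       c f = sym (zeroˡ c)
    sumOver-*ʳ (x ∷ xs) c f = trans (+-congˡ (sumOver-*ʳ xs c f)) (sym (distribʳ c _ _))

    sumOver-*ˡ : ∀ (xs : List A) c f → sumOver xs (λ x → c * f x) ≈ c * sumOver xs f
    sumOver-*ˡ xs c f = trans (sumOver-cong xs (λ x → *-comm c (f x)))
      (trans (sumOver-*ʳ xs c f) (*-comm _ c))

    fromℕ-∑ : ∀ (xs : List A) f → fromℕ (∑ xs f) ≈ sumOver xs (fromℕ ∘ f)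
    fromℕ-∑ []       f = refl
    fromℕ-∑ (x ∷ xs) f = trans (fromℕ-+ (f x) _) (+-congˡ (fromℕ-∑ xs f))

    sumOver-filter : ∀ {P : A → Set} (P? : ∀ x → Dec (P x)) xs f →
                     sumOver (filter P? xs) f ≈ sumOver xs (λ x → fromℕ (𝟙 (P x)) * f x)
    sumOver-filter P? []       f = refl
    sumOver-filter P? (x ∷ xs) f with P? x
    ... | yes p = +-cong (sym (trans (*-congʳ (trans (reflexive (≡.cong fromℕ (𝟙-yes p))) fromℕ-1)) (*-identityˡ _)))
                         (sumOver-filter P? xs f)
    ... | no ¬p = trans (sumOver-filter P? xs f) (sym (trans
                    (+-congʳ (trans (*-congʳ (reflexive (≡.cong fromℕ (𝟙-no ¬p)))) (zeroˡ _))) (+-identityˡ _)))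

  sumOver-swap : ∀ {A B : Set} (xs : List A) (ys : List B) (f : A → B → Carrier) →
                 sumOver xs (λ x → sumOver ys (f x)) ≈ sumOver ys (λ y → sumOver xs (λ x → f x y))
  sumOver-swap []       ys f = sym (sumOver-0 ys)
  sumOver-swap (x ∷ xs) ys f =
    trans (+-congˡ (sumOver-swap xs ys f)) (sym (sumOver-+ ys (f x) _))

  -- Keeps the total of `Cover.colouring` from exceeding `length ℐ / m`: no member of `ℐ` is counted
  -- at two places of the enumeration.
  allSubsets-unique : ∀ {n} (I : Subset n) → ∑ (allSubsets n) (λ S → 𝟙 (I ≡ S)) ℕ.≤ 1
  allSubsets-unique [] = ≡.subst (ℕ._≤ 1) (≡.sym (ℕ.+-identityʳ _)) 𝟙≤1
  allSubsets-unique {suc n} (b ∷ I) = ℕ.≤-trans (ℕ.≤-reflexive (∑-allSubsets-suc n _)) (split b)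
    where
    same : ∀ b → ∑ (allSubsets n) (λ S → 𝟙 (b ∷ I ≡ b ∷ S)) ℕ.≤ 1
    same b = ℕ.≤-trans (∑-mono (allSubsets n) (λ S → 𝟙-mono ∷-injectiveʳ)) (allSubsets-unique I)
    different : ∀ {b c} → ¬ b ≡ c → ∑ (allSubsets n) (λ S → 𝟙 (b ∷ I ≡ c ∷ S)) ≡ 0
    different b≢c = ≡.trans (∑-cong (allSubsets n) (λ S → 𝟙-no (λ { ≡.refl → b≢c ≡.refl }))) (∑-zero (allSubsets n))
    split : ∀ b → ∑ (allSubsets n) (λ S → 𝟙 (b ∷ I ≡ false ∷ S)) ℕ.+ ∑ (allSubsets n) (λ S → 𝟙 (b ∷ I ≡ true ∷ S)) ℕ.≤ 1
    split false = ℕ.≤-trans (ℕ.+-mono-≤ (same false) (ℕ.≤-reflexive (different λ ()))) ℕ.≤-refl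
    split true  = ℕ.≤-trans (ℕ.+-mono-≤ (ℕ.≤-reflexive (different λ ())) (same true)) ℕ.≤-refl

  module _ {n : ℕ} (G : Graph n) where

    open Graph G

    total : (Subset n → Carrier) → Carrier
    total = sumOver (allSubsets n)

    private
      Value : Carrier → Set
      Value x = ∃[ w ] (IsFractionalColouring G w × x ≈ total w)

      Value-resp : ∀ {x y} → x ≈ y → Value x → Value y
      Value-resp x≈y (w , c , x≈) = w , c , trans (sym x≈y) x≈

      Value-nonneg : ∀ x → Value x → 0# ≤ x
      Value-nonneg x (w , c , x≈) =
        ≤-trans (0≤sumOver (allSubsets n) (IsFractionalColouring.nonneg c)) (≈⇒≤ (sym x≈))

    χᶠ≤total : ∀ {w} → IsFractionalColouring G w → χᶠ G ≤ total w
    χᶠ≤total c = inf-lower (_ , c , refl) Value-nonneg Value-resp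

    module Cover (m : ℕ) (0<m : 0 ℕ.< m) (ℐ : List (Subset n)) (independent : All (IsIndependent G) ℐ)
                 (covered : ∀ v → v ∈ V → m ℕ.≤ multiplicity ℐ v) where

      private
        count : Subset n → ℕ
        count S = ∑ ℐ (λ I → 𝟙 (I ≡ S))

        0<m′ : 0# < fromℕ m
        0<m′ = fromℕ-mono-< 0<m

      colouring : Subset n → Carrier
      colouring S = fromℕ (count S) / fromℕ m

      sum-colouring : ∀ xs → sumOver xs colouring ≈ fromℕ (∑ xs count) / fromℕ m
      sum-colouring xs = trans (sumOver-*ʳ xs (fromℕ m ⁻¹) (fromℕ ∘ count)) (*-congʳ (sym (fromℕ-∑ xs count)))

      isFractionalColouring : IsFractionalColouring G colouring
      isFractionalColouring = record
        { nonneg  = λ S → 0≤/ (0≤fromℕ (count S)) 0<m′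
        ; support = λ S dependent → trans (*-congʳ (reflexive (≡.cong fromℕ (unused dependent)))) (zeroˡ _)
        ; covers  = λ v v∈ → ≤-trans
            (x*z≤y⇒x≤y/z 0<m′ (≤-trans (≈⇒≤ (*-identityˡ _)) (fromℕ-mono-≤ (ℕ.≤-trans (covered v v∈) (chosen v)))))
            (≈⇒≤ (sym (sum-colouring (filter (v ∈?_) (allSubsets n)))))
        }
        where
        unused : ∀ {S} → ¬ IsIndependent G S → count S ≡ 0
        unused {S} dependent = ℕ.n≤0⇒n≡0 (ℕ.≤-trans
          (∑-mono-All {g = λ _ → 0} (All.map (λ {I} ind → ℕ.≤-reflexive (𝟙-no (λ I≡S → dependent (≡.subst (IsIndependent G) I≡S ind)))) independent))
          (ℕ.≤-reflexive (∑-zero ℐ)))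
        chosen : ∀ v → multiplicity ℐ v ℕ.≤ ∑ (filter (v ∈?_) (allSubsets n)) count
        chosen v = ℕ.≤-trans
          (∑-mono ℐ (λ I → 𝟙-≤ (λ v∈I → ℕ.≤-trans (ℕ.≤-reflexive (≡.sym (𝟙-yes {I ≡ I} ≡.refl)))
            (∑-∈ (λ S → 𝟙 (I ≡ S)) (∈-filter⁺ (v ∈?_) (∈-allSubsets I) v∈I)))))
          (ℕ.≤-reflexive (∑-swap ℐ (filter (v ∈?_) (allSubsets n)) _))

      χᶠ≤ : χᶠ G ≤ fromℕ (length ℐ) / fromℕ m
      χᶠ≤ = ≤-trans (χᶠ≤total isFractionalColouring) (≤-trans (≈⇒≤ (sum-colouring (allSubsets n)))
        (*-monoˡ-≤ (inj₁ (0<⁻¹ 0<m′)) (fromℕ-mono-≤ (ℕ.≤-trans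
          (ℕ.≤-reflexive (∑-swap (allSubsets n) ℐ _))
          (ℕ.≤-trans (∑-mono ℐ allSubsets-unique) (ℕ.≤-reflexive (≡.trans (∑-const ℐ 1) (ℕ.*-identityʳ (length ℐ)))))))))

    private
      -- Their colouring shows that the infimum defining `χᶠ` is over an inhabited set, and its
      -- value gives the bound `n` that the supremum defining `hᶠ` requires.
      singletons : List (Subset n)
      singletons = map ⁅_⁆ (filter (_∈? V) (allFin n))

      singleton-independent : ∀ {v} → v ∈ V → IsIndependent G ⁅ v ⁆
      singleton-independent {v} v∈V =
        (λ {u} u∈ → ≡.subst (_∈ V) (≡.sym (x∈⁅y⁆⇒x≡y v u∈)) v∈V) ,
        λ {u} {u′} u∈ u′∈ e → adj-irrefl (≡.subst₂ Adj (x∈⁅y⁆⇒x≡y v u∈) (x∈⁅y⁆⇒x≡y v u′∈) e)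

      module Trivial = Cover 1 (ℕ.s≤s ℕ.z≤n) singletons
        (All.map⁺ (All.tabulate (λ v∈ → singleton-independent (proj₂ (∈-filter⁻ (_∈? V) {xs = allFin n} v∈)))))
        (λ v v∈V → ℕ.≤-trans (ℕ.≤-reflexive (≡.sym (𝟙-yes (x∈⁅x⁆ v))))
          (∑-∈ (λ I → 𝟙 (v ∈ I)) (∈-map⁺ ⁅_⁆ (∈-filter⁺ (_∈? V) (∈-allFin v) v∈V))))

    χᶠ≤n : χᶠ G ≤ fromℕ n
    χᶠ≤n = ≤-trans Trivial.χᶠ≤ (x≤y*z⇒x/z≤y (0<fromℕ 1) (≤-trans
      (fromℕ-mono-≤ (ℕ.≤-trans (ℕ.≤-reflexive (length-map ⁅_⁆ (filter (_∈? V) (allFin n))))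
        (ℕ.≤-trans (length-filter (_∈? V) (allFin n)) (ℕ.≤-reflexive (length-tabulate {n = n} (λ v → v))))))
      (≈⇒≤ (sym (trans (*-congˡ fromℕ-1) (*-identityʳ _))))))

    ≤χᶠ : ∀ {x} → (∀ w → IsFractionalColouring G w → x ≤ total w) → x ≤ χᶠ G
    ≤χᶠ lower = inf-greatest (_ , Trivial.isFractionalColouring , refl)
      (λ { y (w , c , y≈) → ≤-trans (lower w c) (≈⇒≤ (sym y≈)) }) Value-resp

    0≤χᶠ : 0# ≤ χᶠ G
    0≤χᶠ = ≤χᶠ (λ w c → 0≤sumOver (allSubsets n) (IsFractionalColouring.nonneg c))

    -- Weak duality by double counting: the independent sets of a fractional colouring together
    -- cover the weight of `V`, and each carries at most a share 1/A of it.
    weighting⇒≤χᶠ : ∀ (w : Fin n → ℕ) A → (let open Weighted G w) → 0 ℕ.< wt (_∈ V) →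
      (∀ S → IsIndependent G S → A ℕ.* wt (_∈ S) ℕ.≤ wt (_∈ V)) → fromℕ A ≤ χᶠ G
    weighting⇒≤χᶠ w A 0<wt light = ≤χᶠ λ y c →
      *-cancelʳ-≤ (fromℕ-mono-< 0<wt) (begin
        fromℕ A * fromℕ (wt (_∈ V))
          ≤⟨ *-monoʳ-≤ (0≤fromℕ A) (wtV≤ y c) ⟩
        fromℕ A * total (λ S → y S * fromℕ (wt (_∈ S)))
          ≈⟨ sumOver-*ˡ (allSubsets n) (fromℕ A) _ ⟨
        total (λ S → fromℕ A * (y S * fromℕ (wt (_∈ S))))
          ≤⟨ sumOver-mono-≤ (allSubsets n) (light′ y c) ⟩
        total (λ S → y S * fromℕ (wt (_∈ V)))
          ≈⟨ sumOver-*ʳ (allSubsets n) _ y ⟩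
        total y * fromℕ (wt (_∈ V)) ∎)
      where
      open Weighted G w
      light′ : ∀ y → IsFractionalColouring G y → ∀ S →
               fromℕ A * (y S * fromℕ (wt (_∈ S))) ≤ y S * fromℕ (wt (_∈ V))
      light′ y c S with lem (IsIndependent G S)
      ... | yes ind = begin
        fromℕ A * (y S * fromℕ (wt (_∈ S)))
          ≈⟨ solve 3 (λ a y s → a :* (y :* s) := y :* (a :* s)) refl (fromℕ A) (y S) (fromℕ (wt (_∈ S))) ⟩
        y S * (fromℕ A * fromℕ (wt (_∈ S)))
          ≈⟨ *-congˡ (fromℕ-* A (wt (_∈ S))) ⟨
        y S * fromℕ (A ℕ.* wt (_∈ S))
          ≤⟨ *-monoʳ-≤ (IsFractionalColouring.nonneg c S) (fromℕ-mono-≤ (light S ind)) ⟩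
        y S * fromℕ (wt (_∈ V)) ∎
      ... | no dep = ≈⇒≤ (trans (*-congˡ (trans (*-congʳ y≈0) (zeroˡ _)))
                       (trans (zeroʳ _) (sym (trans (*-congʳ y≈0) (zeroˡ _)))))
        where
        y≈0 : y S ≈ 0#
        y≈0 = IsFractionalColouring.support c S dep
      wtV≤ : ∀ y → IsFractionalColouring G y → fromℕ (wt (_∈ V)) ≤ total (λ S → y S * fromℕ (wt (_∈ S)))
      wtV≤ y c = begin
        fromℕ (wt (_∈ V))
          ≈⟨ fromℕ-∑ (allFin n) _ ⟩
        sumOver (allFin n) (λ v → fromℕ (w v ℕ.* 𝟙 (v ∈ V)))
          ≤⟨ sumOver-mono-≤ (allFin n) (λ v → vertex v (v ∈? V)) ⟩
        sumOver (allFin n) (λ v → total (λ S → y S * fromℕ (w v ℕ.* 𝟙 (v ∈ S))))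
          ≈⟨ sumOver-swap (allFin n) (allSubsets n) _ ⟩
        total (λ S → sumOver (allFin n) (λ v → y S * fromℕ (w v ℕ.* 𝟙 (v ∈ S))))
          ≈⟨ sumOver-cong (allSubsets n) (λ S → trans (sumOver-*ˡ (allFin n) (y S) _)
               (*-congˡ (sym (fromℕ-∑ (allFin n) _)))) ⟩
        total (λ S → y S * fromℕ (wt (_∈ S))) ∎
        where
        vertex : ∀ v → Dec (v ∈ V) → fromℕ (w v ℕ.* 𝟙 (v ∈ V)) ≤ total (λ S → y S * fromℕ (w v ℕ.* 𝟙 (v ∈ S)))
        vertex v (no v∉V) = ≤-trans
          (≈⇒≤ (reflexive (≡.cong fromℕ (≡.trans (≡.cong (w v ℕ.*_) (𝟙-no v∉V)) (ℕ.*-zeroʳ (w v))))))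
          (0≤sumOver (allSubsets n) (λ S → 0≤* (IsFractionalColouring.nonneg c S) (0≤fromℕ (w v ℕ.* 𝟙 (v ∈ S)))))
        vertex v (yes v∈V) = begin
          fromℕ (w v ℕ.* 𝟙 (v ∈ V))
            ≈⟨ reflexive (≡.cong fromℕ (≡.trans (≡.cong (w v ℕ.*_) (𝟙-yes v∈V)) (ℕ.*-identityʳ (w v)))) ⟩
          fromℕ (w v)
            ≈⟨ *-identityʳ _ ⟨
          fromℕ (w v) * 1#
            ≤⟨ *-monoʳ-≤ (0≤fromℕ (w v)) (IsFractionalColouring.covers c v v∈V) ⟩
          fromℕ (w v) * sumOver (filter (v ∈?_) (allSubsets n)) y
            ≈⟨ *-congˡ (sumOver-filter (v ∈?_) (allSubsets n) y) ⟩
          fromℕ (w v) * total (λ S → fromℕ (𝟙 (v ∈ S)) * y S)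
            ≈⟨ sumOver-*ˡ (allSubsets n) (fromℕ (w v)) _ ⟨
          total (λ S → fromℕ (w v) * (fromℕ (𝟙 (v ∈ S)) * y S))
            ≈⟨ sumOver-cong (allSubsets n) (λ S → trans
                 (solve 3 (λ a b c → a :* (b :* c) := c :* (a :* b)) refl (fromℕ (w v)) (fromℕ (𝟙 (v ∈ S))) (y S))
                 (*-congˡ (sym (fromℕ-* (w v) (𝟙 (v ∈ S)))))) ⟩
          total (λ S → y S * fromℕ (w v ℕ.* 𝟙 (v ∈ S))) ∎

  -- From duality to a lower bound for `hᶠ`.

  χᶠ≤hᶠ : ∀ {n} r (G F : Graph n) → F ⊆ᴳ G → Girth≥ r F → χᶠ F ≤ hᶠ r G
  χᶠ≤hᶠ {n} r G F F⊆G girth = sup-upper (χᶠ F , F , F⊆G , girth , refl)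
    (fromℕ n , λ { x (H , _ , _ , x≈) → ≤-trans (≈⇒≤ x≈) (χᶠ≤n H) }) (χᶠ F) (F , F⊆G , girth , refl)

  -- A value above 4L rules out the covering alternative of `dual-or-cover`, so a light weighting
  -- exists; restricted to the sparse subgraph, it certifies `A`.
  sparse-bound : ∀ {n} (G : Graph n) (r : ℕ) .⦃ _ : ℕ.NonZero r ⦄ (𝒦 : List (Subset n)) →
    IsCycleCliqueCover r G 𝒦 → ∀ B N → localOverlap G 𝒦 ℕ.≤ B → All (λ K → ∣ K ∣ ℕ.≤ N) 𝒦 →
    ∀ q′ → (∀ k → 3 ℕ.+ k ℕ.< r → 4 ℕ.* r ℕ.* B ℕ.* N ℕ.^ (2 ℕ.+ k) ℕ.≤ suc q′ ℕ.^ (3 ℕ.+ k)) →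
    ∀ l κ A .⦃ _ : ℕ.NonZero κ ⦄ → 4 ℕ.* suc l ℕ.≤ 2 ℕ.^ κ → 64 ℕ.* A ℕ.* (suc q′ ℕ.* κ) ℕ.≤ suc l →
    fromℕ (4 ℕ.* suc l) < χᶠ G → fromℕ A ≤ hᶠ r G
  sparse-bound G r 𝒦 cover B N overlap≤B small q′ sparse l κ A 4L≤2^κ 64Aqκ≤L 4L<χ
    with Duality.dual-or-cover G l
  ... | inj₁ (w , supported , light) =
    let (F , F⊆G , girth , 0<wt , light-F) = SparseSubgraph.sparse-subgraph G w supported r 𝒦 cover B N
          (λ v → ℕ.≤-trans (local-overlap G 𝒦 (proj₁ cover) v) overlap≤B) small q′ sparse
          (suc l) κ A 4L≤2^κ 64Aqκ≤L light
    in ≤-trans (weighting⇒≤χᶠ F w A 0<wt light-F) (χᶠ≤hᶠ r G F F⊆G girth)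
  ... | inj₂ (m , 0<m , ℐ , independent , len , covered) =
    contradiction 4L<χ (≤⇒≯ (≤-trans (Cover.χᶠ≤ G m 0<m ℐ independent covered)
      (x≤y*z⇒x/z≤y {x = fromℕ (length ℐ)} {y = fromℕ (4 ℕ.* suc l)} (fromℕ-mono-< 0<m)
        (≈⇒≤ (trans (reflexive (≡.cong fromℕ len)) (fromℕ-* (4 ℕ.* suc l) m))))))

  -- Asymptotics

  2^-bracket : ∀ m → 2 ℕ.≤ m → ∃[ κ ] (2 ℕ.^ κ ℕ.< m × m ℕ.≤ 2 ℕ.^ suc κ)
  2^-bracket m 2≤m = search m (ℕ.≤-trans (ℕ.<⇒≤ (1+d≤2^d m)) (ℕ.^-monoʳ-≤ 2 (ℕ.n≤1+n m)))
    where
    search : ∀ f → m ℕ.≤ 2 ℕ.^ suc f → ∃[ κ ] (2 ℕ.^ κ ℕ.< m × m ℕ.≤ 2 ℕ.^ suc κ)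
    search zero    m≤ = 0 , 2≤m , m≤
    search (suc f) m≤ with m ℕ.≤? 2 ℕ.^ suc f
    ... | yes m≤′ = search f m≤′
    ... | no m≰   = suc f , ℕ.≰⇒> m≰ , m≤

  division : ∀ L D .⦃ _ : ℕ.NonZero D ⦄ → ∃[ A ] (64 ℕ.* A ℕ.* D ℕ.≤ L × L ℕ.≤ 64 ℕ.* suc A ℕ.* D)
  division L D = A , lower , upper
    where
    instance
      64D≢0 : ℕ.NonZero (64 ℕ.* D)
      64D≢0 = ℕ.m*n≢0 64 D
    A : ℕ
    A = L ℕ./ (64 ℕ.* D)
    L≡ : L ≡ L ℕ.% (64 ℕ.* D) ℕ.+ A ℕ.* (64 ℕ.* D)
    L≡ = ℕ.m≡m%n+[m/n]*n L (64 ℕ.* D)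
    eq : ∀ s A D → s ℕ.* A ℕ.* D ≡ A ℕ.* (s ℕ.* D)
    eq = solve-∀
    lower : 64 ℕ.* A ℕ.* D ℕ.≤ L
    lower = ℕ.≤-trans (ℕ.≤-reflexive (eq 64 A D)) (ℕ.≤-trans (ℕ.m≤n+m _ (L ℕ.% (64 ℕ.* D))) (ℕ.≤-reflexive (≡.sym L≡)))
    upper : L ℕ.≤ 64 ℕ.* suc A ℕ.* D
    upper = ℕ.≤-trans (ℕ.≤-reflexive L≡) (ℕ.≤-trans (ℕ.+-monoˡ-≤ (A ℕ.* (64 ℕ.* D)) (ℕ.<⇒≤ (ℕ.m%n<n L (64 ℕ.* D))))
      (ℕ.≤-reflexive (≡.sym (eq 64 (suc A) D))))

  -- The asymptotics secure only the longest cycle length. To lower the exponent, divide by `N` if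
  -- `q ≤ N`; otherwise `C ≤ N < q` gives the inequality directly.
  descent : ∀ C N q → 1 ℕ.≤ N → C ℕ.≤ N → ∀ d i →
            C ℕ.* N ℕ.^ (d ℕ.+ i) ℕ.≤ q ℕ.^ suc (d ℕ.+ i) → C ℕ.* N ℕ.^ i ℕ.≤ q ℕ.^ suc i
  descent C N q 1≤N C≤N zero i le = le
  descent C N q 1≤N C≤N (suc d) i le = descent C N q 1≤N C≤N d i (lower (ℕ.≤-<-connex q N))
    where
    k : ℕ
    k = d ℕ.+ i
    eq : ∀ c x y → c ℕ.* x ℕ.* y ≡ c ℕ.* (y ℕ.* x)
    eq = solve-∀
    lower : q ℕ.≤ N ⊎ N ℕ.< q → C ℕ.* N ℕ.^ k ℕ.≤ q ℕ.^ suc k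
    lower (inj₁ q≤N) = ℕ.*-cancelʳ-≤ _ _ N ⦃ ℕ.>-nonZero 1≤N ⦄ (ℕ.≤-trans (ℕ.≤-reflexive (eq C (N ℕ.^ k) N))
      (ℕ.≤-trans le (ℕ.≤-trans (ℕ.*-monoˡ-≤ (q ℕ.^ suc k) q≤N) (ℕ.≤-reflexive (ℕ.*-comm N _)))))
    lower (inj₂ N<q) = ℕ.*-mono-≤ (ℕ.≤-trans C≤N (ℕ.<⇒≤ N<q)) (ℕ.^-monoˡ-≤ k (ℕ.<⇒≤ N<q))

  _∧ᵉ_ : {P Q : ℕ → Set} → Eventually P → Eventually Q → Eventually (λ N → P N × Q N)
  (M , p) ∧ᵉ (N , q) = M ℕ.⊔ N , λ k le →
    p k (ℕ.≤-trans (ℕ.m≤m⊔n M N) le) , q k (ℕ.≤-trans (ℕ.m≤n⊔m M N) le)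

  mapᵉ : {P Q : ℕ → Set} → (∀ N → P N → Q N) → Eventually P → Eventually Q
  mapᵉ f (N₀ , p) = N₀ , λ N le → f N (p N le)

  0≤log : ∀ {N} → 1 ℕ.≤ N → 0# ≤ log (fromℕ N)
  0≤log {N} 1≤N = ≤-trans (≈⇒≤ (sym (zeroˡ ½))) (2^k≤⇒k/2≤log (0≤fromℕ N) {0} (fromℕ-mono-≤ 1≤N))

  log-unbounded : TendsTo∞ (λ N → log (fromℕ N))
  log-unbounded M with archimedean (M * fromℕ 2)
  ... | k , 2M<k = 2 ℕ.^ k , λ N 2^k≤N →
    ≤-trans (x*z≤y⇒x≤y/z 0<2 (inj₁ 2M<k)) (2^k≤⇒k/2≤log (0≤fromℕ N) {k} (fromℕ-mono-≤ 2^k≤N))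

  module _ (j : ℕ) {δ : Carrier} (0<δ : 0# < δ) (δ<1/J : δ < 1# / fromℕ (suc j)) where

    private
      -- `J` is r - 1, the greatest length below r, and `η` is the surplus in (1 - δ) J = j + η; it
      -- is positive exactly because δ < 1/J.
      J η : Carrier
      J = fromℕ (suc j)
      η = 1# + J * - δ

      0<J : 0# < J
      0<J = 0<fromℕ (suc j)

      Jδ<1 : J * δ < 1#
      Jδ<1 = <-respʳ-≈ (trans (*-comm J _) (/-*-cancelʳ 1# 0<J)) (*-monoʳ-< 0<J δ<1/J)

      0<η : 0# < η
      0<η = <-respʳ-≈ (+-congˡ (-‿distribʳ-* J δ)) (0<y-x Jδ<1)

    0≤1-δ : 0# ≤ 1# + - δ
    0≤1-δ = 0≤y-x (≤-trans (≤-trans (≈⇒≤ (sym (*-identityˡ δ)))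
      (*-monoˡ-≤ (inj₁ 0<δ) (≤-trans (≈⇒≤ (sym fromℕ-1)) (fromℕ-mono-≤ (ℕ.s≤s (ℕ.z≤n {j})))))) (inj₁ Jδ<1))

    -- With ℓ = log N, the two sides grow like exp (j ℓ) and exp (j ℓ + η ℓ).
    power-bound : ∀ C → Eventually (λ N →
      fromℕ C * fromℕ N Exp.^ j ≤ exp ((1# + - δ) * log (fromℕ N)) Exp.^ suc j)
    power-bound C = mapᵉ bound (log-unbounded (D / η) ∧ᵉ (1 , λ N 1≤N → 1≤N))
      where
      D : Carrier
      D = fromℕ C * exp 1# Exp.^ j
      bound : ∀ N → (D / η ≤ log (fromℕ N)) × (1 ℕ.≤ N) →
        fromℕ C * fromℕ N Exp.^ j ≤ exp ((1# + - δ) * log (fromℕ N)) Exp.^ suc j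
      bound N (large , 1≤N) = begin
        fromℕ C * fromℕ N Exp.^ j
          ≤⟨ *-monoʳ-≤ (0≤fromℕ C) (^-mono-≤ j (0≤fromℕ N) (inj₁ (<exp-log+1 {fromℕ N} (0≤fromℕ N)))) ⟩
        fromℕ C * exp (ℓ + 1#) Exp.^ j
          ≈⟨ *-congˡ (trans (Exp.^-congˡ j (exp-+ 0≤ℓ 0≤1)) (CExp.^-distrib-* (exp ℓ) (exp 1#) j)) ⟩
        fromℕ C * (exp ℓ Exp.^ j * exp 1# Exp.^ j)
          ≈⟨ solve 3 (λ c x y → c :* (x :* y) := x :* (c :* y)) refl (fromℕ C) (exp ℓ Exp.^ j) (exp 1# Exp.^ j) ⟩
        exp ℓ Exp.^ j * D
          ≤⟨ *-monoʳ-≤ (0≤^ j (inj₁ (0<exp 0≤ℓ))) D≤ ⟩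
        exp ℓ Exp.^ j * exp (η * ℓ)
          ≈⟨ *-congʳ (exp-^ 0≤ℓ j) ⟨
        exp (fromℕ j * ℓ) * exp (η * ℓ)
          ≈⟨ exp-+ 0≤jℓ 0≤ηℓ ⟨
        exp (fromℕ j * ℓ + η * ℓ)
          ≈⟨ exp-cong (0≤+ 0≤jℓ 0≤ηℓ) (solve 3 (λ j d l →
               j :* l :+ (con 1 :+ (con 1 :+ j) :* d) :* l := (con 1 :+ j) :* ((con 1 :+ d) :* l)) refl (fromℕ j) (- δ) ℓ) ⟩
        exp (J * ((1# + - δ) * ℓ))
          ≈⟨ exp-^ (0≤* 0≤1-δ 0≤ℓ) (suc j) ⟩
        exp ((1# + - δ) * ℓ) Exp.^ suc j ∎
        where
        ℓ : Carrier
        ℓ = log (fromℕ N)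
        0≤ℓ : 0# ≤ ℓ
        0≤ℓ = 0≤log 1≤N
        0≤jℓ : 0# ≤ fromℕ j * ℓ
        0≤jℓ = 0≤* (0≤fromℕ j) 0≤ℓ
        0≤ηℓ : 0# ≤ η * ℓ
        0≤ηℓ = 0≤* (inj₁ 0<η) 0≤ℓ
        D≤ : D ≤ exp (η * ℓ)
        D≤ = begin
          D             ≈⟨ /-*-cancelʳ D 0<η ⟨
          D / η * η     ≤⟨ *-monoˡ-≤ (inj₁ 0<η) large ⟩
          ℓ * η         ≈⟨ *-comm ℓ η ⟩
          η * ℓ         ≤⟨ x≤y+x 0≤1 ⟩
          1# + η * ℓ    ≤⟨ 1+x≤exp 0≤ηℓ ⟩
          exp (η * ℓ)   ∎

  -- 8 = 2 * 4 comes from q ≤ 2 E and κ ≤ 4 log t, the rest from t ≤ 16 L and L ≤ 64 (1 + A) q κ.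
  K₀ : Carrier
  K₀ = fromℕ 8 * (fromℕ 16 * fromℕ 64)

  -- The doubling pays for 1 + A ≤ 2A once `A` is positive.
  K : Carrier
  K = K₀ + K₀

  0<K₀ : 0# < K₀
  0<K₀ = *-pos (0<fromℕ 8) (*-pos (0<fromℕ 16) (0<fromℕ 64))

  0<K : 0# < K
  0<K = <-≤-trans 0<K₀ (x≤x+y (inj₁ 0<K₀))

  -- `E` stands for N^(1-δ) and `p` for N^(δ-1); the only link between them is `p≤1/E`.
  module _ {n : ℕ} (G : Graph n) (j : ℕ) (𝒦 : List (Subset n)) (B N : ℕ) (p E : Carrier) where

    private
      r C : ℕ
      r = 2 ℕ.+ j
      C = 4 ℕ.* r ℕ.* B

      t X : Carrier
      t = χᶠ G
      X = (p * t) / log t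

    module _ (cover : IsCycleCliqueCover r G 𝒦) (overlap≤B : localOverlap G 𝒦 ℕ.≤ B)
             (small : All (λ K → ∣ K ∣ ℕ.≤ N) 𝒦) (1≤N : 1 ℕ.≤ N) (C≤N : C ℕ.≤ N) (1≤E : 1# ≤ E) (p≤1/E : p ≤ E ⁻¹)
             (power : fromℕ C * fromℕ N Exp.^ j ≤ E Exp.^ suc j) (8≤t : fromℕ 8 ≤ t) (K₀<X : K₀ < X) where

      -- Integer parameters: `q` is one more than the floor of `E`, `L` the floor of t/8, `κ` the
      -- binary logarithm of 4L rounded up, and `A` the quotient of `L` by 64 q κ.
      module Rounded
        (q′ : ℕ) (q′≤E : fromℕ q′ ≤ E) (E<q : E < fromℕ (suc q′))
        (l : ℕ) (L≤t/8 : fromℕ (suc l) ≤ t / fromℕ 8) (t/8<1+L : t / fromℕ 8 < fromℕ (suc (suc l)))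
        (κ′ : ℕ) (2^κ′<4L : 2 ℕ.^ κ′ ℕ.< 4 ℕ.* suc l) (4L≤2^κ : 4 ℕ.* suc l ℕ.≤ 2 ℕ.^ suc κ′)
        (A : ℕ) (64Aqκ≤L : 64 ℕ.* A ℕ.* (suc q′ ℕ.* suc κ′) ℕ.≤ suc l)
        (L≤64[1+A]qκ : suc l ℕ.≤ 64 ℕ.* suc A ℕ.* (suc q′ ℕ.* suc κ′))
        where
        L q κ : ℕ
        L = suc l
        q = suc q′
        κ = suc κ′

        a : Carrier
        a = log t

        power′ : C ℕ.* N ℕ.^ j ℕ.≤ q ℕ.^ suc j
        power′ = fromℕ-cancel-≤ (begin
          fromℕ (C ℕ.* N ℕ.^ j)         ≈⟨ trans (fromℕ-* C (N ℕ.^ j)) (*-congˡ (fromℕ-^ N j)) ⟩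
          fromℕ C * fromℕ N Exp.^ j     ≤⟨ power ⟩
          E Exp.^ suc j                 ≤⟨ ^-mono-≤ (suc j) (≤-trans 0≤1 1≤E) (inj₁ E<q) ⟩
          fromℕ q Exp.^ suc j           ≈⟨ fromℕ-^ q (suc j) ⟨
          fromℕ (q ℕ.^ suc j)           ∎)

        sparse : ∀ k → 3 ℕ.+ k ℕ.< r → C ℕ.* N ℕ.^ (2 ℕ.+ k) ℕ.≤ q ℕ.^ (3 ℕ.+ k)
        sparse k 3+k<r = descent C N q 1≤N C≤N (j ℕ.∸ (2 ℕ.+ k)) (2 ℕ.+ k)
          (≡.subst (λ i → C ℕ.* N ℕ.^ i ℕ.≤ q ℕ.^ suc i) (≡.sym (ℕ.m∸n+n≡m (ℕ.s≤s⁻¹ (ℕ.s≤s⁻¹ 3+k<r)))) power′)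

        8L≤t : fromℕ (8 ℕ.* L) ≤ t
        8L≤t = begin
          fromℕ (8 ℕ.* L)       ≈⟨ trans (fromℕ-* 8 L) (*-comm _ _) ⟩
          fromℕ L * fromℕ 8     ≤⟨ *-monoˡ-≤ (0≤fromℕ 8) L≤t/8 ⟩
          t / fromℕ 8 * fromℕ 8 ≈⟨ /-*-cancelʳ t (0<fromℕ 8) ⟩
          t                     ∎

        t≤16L : t ≤ fromℕ 16 * fromℕ L
        t≤16L = begin
          t                        ≈⟨ /-*-cancelʳ t (0<fromℕ 8) ⟨
          t / fromℕ 8 * fromℕ 8    ≤⟨ *-monoˡ-≤ (0≤fromℕ 8) (inj₁ t/8<1+L) ⟩
          fromℕ (suc L) * fromℕ 8  ≈⟨ fromℕ-* (suc L) 8 ⟨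
          fromℕ (suc L ℕ.* 8)      ≤⟨ fromℕ-mono-≤ (ℕ.≤-trans (ℕ.*-monoˡ-≤ 8 (ℕ.+-monoˡ-≤ L (ℕ.s≤s (ℕ.z≤n {l})))) (ℕ.≤-reflexive (eq L))) ⟩
          fromℕ (16 ℕ.* L)         ≈⟨ fromℕ-* 16 L ⟩
          fromℕ 16 * fromℕ L       ∎
          where
          eq : ∀ L → (L ℕ.+ L) ℕ.* 8 ≡ 16 ℕ.* L
          eq = solve-∀

        -- Dividing `t` by 8 leaves room for the strict inequality that `sparse-bound` demands.
        4L<t : fromℕ (4 ℕ.* L) < t
        4L<t = <-≤-trans (fromℕ-mono-< (ℕ.*-monoˡ-< L (ℕ.s≤s (ℕ.s≤s (ℕ.s≤s (ℕ.s≤s (ℕ.s≤s (ℕ.z≤n {3})))))))) 8L≤t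

        A≤h : fromℕ A ≤ hᶠ r G
        A≤h = sparse-bound G r 𝒦 cover B N overlap≤B small q′ sparse l κ A 4L≤2^κ 64Aqκ≤L 4L<t

        q≤2E : fromℕ q ≤ fromℕ 2 * E
        q≤2E = ≤-trans (+-mono-≤ 1≤E q′≤E)
          (≈⇒≤ (solve 1 (λ e → e :+ e := (con 1 :+ (con 1 :+ con 0)) :* e) refl E))

        κ≤2κ′ : κ ℕ.≤ κ′ ℕ.* 2
        κ≤2κ′ = lemma κ′ (ℕ.≤-trans (ℕ.m≤m*n 4 L) 4L≤2^κ)
          where
          lemma : ∀ κ′ → 4 ℕ.≤ 2 ℕ.^ suc κ′ → suc κ′ ℕ.≤ κ′ ℕ.* 2
          lemma zero    (ℕ.s≤s (ℕ.s≤s ()))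
          lemma (suc k) _ = ℕ.s≤s (ℕ.s≤s (ℕ.m≤m*n k 2))

        -- From 2^κ′ < 4L < t comes κ′ / 2 ≤ log t; passing from `κ` to `κ′` costs the other factor
        -- 2.
        κ≤4a : fromℕ κ ≤ fromℕ 4 * a
        κ≤4a = begin
          fromℕ κ                           ≤⟨ fromℕ-mono-≤ κ≤2κ′ ⟩
          fromℕ (κ′ ℕ.* 2)                  ≈⟨ fromℕ-* κ′ 2 ⟩
          fromℕ κ′ * fromℕ 2                ≈⟨ *-congʳ (/-*-cancelʳ (fromℕ κ′) 0<2) ⟨
          fromℕ κ′ / fromℕ 2 * fromℕ 2 * fromℕ 2
            ≤⟨ *-monoˡ-≤ (0≤fromℕ 2) (*-monoˡ-≤ (0≤fromℕ 2) (2^k≤⇒k/2≤log (0≤χᶠ G) {κ′}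
                 (≤-trans (fromℕ-mono-≤ (ℕ.<⇒≤ 2^κ′<4L)) (inj₁ 4L<t)))) ⟩
          a * fromℕ 2 * fromℕ 2             ≈⟨ trans (*-assoc a _ _) (trans (*-congˡ (sym (fromℕ-* 2 2))) (*-comm a _)) ⟩
          fromℕ 4 * a                       ∎

        0<a : 0# < a
        0<a with ≤-or-> a 0#
        ... | inj₂ 0<a = 0<a
        ... | inj₁ a≤0 = contradiction (0<fromℕ κ) (≤⇒≯ (≤-trans κ≤4a
                           (≤-trans (*-monoʳ-≤ (0≤fromℕ 4) a≤0) (≈⇒≤ (zeroʳ _)))))

        0<E : 0# < E
        0<E = <-≤-trans 0<1 1≤E

        0≤X : 0# ≤ X
        0≤X = inj₁ (<-trans 0<K₀ K₀<X)

        XaE≤t : X * a * E ≤ t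
        XaE≤t = begin
          X * a * E        ≈⟨ *-congʳ (/-*-cancelʳ (p * t) 0<a) ⟩
          p * t * E        ≤⟨ *-monoˡ-≤ (inj₁ 0<E) (*-monoˡ-≤ (0≤χᶠ G) p≤1/E) ⟩
          E ⁻¹ * t * E     ≈⟨ solve 3 (λ e t f → e :* t :* f := e :* f :* t) refl (E ⁻¹) t E ⟩
          E ⁻¹ * E * t     ≈⟨ trans (*-congʳ (⁻¹-* 0<E)) (*-identityˡ t) ⟩
          t                ∎

        X≤K₀[1+A] : X ≤ K₀ * fromℕ (suc A)
        X≤K₀[1+A] = *-cancelˡ-≤ (0<fromℕ (q ℕ.* κ)) (begin
          fromℕ (q ℕ.* κ) * X
            ≤⟨ *-monoˡ-≤ 0≤X (≤-trans (≈⇒≤ (fromℕ-* q κ)) (*-mono-≤ (0≤fromℕ q) (0≤* (0≤fromℕ 4) (inj₁ 0<a)) q≤2E κ≤4a)) ⟩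
          fromℕ 2 * E * (fromℕ 4 * a) * X
            ≈⟨ solve 5 (λ s e f a x → s :* e :* (f :* a) :* x := s :* f :* (x :* a :* e)) refl (fromℕ 2) E (fromℕ 4) a X ⟩
          fromℕ 2 * fromℕ 4 * (X * a * E)
            ≤⟨ *-mono-≤ (0≤* (0≤fromℕ 2) (0≤fromℕ 4)) (0≤χᶠ G) (≈⇒≤ (sym (fromℕ-* 2 4))) XaE≤t ⟩
          fromℕ 8 * t
            ≤⟨ *-monoʳ-≤ (0≤fromℕ 8) t≤16L ⟩
          fromℕ 8 * (fromℕ 16 * fromℕ L)
            ≤⟨ *-monoʳ-≤ (0≤fromℕ 8) (*-monoʳ-≤ (0≤fromℕ 16) (fromℕ-mono-≤ L≤64[1+A]qκ)) ⟩
          fromℕ 8 * (fromℕ 16 * fromℕ (64 ℕ.* suc A ℕ.* (q ℕ.* κ)))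
            ≈⟨ *-congˡ (*-congˡ (trans (fromℕ-* (64 ℕ.* suc A) (q ℕ.* κ)) (*-congʳ (fromℕ-* 64 (suc A))))) ⟩
          fromℕ 8 * (fromℕ 16 * (fromℕ 64 * fromℕ (suc A) * fromℕ (q ℕ.* κ)))
            ≈⟨ solve 5 (λ x y z a d → x :* (y :* (z :* a :* d)) := d :* (x :* (y :* z) :* a)) refl
                 (fromℕ 8) (fromℕ 16) (fromℕ 64) (fromℕ (suc A)) (fromℕ (q ℕ.* κ)) ⟩
          fromℕ (q ℕ.* κ) * (K₀ * fromℕ (suc A)) ∎)

        -- For `A = 0` the previous bound would read X ≤ K₀, against `K₀<X`.
        1≤A : 1 ℕ.≤ A
        1≤A = ℕ.n≢0⇒n>0 λ A≡0 → ≤⇒≯ X≤K₀[1+A] (≤-<-trans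
          (≈⇒≤ (trans (*-congˡ (trans (reflexive (≡.cong (λ A → fromℕ (suc A)) A≡0)) fromℕ-1)) (*-identityʳ K₀))) K₀<X)

        X≤Kh : X ≤ K * hᶠ r G
        X≤Kh = begin
          X                             ≤⟨ X≤K₀[1+A] ⟩
          K₀ * fromℕ (suc A)            ≤⟨ *-monoʳ-≤ (inj₁ 0<K₀) (+-monoˡ-≤ (fromℕ A) (≤-trans (≈⇒≤ (sym fromℕ-1)) (fromℕ-mono-≤ 1≤A))) ⟩
          K₀ * (fromℕ A + fromℕ A)      ≈⟨ solve 2 (λ k a → k :* (a :+ a) := (k :+ k) :* a) refl K₀ (fromℕ A) ⟩
          K * fromℕ A           ≤⟨ *-monoʳ-≤ (inj₁ 0<K) A≤h ⟩
          K * hᶠ r G            ∎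

      large-hᶠ : X ≤ K * hᶠ r G
      large-hᶠ = from-q (floor (≤-trans 0≤1 1≤E))
        where
        from-κ : ∀ q′ l → fromℕ q′ ≤ E → E < fromℕ (suc q′) → fromℕ (suc l) ≤ t / fromℕ 8 →
          t / fromℕ 8 < fromℕ (suc (suc l)) →
          ∃[ κ ] (2 ℕ.^ κ ℕ.< 4 ℕ.* suc l × 4 ℕ.* suc l ℕ.≤ 2 ℕ.^ suc κ) → X ≤ K * hᶠ r G
        from-κ q′ l q′≤E E<q L≤ <1+L (κ′ , 2^κ′< , ≤2^κ) =
          let (A , lower , upper) = division (suc l) (suc q′ ℕ.* suc κ′)
          in Rounded.X≤Kh q′ q′≤E E<q l L≤ <1+L κ′ 2^κ′< ≤2^κ A lower upper
        from-L : ∀ q′ → fromℕ q′ ≤ E → E < fromℕ (suc q′) →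
          ∃[ L ] (fromℕ L ≤ t / fromℕ 8 × t / fromℕ 8 < fromℕ (suc L)) → X ≤ K * hᶠ r G
        from-L q′ q′≤E E<q (zero , _ , t/8<1) = contradiction t/8<1
          (≤⇒≯ (x*z≤y⇒x≤y/z (0<fromℕ 8) (≤-trans (≈⇒≤ (trans (*-congʳ fromℕ-1) (*-identityˡ _))) 8≤t)))
        from-L q′ q′≤E E<q (suc l , L≤ , <1+L) = from-κ q′ l q′≤E E<q L≤ <1+L
          (2^-bracket (4 ℕ.* suc l) (ℕ.≤-trans (ℕ.s≤s (ℕ.s≤s ℕ.z≤n)) (ℕ.m≤m*n 4 (suc l))))
        from-q : ∃[ q′ ] (fromℕ q′ ≤ E × E < fromℕ (suc q′)) → X ≤ K * hᶠ r G
        from-q (q′ , q′≤E , E<q) = from-L q′ q′≤E E<q (floor (0≤/ (0≤χᶠ G) (0<fromℕ 8)))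

  eventually-large : ∀ j b {δ} → 0# < δ → δ < 1# / fromℕ (suc j) →
    (n : ℕ → ℕ) (G : ∀ N → Graph (n N)) (𝒦 : ∀ N → List (Subset (n N))) →
    let r = 2 ℕ.+ j
        t = λ N → χᶠ (G N)
        p = λ N → fromℕ N ^ (- 1# + δ)
    in
    TendsTo∞ t →
    (∀ N → IsCycleCliqueCover r (G N) (𝒦 N)) →
    Eventually (λ N → fromℕ (localOverlap (G N) (𝒦 N)) ≤ b) →
    Eventually (λ N → All (λ K → ∣ K ∣ ℕ.≤ N) (𝒦 N)) →
    TendsTo∞ (λ N → (p N * t N) / log (t N)) →
    Eventually (λ N → (p N * t N) / log (t N) ≤ K * hᶠ r (G N))
  eventually-large j b {δ} 0<δ δ<1/J n G 𝒦 t→∞ cover overlap≤b small X→∞ =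
    -- The maximum secures both `1 ≤ N` and `C ≤ N`, and the summand 1 in `1# + K₀` makes the lower
    -- bound for the ratio strict.
    mapᵉ bound ((1 ℕ.⊔ C , λ N le → le) ∧ᵉ (power-bound j 0<δ δ<1/J C ∧ᵉ (t→∞ (fromℕ 8) ∧ᵉ (X→∞ (1# + K₀) ∧ᵉ (overlap≤b ∧ᵉ small)))))
    where
    B C : ℕ
    B = proj₁ (archimedean b)
    C = 4 ℕ.* (2 ℕ.+ j) ℕ.* B
    bound : ∀ N →
      (1 ℕ.⊔ C ℕ.≤ N) ×
      (fromℕ C * fromℕ N Exp.^ j ≤ exp ((1# + - δ) * log (fromℕ N)) Exp.^ suc j) ×
      (fromℕ 8 ≤ χᶠ (G N)) ×
      (1# + K₀ ≤ (fromℕ N ^ (- 1# + δ) * χᶠ (G N)) / log (χᶠ (G N))) ×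
      (fromℕ (localOverlap (G N) (𝒦 N)) ≤ b) × All (λ K → ∣ K ∣ ℕ.≤ N) (𝒦 N) →
      (fromℕ N ^ (- 1# + δ) * χᶠ (G N)) / log (χᶠ (G N)) ≤ K * hᶠ (2 ℕ.+ j) (G N)
    bound N (N-large , power , 8≤t , X-large , overlap≤b , small) =
      large-hᶠ (G N) j (𝒦 N) B N (fromℕ N ^ (- 1# + δ)) (exp y) (cover N)
        (fromℕ-cancel-≤ (≤-trans overlap≤b (inj₁ (proj₂ (archimedean b))))) small
        1≤N (ℕ.≤-trans (ℕ.m≤n⊔m 1 C) N-large)
        (1≤exp 0≤y) (exp-neg 0≤y exponent) power 8≤t (<-≤-trans (x<1+x K₀) X-large)
      where
      1≤N : 1 ℕ.≤ N
      1≤N = ℕ.≤-trans (ℕ.m≤m⊔n 1 C) N-large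
      y : Carrier
      y = (1# + - δ) * log (fromℕ N)
      0≤y : 0# ≤ y
      0≤y = 0≤* (0≤1-δ j 0<δ δ<1/J) (0≤log 1≤N)
      exponent : (- 1# + δ) * log (fromℕ N) ≈ - y
      exponent = trans (*-congʳ (trans (+-congˡ (sym (-‿involutive δ))) (-‿+-comm 1# (- δ))))
        (sym (-‿distribˡ-* (1# + - δ) (log (fromℕ N))))

  K⁻¹*≤ : ∀ {x h} → x ≤ K * h → K ⁻¹ * x ≤ h
  K⁻¹*≤ x≤Kh = ≤-trans (≈⇒≤ (*-comm (K ⁻¹) _)) (x≤y*z⇒x/z≤y 0<K (≤-trans x≤Kh (≈⇒≤ (*-comm K _))))

  ≤-via-K : ∀ {m x h} → m * K ≤ x → x ≤ K * h → m ≤ h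
  ≤-via-K mK≤x x≤Kh = *-cancelʳ-≤ 0<K (≤-trans mK≤x (≤-trans x≤Kh (≈⇒≤ (*-comm K _))))

corollary9p18 : (ℝ : CompleteOrderedField) →
    let open CompleteOrderedField ℝ
        open RealAnalysis ℝ
        open FractionalColouring ℝ
    in
    (r : ℕ) → 4 ℕ.≤ r →
    (a b δ : Carrier) → 0# < a → 1# ≤ b → 0# < δ → δ < 1# / fromℕ (r ℕ.∸ 1) →
    ∃[ c ] (0# < c ×
      ((n : ℕ → ℕ) (G : ∀ N → Graph (n N)) (𝒦 : ∀ N → List (Subset (n N))) →
       let t = λ N → χᶠ (G N)
           p = λ N → fromℕ N ^ (- 1# + δ)
       in
       TendsTo∞ t →
       (∀ N → IsCycleCliqueCover r (G N) (𝒦 N)) →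
       Eventually (λ N → fromℕ (localOverlap (G N) (𝒦 N)) ≤ b) →
       Eventually (λ N → fromℕ (incidence (𝒦 N)) ≤ fromℕ N ^ a) →
       Eventually (λ N → All (λ K → ∣ K ∣ ℕ.≤ N) (𝒦 N)) →
       LittleO (λ N → χᶠ (uncovered (G N) (𝒦 N))) t →
       TendsTo∞ (λ N → (p N * t N) / log (t N)) →
       TendsTo∞ (λ N → hᶠ r (G N)) ×
       Eventually (λ N → c * ((p N * t N) / log (t N)) ≤ hᶠ r (G N))))
corollary9p18 ℝ (ℕ.suc ℕ.zero) (ℕ.s≤s ())
-- With r = 2 + j, the term `r ∸ 1` reduces to `suc j`. The constant `K ⁻¹` is numerically 1/16384.
corollary9p18 ℝ (ℕ.suc (ℕ.suc j)) _ a b δ _ _ 0<δ δ<1/J =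
  K ⁻¹ , 0<⁻¹ 0<K , λ n G 𝒦 t→∞ cover overlap≤b _ small _ X→∞ →
    let X≤Kh = eventually-large j b 0<δ δ<1/J n G 𝒦 t→∞ cover overlap≤b small X→∞ in
    (λ M → mapᵉ (λ N (MK≤X , X≤) → ≤-via-K MK≤X X≤) (X→∞ (M * K) ∧ᵉ X≤Kh)) ,
    mapᵉ (λ N → K⁻¹*≤) X≤Kh
  where
  open CompleteOrderedField ℝ
  open Reals ℝ
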